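{- For every finite graph $G$, $\bar\kappa(G;x,y)=R_G(x,y)$ as polynomials; equivalently, for all nonnegative integers $p,q$, $R_G(p,q)$ equals the number of triples $(\rho,f,g)$ where $\rho$ runs over a set of distinct representatives of the cut-Eulerian equivalence classes of $\mathcal O(G)$, $f$ is an integer-valued tension of $(G,\rho)$ with $0\le f(e)\le p$ for all $e$, and $g$ is an integer-valued flow of $(G,\rho)$ with $0\le g(e)\le q$ for all $e$.
   Context: $G=(V,E)$ is a finite graph, loops and multiple edges allowed; $c(\cdot)$ counts connected components; for $X\subseteq E$, $r(X)=|V|-c((V,X))$, $n(X)=|X|-r(X)$. Whitney's rank generating polynomial is $R_G(x,y)=\sum_{X\subseteq E}x^{r(E)-r(X)}y^{n(X)}$. An orientation chooses for each edge one of its two directions (loops also have two); $\mathcal O(G)$ is the set of orientations; $E(\rho\ne\sigma)$ is the set of edges where $\rho,\sigma$ differ. An integer flow $g$ of $(G,\rho)$ is $g:E\to\mathbb Z$ with, at each vertex, the sum over incoming edges equal to the sum over outgoing edges; an integer tension is $f:E\to\mathbb Z$ with $f(e)=h(u)-h(v)$ for each edge directed from $u$ to $v$, for some $h:V\to\mathbb Z$. A bond is a minimal nonempty edge set $[S,V\setminus S]$, directed if all its edges point the same way across. A locally directed cut is an edge set $[S,V\setminus S]$ with an orientation making it a disjoint union of directed bonds; a directed Eulerian subgraph is an edge set with an orientation having equal in- and out-degree at each vertex. $\rho\sim_{ce}\sigma$ (cut-Eulerian equivalent) if $E(\rho\ne\sigma)$, oriented by $\rho$, is a disjoint union of a locally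 directed cut and a directed Eulerian subgraph (either possibly empty); this is an equivalence relation on $\mathcal O(G)$. For $\rho\in\mathcal O(G)$ and nonnegative integers $p,q$, $\bar\kappa_\rho(G;p,q)$ is the number of pairs $(f,g)$ with $f$ an integer tension and $g$ an integer flow of $(G,\rho)$ with $0\le f\le p$, $0\le g\le q$ edgewise, and $\bar\kappa(G;p,q)=\sum_\rho\bar\kappa_\rho(G;p,q)$ over a set of distinct representatives $\rho$ of the cut-Eulerian classes (a polynomial in $p,q$, independent of the representatives). -}

module Defs where

open import Data.Nat using (ℕ; zero; suc; _+_; _*_; _∸_; _^_; _≤_)
open import Data.Integer as ℤ using (ℤ; +_; _-_)
open import Data.Bool using (Bool; true; false; _∧_; _∨_; not; _xor_; if_then_else_)
open import Data.Fin using (Fin; zero; suc; _≟_; _<_)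
open import Data.Fin.Properties using (_<?_)
open import Data.Vec using (Vec; []; _∷_; lookup)
open import Data.List using (List; []; _∷_; map; _++_)
open import Data.Nat.ListAction using (sum)
open import Data.List.Membership.Propositional using (_∈_)
open import Data.List.Relation.Unary.All using (All)
open import Data.List.Relation.Unary.Any using (Any)
open import Data.List.Relation.Unary.AllPairs using (AllPairs)
open import Data.Product using (Σ; Σ-syntax; _×_; _,_; proj₁; proj₂)
open import Data.Sum using (_⊎_)
open import Data.Empty using (⊥)
open import Relation.Nullary using (¬_; does)
open import Relation.Binary.PropositionalEquality using (_≡_)

-- Finite graphs: vertex set Fin n, edge set Fin m, each edge has an
-- (ordered, reference) pair of endpoints.  Loops (ends e = (v , v)) and
-- multiple edges are allowed.

Ends : ℕ → ℕ → Set
Ends n m = Fin m → Fin n × Fin n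

sumℕ : {k : ℕ} → (Fin k → ℕ) → ℕ
sumℕ {zero} f = 0
sumℕ {suc k} f = f zero + sumℕ (λ i → f (suc i))

sumℤ : {k : ℕ} → (Fin k → ℤ) → ℤ
sumℤ {zero} f = + 0
sumℤ {suc k} f = f zero ℤ.+ sumℤ (λ i → f (suc i))

anyF : {k : ℕ} → (Fin k → Bool) → Bool
anyF {zero} f = false
anyF {suc k} f = f zero ∨ anyF (λ i → f (suc i))

countF : {k : ℕ} → (Fin k → Bool) → ℕ
countF f = sumℕ (λ i → if f i then 1 else 0)

_==_ : {k : ℕ} → Fin k → Fin k → Bool
u == v = does (u ≟ v)

module _ {n m : ℕ} (ends : Ends n m) where

  adj : (Fin m → Bool) → Fin n → Fin n → Bool
  adj X u v = anyF (λ e → X e ∧ ((proj₁ (ends e) == u ∧ proj₂ (ends e) == v)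
                                 ∨ (proj₁ (ends e) == v ∧ proj₂ (ends e) == u)))

  reachIn : ℕ → (Fin m → Bool) → Fin n → Fin n → Bool
  reachIn zero X u v = u == v
  reachIn (suc k) X u v = reachIn k X u v ∨ anyF (λ w → reachIn k X u w ∧ adj X w v)

  reach : (Fin m → Bool) → Fin n → Fin n → Bool
  reach X = reachIn n X

  -- c((V,X)): number of components = number of vertices that are the
  -- least vertex of their component
  comps : (Fin m → Bool) → ℕ
  comps X = countF (λ v → not (anyF (λ w → does (w <? v) ∧ reach X w v)))

  rk : (Fin m → Bool) → ℕ
  rk X = n ∸ comps X

  nul : (Fin m → Bool) → ℕ
  nul X = countF X ∸ rk X

allVecBool : (k : ℕ) → List (Vec Bool k)
allVecBool zero = [] ∷ []
allVecBool (suc k) = map (true ∷_) (allVecBool k) ++ map (false ∷_) (allVecBool k)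

whitneyR : {n m : ℕ} → Ends n m → ℕ → ℕ → ℕ
whitneyR {n} {m} ends p q =
  sum (map (λ X → p ^ (rk ends (λ _ → true) ∸ rk ends (lookup X))
                  * q ^ nul ends (lookup X))
           (allVecBool m))

-- Orientations: ρ e = true  means e = (u , v) is directed u → v,
--               ρ e = false means it is directed v → u.
-- (A loop also has two orientations.)

Orientation : ℕ → Set
Orientation m = Vec Bool m

module _ {n m : ℕ} (ends : Ends n m) where

  tail : Orientation m → Fin m → Fin n
  tail ρ e = if lookup ρ e then proj₁ (ends e) else proj₂ (ends e)

  head : Orientation m → Fin m → Fin n
  head ρ e = if lookup ρ e then proj₂ (ends e) else proj₁ (ends e)

  EdgeSet : Set
  EdgeSet = Fin m → Bool

  VertexSet : Set
  VertexSet = Fin n → Bool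

  cutOf : VertexSet → EdgeSet
  cutOf S e = S (proj₁ (ends e)) xor S (proj₂ (ends e))

  IsCut : EdgeSet → Set
  IsCut A = Σ[ S ∈ VertexSet ] (∀ e → A e ≡ cutOf S e)

  NonEmpty : EdgeSet → Set
  NonEmpty A = Σ[ e ∈ Fin m ] A e ≡ true

  _⊆E_ : EdgeSet → EdgeSet → Set
  A ⊆E B = ∀ e → A e ≡ true → B e ≡ true

  DisjointE : EdgeSet → EdgeSet → Set
  DisjointE A B = ∀ e → A e ≡ true → B e ≡ true → ⊥

  IsBond : EdgeSet → Set
  IsBond A = IsCut A × NonEmpty A
           × (∀ B → IsCut B → NonEmpty B → B ⊆E A → ∀ e → B e ≡ A e)

  IsDirectedBond : Orientation m → EdgeSet → Set
  IsDirectedBond ρ B =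
    IsBond B ×
    Σ[ S ∈ VertexSet ] ((∀ e → B e ≡ cutOf S e) ×
       ((∀ e → B e ≡ true → S (tail ρ e) ≡ true)
        ⊎ (∀ e → B e ≡ true → S (head ρ e) ≡ true)))

  IsLocallyDirectedCut : Orientation m → EdgeSet → Set
  IsLocallyDirectedCut ρ C =
    IsCut C ×
    Σ[ Bs ∈ List EdgeSet ]
      (All (IsDirectedBond ρ) Bs × AllPairs DisjointE Bs
       × (∀ e → C e ≡ true → Any (λ B → B e ≡ true) Bs)
       × (∀ e → Any (λ B → B e ≡ true) Bs → C e ≡ true))

  IsDirectedEulerian : Orientation m → EdgeSet → Set
  IsDirectedEulerian ρ D =
    ∀ v → countF (λ e → D e ∧ head ρ e == v) ≡ countF (λ e → D e ∧ tail ρ e == v)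

  differ : Orientation m → Orientation m → EdgeSet
  differ ρ σ e = lookup ρ e xor lookup σ e

  _∼ce_ : Orientation m → Orientation m → Set
  ρ ∼ce σ = Σ[ C ∈ EdgeSet ] Σ[ D ∈ EdgeSet ]
    (IsLocallyDirectedCut ρ C × IsDirectedEulerian ρ D × DisjointE C D
     × (∀ e → differ ρ σ e ≡ true → (C e ≡ true ⊎ D e ≡ true))
     × (∀ e → (C e ≡ true ⊎ D e ≡ true) → differ ρ σ e ≡ true))

  IsSDR : List (Orientation m) → Set
  IsSDR reps = (∀ σ → Any (λ ρ → ρ ∼ce σ) reps)
             × AllPairs (λ ρ σ → ¬ (ρ ∼ce σ)) reps

  IsTension : Orientation m → (Fin m → ℤ) → Set
  IsTension ρ f = Σ[ h ∈ (Fin n → ℤ) ] (∀ e → f e ≡ h (tail ρ e) - h (head ρ e))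

  IsFlow : Orientation m → (Fin m → ℤ) → Set
  IsFlow ρ g = ∀ v → sumℤ (λ e → if head ρ e == v then g e else + 0)
                   ≡ sumℤ (λ e → if tail ρ e == v then g e else + 0)

  -- the triples (ρ , f , g) counted by κ̄(G; p, q); f, g are given by their
  -- (nonnegative) values as vectors of naturals
  Triple : Set
  Triple = Orientation m × Vec ℕ m × Vec ℕ m

  IsCounted : List (Orientation m) → ℕ → ℕ → Triple → Set
  IsCounted reps p q (ρ , f , g) =
    ρ ∈ reps
    × IsTension ρ (λ e → + lookup f e)
    × IsFlow ρ (λ e → + lookup g e)
    × (∀ e → lookup f e ≤ p)
    × (∀ e → lookup g e ≤ q)

{-# OPTIONS --safe #-}
module Submission where

-- Sign edges by the reference orientation and encode an orientation as s ∈ {0,1}^E.  A triple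
-- (ρ , f , g) becomes a point (s , F , G) with F a tension, G a flow, p(s-1) ≤ F ≤ ps and
-- q(s-1) ≤ G ≤ qs, and two orientations are cut-Eulerian equivalent iff s - s′ = φ + γ with φ an
-- integer tension and γ an integer flow: orthogonality then forces φ and γ to have values in
-- {0,±1} and disjoint supports.  So the triples over a set of representatives are the classes of
-- points modulo the translations (φ + γ , pφ , qγ).  These classes satisfy the deletion-contraction
-- recursion of R_G at an edge e.  For an ordinary e, a class of G/e extends to one class of G, with
-- s_e = 1, F_e = 0 and 0 ≤ G_e < q (if q = 0: with e in a directed cut); dually for G∖e; by Minty's
-- colouring lemma each class of G arises exactly once in this way.  This is uniform in p , q ≥ 0 and
-- symmetric under the exchange of tensions and flows, so bridges are dual to loops.

-- Both disjointness statements are sign arguments. If `s - s′ = φ + γ` has entries in {0,±1}, then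
-- `φ` and `γ` are never nonzero with the same sign at an edge; the products `φ e * γ e` are at most
-- 0, sum to 0, and so vanish. With the opposite sign, a directed cut avoids the support of `G` and
-- a directed cycle that of `F`; therefore every admissible translation of `s` carries `F` and `G`
-- along. For an ordinary edge, a flow of the contraction extends over the edge by a unique integer,
-- and flipping a directed cycle through the edge moves this integer by q; the interval from 0 to q
-- - 1 is thus a normal form. For q = 0 that interval is empty and the flips do not change the
-- integer. They still change `s`, so the normal form is the end of the chain of flips, where by
-- Minty's lemma the edge lies in a directed cut. The chain is finite because a tension with value 1
-- on the edge is a linear functional on `s` that moves by one at each flip and is bounded. No
-- quotient is formed: classes are counted by a family of pairwise inequivalent points that meets
-- each class.

open import Defs
open import Data.Nat as ℕ using (ℕ; zero; suc; z≤n; s≤s; _∸_)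
import Data.Nat.Properties as ℕ
open import Data.Nat.ListAction using (sum)
open import Data.Nat.ListAction.Properties using (sum-++)
open import Data.Integer as ℤ using (ℤ; +_; -[1+_]; _+_; _*_; -_; 0ℤ; 1ℤ; +≤+)
import Data.Integer.Properties as ℤ
open import Data.Integer.Tactic.RingSolver using (solve-∀)
open import Data.Bool using (Bool; true; false; not; _∧_; _∨_; _xor_; if_then_else_)
open import Data.Bool.Properties using (not-involutive; not-injective; ∨-identityʳ; ∧-zeroʳ; xor-comm; xor-same; xor-identityʳ)
open import Data.Fin as F using (Fin; zero; suc; toℕ; fromℕ<; splitAt; join; remQuot; combine)
import Data.Fin.Properties as F
open import Data.Fin.Induction using (<-wellFounded)
open import Induction.WellFounded using (Acc; acc)
open import Data.List as List using (List; []; _∷_; length; map; _++_)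
open import Data.List.Properties using (map-++; map-∘; map-cong; length-tabulate)
open import Data.List.Membership.Propositional using (_∈_; find; lose)
open import Data.List.Membership.Propositional.Properties using (∈-lookup; ∈-tabulate⁺; ∈-tabulate⁻)
open import Data.List.Relation.Unary.All as All using (All; []; _∷_)
open import Data.List.Relation.Unary.AllPairs using (AllPairs; []; _∷_)
open import Data.List.Relation.Unary.Any using (Any; here; there; index)
open import Data.List.Relation.Unary.Any.Properties using (lookup-index)
open import Data.List.Relation.Unary.Unique.Propositional using (Unique)
open import Data.List.Relation.Unary.Unique.Propositional.Properties using (tabulate⁺)
open import Data.List.Relation.Binary.Subset.Propositional using (_⊆_)
open import Data.List.Relation.Binary.Subset.Propositional.Properties using (xs⊆x∷xs; ⊆-refl; ⊆-trans)
open import Data.List.Relation.Binary.Permutation.Propositional as Perm using (_↭_; ↭-refl; ↭-trans; ↭-sym)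
open import Data.List.Relation.Binary.Permutation.Propositional.Properties using (∈-resp-↭)
open import Data.Vec as Vec using (Vec; []; _∷_; lookup; tabulate)
open import Data.Vec.Properties using (lookup-replicate; lookup∘tabulate; tabulate∘lookup; tabulate-cong)
open import Data.Product using (Σ; Σ-syntax; _×_; _,_; proj₁; proj₂)
open import Data.Sum using (_⊎_; inj₁; inj₂; swap; [_,_]′)
open import Data.Empty using (⊥; ⊥-elim)
open import Data.Unit using (⊤; tt)
open import Function using (_∘_; id)
open import Relation.Nullary using (yes; no; does)
open import Relation.Nullary.Decidable using (dec-true; dec-false)
open import Relation.Binary using (tri<; tri≈; tri>)
open import Relation.Binary.PropositionalEquality using (_≡_; _≢_; _≗_; refl; sym; trans; cong; cong₂; subst; module ≡-Reasoning)

-- Booleans and counting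

true≢false : {A : Set} → true ≡ false → A
true≢false ()

¬true⇒false : ∀ {b} → (b ≡ true → ⊥) → b ≡ false
¬true⇒false {false} _ = refl
¬true⇒false {true} h = ⊥-elim (h refl)

¬false⇒true : ∀ {b} → (b ≡ false → ⊥) → b ≡ true
¬false⇒true {true} _ = refl
¬false⇒true {false} h = ⊥-elim (h refl)

false⇒¬true : ∀ {b} → b ≡ false → b ≡ true → ⊥
false⇒¬true refl ()

not-true : ∀ {b} → not b ≡ true → b ≡ false
not-true {false} _ = refl

⇔⇒≡ : ∀ {a b} → (a ≡ true → b ≡ true) → (b ≡ true → a ≡ true) → a ≡ b
⇔⇒≡ {true} h _ = sym (h refl)
⇔⇒≡ {false} {false} _ _ = refl
⇔⇒≡ {false} {true} _ h = h refl

∧-true : ∀ {a b} → a ∧ b ≡ true → a ≡ true × b ≡ true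
∧-true {true} {true} _ = refl , refl

∨-true : ∀ {a b} → a ∨ b ≡ true → a ≡ true ⊎ b ≡ true
∨-true {true} _ = inj₁ refl
∨-true {false} h = inj₂ h

∨-introˡ : ∀ {a b} → a ≡ true → a ∨ b ≡ true
∨-introˡ refl = refl

∨-introʳ : ∀ {a b} → b ≡ true → a ∨ b ≡ true
∨-introʳ {true} refl = refl
∨-introʳ {false} refl = refl

==⇒≡ : ∀ {k} {u v : Fin k} → (u == v) ≡ true → u ≡ v
==⇒≡ {u = u} {v} h with u F.≟ v
... | yes eq = eq

==-refl : ∀ {k} (u : Fin k) → (u == u) ≡ true
==-refl u = dec-true (u F.≟ u) refl

anyF-elim : ∀ {k} (f : Fin k → Bool) → anyF f ≡ true → Σ[ i ∈ Fin k ] f i ≡ true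
anyF-elim {suc k} f h with ∨-true {f zero} h
... | inj₁ p = zero , p
... | inj₂ p = let (i , q) = anyF-elim (f ∘ suc) p in suc i , q

anyF-intro : ∀ {k} (f : Fin k → Bool) i → f i ≡ true → anyF f ≡ true
anyF-intro f zero h = ∨-introˡ h
anyF-intro f (suc i) h = ∨-introʳ {f zero} (anyF-intro (f ∘ suc) i h)

bit : Bool → ℕ
bit b = if b then 1 else 0

countF-cong : ∀ {k} {f g : Fin k → Bool} → f ≗ g → countF f ≡ countF g
countF-cong {zero} h = refl
countF-cong {suc k} h = cong₂ ℕ._+_ (cong bit (h zero)) (countF-cong (h ∘ suc))

bit-mono : ∀ {a b} → (a ≡ true → b ≡ true) → bit a ℕ.≤ bit b
bit-mono {false} h = z≤n
bit-mono {true} h rewrite h refl = ℕ.≤-refl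

countF-mono : ∀ {k} (f g : Fin k → Bool) → (∀ i → f i ≡ true → g i ≡ true) → countF f ℕ.≤ countF g
countF-mono {zero} f g h = z≤n
countF-mono {suc k} f g h = ℕ.+-mono-≤ (bit-mono (h zero)) (countF-mono (f ∘ suc) (g ∘ suc) (h ∘ suc))

countF-mono-< : ∀ {k} (f g : Fin k → Bool) → (∀ i → f i ≡ true → g i ≡ true) →
  ∀ v → f v ≡ false → g v ≡ true → countF f ℕ.< countF g
countF-mono-< f g h zero fv gv rewrite fv | gv = s≤s (countF-mono (f ∘ suc) (g ∘ suc) (h ∘ suc))
countF-mono-< f g h (suc v) fv gv = ℕ.+-mono-≤-< (bit-mono (h zero)) (countF-mono-< (f ∘ suc) (g ∘ suc) (h ∘ suc) v fv gv)

countF-drop : ∀ {k} (f g : Fin k → Bool) v → f v ≡ true → g v ≡ false →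
  (∀ i → i ≢ v → f i ≡ g i) → countF f ≡ suc (countF g)
countF-drop f g zero fv gv h rewrite fv | gv = cong suc (countF-cong (λ i → h (suc i) λ ()))
countF-drop f g (suc v) fv gv h = trans
  (cong₂ ℕ._+_ (cong bit (h zero λ ())) (countF-drop (f ∘ suc) (g ∘ suc) v fv gv (λ i ne → h (suc i) (ne ∘ F.suc-injective))))
  (ℕ.+-suc (bit (g zero)) _)

countF-all : ∀ {k} (f : Fin k → Bool) → (∀ i → f i ≡ true) → countF f ≡ k
countF-all {zero} f h = refl
countF-all {suc k} f h rewrite h zero = cong suc (countF-all (f ∘ suc) (h ∘ suc))

countF≤ : ∀ {k} (f : Fin k → Bool) → countF f ℕ.≤ k
countF≤ {k} f = ℕ.≤-trans (countF-mono f (λ _ → true) (λ _ _ → refl)) (ℕ.≤-reflexive (countF-all {k} (λ _ → true) (λ _ → refl)))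

-- Reachability along a set of edges

module _ {n m : ℕ} (ends : Ends n m) (X : Fin m → Bool) where

  Crosses : (Fin n → Set) → Set
  Crosses P = ∀ e → X e ≡ true → (P (proj₁ (ends e)) → P (proj₂ (ends e))) × (P (proj₂ (ends e)) → P (proj₁ (ends e)))

  joins : Fin n → Fin n → Fin m → Bool
  joins u v e = X e ∧ ((proj₁ (ends e) == u ∧ proj₂ (ends e) == v) ∨ (proj₁ (ends e) == v ∧ proj₂ (ends e) == u))

  via : ℕ → Fin n → Fin n → Fin n → Bool
  via k u v w = reachIn ends k X u w ∧ adj ends X w v

  adj-elim : ∀ {u v} → adj ends X u v ≡ true →
    Σ[ e ∈ Fin m ] X e ≡ true × (ends e ≡ (u , v) ⊎ ends e ≡ (v , u))
  adj-elim {u} {v} h with anyF-elim (joins u v) h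
  ... | e , p with ∧-true {X e} p
  ... | Xe , q = e , Xe , [ (λ r → inj₁ (both r)) , (λ r → inj₂ (both r)) ]′
      (∨-true {proj₁ (ends e) == u ∧ proj₂ (ends e) == v} q)
    where
    both : ∀ {a b : Fin n} {x y} → (x == a) ∧ (y == b) ≡ true → (x , y) ≡ (a , b)
    both {a} {x = x} h = let (p , q) = ∧-true {x == a} h in cong₂ _,_ (==⇒≡ p) (==⇒≡ q)

  adj-intro₁ : ∀ e → X e ≡ true → adj ends X (proj₁ (ends e)) (proj₂ (ends e)) ≡ true
  adj-intro₁ e h = anyF-intro (joins _ _) e (trans (cong (_∧ _) h)
    (∨-introˡ (cong₂ _∧_ (==-refl (proj₁ (ends e))) (==-refl (proj₂ (ends e))))))

  adj-intro₂ : ∀ e → X e ≡ true → adj ends X (proj₂ (ends e)) (proj₁ (ends e)) ≡ true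
  adj-intro₂ e h = anyF-intro (joins _ _) e (trans (cong (_∧ _) h)
    (∨-introʳ {proj₁ (ends e) == proj₂ (ends e) ∧ proj₂ (ends e) == proj₁ (ends e)}
        (cong₂ _∧_ (==-refl (proj₁ (ends e))) (==-refl (proj₂ (ends e))))))

  reachIn-ind : (P : Fin n → Set) → Crosses P → ∀ k {u v} → reachIn ends k X u v ≡ true → P u → P v
  reachIn-ind P cr zero h Pu = subst P (==⇒≡ h) Pu
  reachIn-ind P cr (suc k) {u} {v} h Pu with ∨-true {reachIn ends k X u v} h
  ... | inj₁ p = reachIn-ind P cr k p Pu
  ... | inj₂ p with anyF-elim (via k u v) p
  ...   | w , q with ∧-true {reachIn ends k X u w} q
  ...     | r , a with adj-elim a
  ...       | e , Xe , inj₁ eq = subst P (cong proj₂ eq)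
      (proj₁ (cr e Xe) (subst P (sym (cong proj₁ eq)) (reachIn-ind P cr k r Pu)))
  ...       | e , Xe , inj₂ eq = subst P (cong proj₁ eq)
      (proj₂ (cr e Xe) (subst P (sym (cong proj₂ eq)) (reachIn-ind P cr k r Pu)))

  reach-ind : (P : Fin n → Set) → Crosses P → ∀ {u v} → reach ends X u v ≡ true → P u → P v
  reach-ind P cr = reachIn-ind P cr n

  module _ (u : Fin n) where
    private
      R : ℕ → Fin n → Bool
      R k v = reachIn ends k X u v

      Stable : ℕ → Set
      Stable k = ∀ v → R (suc k) v ≡ true → R k v ≡ true

      stable-suc : ∀ k → Stable k → Stable (suc k)
      stable-suc k st v h with ∨-true {R (suc k) v} h
      ... | inj₁ p = p
      ... | inj₂ p with anyF-elim (via (suc k) u v) p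
      ...   | w , q with ∧-true {R (suc k) w} q
      ...     | r , a = ∨-introʳ {R k v} (anyF-intro (via k u v) w (cong₂ _∧_ (st w r) a))

      fresh : ℕ → Fin n → Bool
      fresh k v = R (suc k) v ∧ not (R k v)

      -- A round that is not stable adds a vertex, so without stability round `k` contains more than
      -- `k` vertices. This is impossible at `k = n`, which is why `n` rounds suffice in the
      -- definition of `reach`.
      stable-or-large : ∀ k → Stable k ⊎ k ℕ.< countF (R k)
      stable-or-large zero = inj₂ (subst (ℕ._< countF (R 0)) (none n)
          (countF-mono-< (λ _ → false) (R 0) (λ _ ()) u refl (==-refl u)))
        where
        none : ∀ k → countF {k} (λ _ → false) ≡ 0
        none zero = refl
        none (suc k) = none k
      stable-or-large (suc k) with stable-or-large k
      ... | inj₁ st = inj₁ (stable-suc k st)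
      ... | inj₂ lt with anyF (fresh k) in eq
      ...   | false = inj₁ (stable-suc k λ v h → ¬false⇒true (λ Rk →
                false⇒¬true eq (anyF-intro (fresh k) v (cong₂ _∧_ h (cong not Rk)))))
      ...   | true with anyF-elim (fresh k) eq
      ...     | v , p with ∧-true {R (suc k) v} p
      ...       | new , old = inj₂ (ℕ.≤-<-trans lt
                    (countF-mono-< (R k) (R (suc k)) (λ i → ∨-introˡ) v (not-true old) new))

      stable : Stable n
      stable with stable-or-large n
      ... | inj₁ st = st
      ... | inj₂ lt = ⊥-elim (ℕ.<⇒≱ lt (countF≤ (R n)))

      R-mono : ∀ k v → R 0 v ≡ true → R k v ≡ true
      R-mono zero v h = h
      R-mono (suc k) v h = ∨-introˡ (R-mono k v h)

    reach-refl : reach ends X u u ≡ true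
    reach-refl = R-mono n u (==-refl u)

    reach-crosses : Crosses (λ v → reach ends X u v ≡ true)
    reach-crosses e Xe =
        (λ h → stable _ (∨-introʳ {R n (proj₂ (ends e))}
            (anyF-intro (via n u (proj₂ (ends e))) (proj₁ (ends e)) (cong₂ _∧_ h (adj-intro₁ e Xe)))))
      , (λ h → stable _ (∨-introʳ {R n (proj₁ (ends e))}
          (anyF-intro (via n u (proj₁ (ends e))) (proj₂ (ends e)) (cong₂ _∧_ h (adj-intro₂ e Xe)))))

  reach-trans : ∀ {u v w} → reach ends X u v ≡ true → reach ends X v w ≡ true → reach ends X u w ≡ true
  reach-trans {u} h k = reach-ind (λ v → reach ends X u v ≡ true) (reach-crosses u) k h

  reach-sym : ∀ {u v} → reach ends X u v ≡ true → reach ends X v u ≡ true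
  reach-sym {u} h = reach-ind (λ v → reach ends X v u ≡ true)
    (λ e Xe → (λ k → reach-trans (proj₂ (reach-crosses (proj₂ (ends e)) e Xe) (reach-refl _)) k)
            , (λ k → reach-trans (proj₁ (reach-crosses (proj₁ (ends e)) e Xe) (reach-refl _)) k))
    h (reach-refl u)

full : ∀ m → Vec Bool m
full m = Vec.replicate m true

-- Components of a list of edges, and the recursion of the rank generating polynomial

BoolRel : ℕ → Set
BoolRel n = Fin n → Fin n → Bool

<?⇒< : ∀ {k} {w v : Fin k} → does (w F.<? v) ≡ true → w F.< v
<?⇒< {w = w} {v} h with w F.<? v
... | yes lt = lt
... | no ≮ = true≢false (trans (sym h) (dec-false (w F.<? v) ≮))

smaller : ∀ {n} → BoolRel n → Fin n → Fin n → Bool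
smaller R v w = does (w F.<? v) ∧ R w v

isRoot : ∀ {n} → BoolRel n → Fin n → Bool
isRoot R v = not (anyF (smaller R v))

-- `comps ends X` unfolds to `roots (reach ends X)`. Keeping the relation as a parameter allows the
-- components of differently presented graphs to be compared.
roots : ∀ {n} → BoolRel n → ℕ
roots R = countF (isRoot R)

isRoot-elim : ∀ {n} {R : BoolRel n} {v w} → isRoot R v ≡ true → w F.< v → R w v ≡ true → ⊥
isRoot-elim {R = R} {v} {w} h lt r = true≢false (trans (sym h) (cong not
  (anyF-intro (smaller R v) w (cong₂ _∧_ (dec-true (w F.<? v) lt) r))))

isRoot-intro : ∀ {n} {R : BoolRel n} {v} → (∀ w → w F.< v → R w v ≡ true → ⊥) → isRoot R v ≡ true
isRoot-intro {R = R} {v} h = cong not (¬true⇒false λ p →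
  let (w , q) = anyF-elim (smaller R v) p ; (lt , r) = ∧-true {does (w F.<? v)} q in h w (<?⇒< {v = v} lt) r)

isRoot-false : ∀ {n} {R : BoolRel n} {v} → isRoot R v ≡ false → Σ[ w ∈ Fin n ] w F.< v × R w v ≡ true
isRoot-false {R = R} {v} h with anyF (smaller R v) in eq
... | true with anyF-elim (smaller R v) eq
...   | w , p with ∧-true {does (w F.<? v)} p
...     | lt , r = w , <?⇒< {v = v} lt , r

roots-mono : ∀ {n} {R R′ : BoolRel n} → (∀ x y → R x y ≡ true → R′ x y ≡ true) → roots R′ ℕ.≤ roots R
roots-mono {R = R} {R′} h = countF-mono (isRoot R′) (isRoot R)
    (λ v r → isRoot-intro {R = R} (λ w lt q → isRoot-elim {R = R′} r lt (h w v q)))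

roots-cong : ∀ {n} {R R′ : BoolRel n} → (∀ x y → R x y ≡ true → R′ x y ≡ true) →
  (∀ x y → R′ x y ≡ true → R x y ≡ true) → roots R ≡ roots R′
roots-cong h k = ℕ.≤-antisym (roots-mono k) (roots-mono h)

-- What the equivalence `R` becomes when the classes of `a` and `b` are merged.
Joined : ∀ {n} → BoolRel n → Fin n → Fin n → Fin n → Fin n → Set
Joined R a b x y = R x y ≡ true ⊎ (R x a ≡ true × R b y ≡ true ⊎ R x b ≡ true × R a y ≡ true)

module _ {n} (R : BoolRel n) (R-refl : ∀ x → R x x ≡ true)
  (R-sym : ∀ {x y} → R x y ≡ true → R y x ≡ true)
  (R-trans : ∀ {x y z} → R x y ≡ true → R y z ≡ true → R x z ≡ true) where

  root : ∀ x → Σ[ r ∈ Fin n ] R r x ≡ true × isRoot R r ≡ true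
  root x = go x (<-wellFounded x)
    where
    go : ∀ x → Acc F._<_ x → Σ[ r ∈ Fin n ] R r x ≡ true × isRoot R r ≡ true
    go x (acc rec) with isRoot R x in eq
    ... | true = x , R-refl x , eq
    ... | false with isRoot-false {R = R} eq
    ...   | w , lt , r with go w (rec lt)
    ...     | r₀ , q , is = r₀ , R-trans q r , is

  root-unique : ∀ {x y} → isRoot R x ≡ true → isRoot R y ≡ true → R x y ≡ true → x ≡ y
  root-unique {x} {y} p q r with F.<-cmp x y
  ... | tri< lt _ _ = ⊥-elim (isRoot-elim {R = R} q lt r)
  ... | tri≈ _ eq _ = eq
  ... | tri> _ _ gt = ⊥-elim (isRoot-elim {R = R} p gt (R-sym r))

  module _ {R′ : BoolRel n} where

    -- Of the two merged classes only the one with the larger least element loses its root; every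
    -- other least element remains least.
    roots-join-< : ∀ {a b a₀ b₀} → R a₀ a ≡ true → R b₀ b ≡ true → isRoot R a₀ ≡ true → isRoot R b₀ ≡ true →
      a₀ F.< b₀ → (∀ x y → R′ x y ≡ true → Joined R a b x y) → (∀ x y → Joined R a b x y → R′ x y ≡ true) →
      roots R ≡ suc (roots R′)
    roots-join-< {a} {b} {a₀} {b₀} ra rb roota rootb lt to from = countF-drop (isRoot R) (isRoot R′) b₀ rootb
      (¬true⇒false λ h → isRoot-elim {R = R′} h lt (from a₀ b₀ (inj₂ (inj₁ (ra , R-sym rb)))))
      (λ v v≢b₀ → ⇔⇒≡
        (λ h → isRoot-intro {R = R′} λ w w<v r → case v v≢b₀ h w w<v (to w v r))
        (λ h → isRoot-intro {R = R} λ w w<v r → isRoot-elim {R = R′} h w<v (from w v (inj₁ r))))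
      where
      case : ∀ v → v ≢ b₀ → isRoot R v ≡ true → ∀ w → w F.< v → Joined R a b w v → ⊥
      case v _ h w w<v (inj₁ r) = isRoot-elim {R = R} h w<v r
      case v ne h w w<v (inj₂ (inj₁ (_ , bv))) = ne (root-unique h rootb (R-sym (R-trans rb bv)))
      case v _ h w w<v (inj₂ (inj₂ (wb , av))) =
        isRoot-elim {R = R} rootb (F.<-trans (subst (w F.<_) v≡a₀ w<v) lt) (R-trans wb (R-sym rb))
        where
        v≡a₀ : v ≡ a₀
        v≡a₀ = root-unique h roota (R-sym (R-trans ra av))

    roots-join : ∀ {a b} → R a b ≡ false → (∀ x y → R′ x y ≡ true → Joined R a b x y) →
      (∀ x y → Joined R a b x y → R′ x y ≡ true) → roots R ≡ suc (roots R′)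
    roots-join {a} {b} ab to from with root a | root b
    ... | a₀ , ra , roota | b₀ , rb , rootb with F.<-cmp a₀ b₀
    ... | tri< lt _ _ = roots-join-< ra rb roota rootb lt to from
    ... | tri≈ _ refl _ = true≢false (trans (sym (R-trans (R-sym ra) rb)) ab)
    ... | tri> _ _ gt = roots-join-< rb ra rootb roota gt (λ x y → flip ∘ to x y) (λ x y → from x y ∘ flip)
      where
      flip : ∀ {a b x y} → Joined R a b x y → Joined R b a x y
      flip (inj₁ r) = inj₁ r
      flip (inj₂ (inj₁ r)) = inj₂ (inj₂ r)
      flip (inj₂ (inj₂ r)) = inj₂ (inj₁ r)

module _ {n : ℕ} where

  Edges : Set
  Edges = List (Fin n × Fin n)

  Joins : (Fin n → Set) → Fin n × Fin n → Set
  Joins P (a , b) = (P a → P b) × (P b → P a)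

  conn : Edges → BoolRel n
  conn L = reach (List.lookup L) (λ _ → true)

  conn-ind : ∀ {L} (P : Fin n → Set) → All (Joins P) L → ∀ {u v} → conn L u v ≡ true → P u → P v
  conn-ind {L} P h = reach-ind (List.lookup L) _ P (λ e _ → All.lookup h (∈-lookup e))

  conn-refl : ∀ L u → conn L u u ≡ true
  conn-refl L = reach-refl (List.lookup L) _

  conn-sym : ∀ {L u v} → conn L u v ≡ true → conn L v u ≡ true
  conn-sym {L} = reach-sym (List.lookup L) _

  conn-trans : ∀ {L u v w} → conn L u v ≡ true → conn L v w ≡ true → conn L u w ≡ true
  conn-trans {L} = reach-trans (List.lookup L) _

  conn-joins : ∀ L u → All (Joins (λ v → conn L u v ≡ true)) L
  conn-joins L u = All.tabulate λ {p} i → subst (Joins (λ v → conn L u v ≡ true)) (sym (lookup-index i))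
    (reach-crosses (List.lookup L) _ u (index i) refl)

  conn-edge : ∀ {L a b} → (a , b) ∈ L → conn L a b ≡ true
  conn-edge {L} {a} i = proj₁ (All.lookup (conn-joins L a) i) (conn-refl L a)

  conn-mono : ∀ {L L′} → L ⊆ L′ → ∀ x y → conn L x y ≡ true → conn L′ x y ≡ true
  conn-mono {L} {L′} sub x y h = conn-ind (λ y → conn L′ x y ≡ true)
    (All.tabulate (λ i → All.lookup (conn-joins L′ x) (sub i))) h (conn-refl L′ x)

  c : Edges → ℕ
  c L = roots (conn L)

  c-mono : ∀ {L L′} → L ⊆ L′ → c L′ ℕ.≤ c L
  c-mono sub = roots-mono (conn-mono sub)

  c-↭ : ∀ {L L′} → L ↭ L′ → c L ≡ c L′
  c-↭ p = ℕ.≤-antisym (c-mono (∈-resp-↭ (↭-sym p))) (c-mono (∈-resp-↭ p))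

  conn-joined : ∀ L a b x y → conn ((a , b) ∷ L) x y ≡ true → Joined (conn L) a b x y
  conn-joined L a b x y h = conn-ind (Joined (conn L) a b x) (ab ∷ All.tabulate λ {p} i → step i) h (inj₁ (conn-refl L x))
    where
    J = Joined (conn L) a b x
    ab : Joins J (a , b)
    ab = (λ { (inj₁ r) → inj₂ (inj₁ (r , conn-refl L b)) ; (inj₂ (inj₁ (r , _))) → inj₂ (inj₁ (r , conn-refl L b))
            ; (inj₂ (inj₂ (r , _))) → inj₁ r })
       , (λ { (inj₁ r) → inj₂ (inj₂ (r , conn-refl L a)) ; (inj₂ (inj₂ (r , _))) → inj₂ (inj₂ (r , conn-refl L a))
            ; (inj₂ (inj₁ (r , _))) → inj₁ r })
    ext : ∀ {y z} → conn L y z ≡ true → J y → J z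
    ext yz (inj₁ r) = inj₁ (conn-trans {L} r yz)
    ext yz (inj₂ (inj₁ (r , t))) = inj₂ (inj₁ (r , conn-trans {L} t yz))
    ext yz (inj₂ (inj₂ (r , t))) = inj₂ (inj₂ (r , conn-trans {L} t yz))
    step : ∀ {p} → p ∈ L → Joins J p
    step i = ext (conn-edge i) , ext (conn-sym {L} (conn-edge i))

  joined-conn : ∀ L a b x y → Joined (conn L) a b x y → conn ((a , b) ∷ L) x y ≡ true
  joined-conn L a b x y j = go j
    where
    L′ = (a , b) ∷ L
    up : ∀ {x y} → conn L x y ≡ true → conn L′ x y ≡ true
    up = conn-mono (xs⊆x∷xs L (a , b)) _ _
    ab : conn L′ a b ≡ true
    ab = conn-edge (here refl)
    go : Joined (conn L) a b x y → conn L′ x y ≡ true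
    go (inj₁ r) = up r
    go (inj₂ (inj₁ (r , t))) = conn-trans {L′} (up r) (conn-trans {L′} ab (up t))
    go (inj₂ (inj₂ (r , t))) = conn-trans {L′} (up r) (conn-trans {L′} (conn-sym {L′} ab) (up t))

  c-new : ∀ L a b → conn L a b ≡ false → c L ≡ suc (c ((a , b) ∷ L))
  c-new L a b h = roots-join (conn L) (conn-refl L) (conn-sym {L}) (conn-trans {L}) h (conn-joined L a b) (joined-conn L a b)

  c-old : ∀ L a b → conn L a b ≡ true → c ((a , b) ∷ L) ≡ c L
  c-old L a b h = roots-cong (λ x y → drop ∘ conn-joined L a b x y) (conn-mono (xs⊆x∷xs L (a , b)))
    where
    drop : ∀ {x y} → Joined (conn L) a b x y → conn L x y ≡ true
    drop (inj₁ r) = r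
    drop (inj₂ (inj₁ (r , t))) = conn-trans {L} r (conn-trans {L} h t)
    drop (inj₂ (inj₂ (r , t))) = conn-trans {L} r (conn-trans {L} (conn-sym {L} h) t)

  c-[] : c [] ≡ n
  c-[] = countF-all (isRoot (conn [])) λ v → isRoot-intro {R = conn []} λ w lt h →
    F.<-irrefl (conn-ind (w ≡_) [] h refl) lt

  c-step : ∀ L e → c L ℕ.≤ suc (c (e ∷ L))
  c-step L (a , b) with conn L a b in eq
  ... | false = ℕ.≤-reflexive (c-new L a b eq)
  ... | true = ℕ.≤-trans (ℕ.≤-reflexive (sym (c-old L a b eq))) (ℕ.n≤1+n _)

  -- `con` is an accumulator, so that choosing the first edge and contracting it lead to literally
  -- the same list. The vertex set is never changed by a contraction.
  addE : ∀ {m} → Ends n m → Vec Bool m → Edges → Edges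
  addE ends [] con = con
  addE ends (true ∷ X) con = addE (ends ∘ suc) X (ends zero ∷ con)
  addE ends (false ∷ X) con = addE (ends ∘ suc) X con

  addE-cong : ∀ {m} (ends : Ends n m) X {con con′} → con ↭ con′ → addE ends X con ↭ addE ends X con′
  addE-cong ends [] p = p
  addE-cong ends (true ∷ X) p = addE-cong (ends ∘ suc) X (Perm.prep _ p)
  addE-cong ends (false ∷ X) p = addE-cong (ends ∘ suc) X p

  addE-∷ : ∀ {m} (ends : Ends n m) X e con → addE ends X (e ∷ con) ↭ e ∷ addE ends X con
  addE-∷ ends [] e con = ↭-refl
  addE-∷ ends (true ∷ X) e con = ↭-trans (addE-cong (ends ∘ suc) X (Perm.swap _ _ ↭-refl)) (addE-∷ (ends ∘ suc) X e _)
  addE-∷ ends (false ∷ X) e con = addE-∷ (ends ∘ suc) X e con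

  addE-⊆ : ∀ {m} (ends : Ends n m) X con → con ⊆ addE ends X con
  addE-⊆ ends [] con = ⊆-refl
  addE-⊆ ends (true ∷ X) con = ⊆-trans (xs⊆x∷xs con _) (addE-⊆ (ends ∘ suc) X _)
  addE-⊆ ends (false ∷ X) con = addE-⊆ (ends ∘ suc) X con

  addE-full : ∀ {m} (ends : Ends n m) X con → addE ends X con ⊆ addE ends (full m) con
  addE-full ends [] con = ⊆-refl
  addE-full ends (true ∷ X) con = addE-full (ends ∘ suc) X _
  addE-full ends (false ∷ X) con = ⊆-trans (addE-full (ends ∘ suc) X con)
    (⊆-trans (xs⊆x∷xs _ _) (∈-resp-↭ (↭-sym (addE-∷ (ends ∘ suc) (full _) (ends zero) con))))

  ∈-addE : ∀ {m} (ends : Ends n m) X con e → lookup X e ≡ true → ends e ∈ addE ends X con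
  ∈-addE ends (true ∷ X) con zero h = addE-⊆ (ends ∘ suc) X _ (here refl)
  ∈-addE ends (true ∷ X) con (suc e) h = ∈-addE (ends ∘ suc) X _ e h
  ∈-addE ends (false ∷ X) con (suc e) h = ∈-addE (ends ∘ suc) X con e h

  All-addE : ∀ {m} {P : Fin n × Fin n → Set} (ends : Ends n m) X {con} →
    (∀ e → lookup X e ≡ true → P (ends e)) → All P con → All P (addE ends X con)
  All-addE ends [] h ps = ps
  All-addE ends (true ∷ X) h ps = All-addE (ends ∘ suc) X (h ∘ suc) (h zero refl ∷ ps)
  All-addE ends (false ∷ X) h ps = All-addE (ends ∘ suc) X (h ∘ suc) ps

  -- Each edge lowers the number of components by at most one. This makes the truncated subtraction
  -- in the exponent of `q` exact.
  c-lower : ∀ {m} (ends : Ends n m) X con → c con ℕ.≤ countF (lookup X) ℕ.+ c (addE ends X con)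
  c-lower ends [] con = ℕ.≤-refl
  c-lower ends (true ∷ X) con = ℕ.≤-trans (c-step con (ends zero)) (s≤s (c-lower (ends ∘ suc) X _))
  c-lower ends (false ∷ X) con = c-lower (ends ∘ suc) X con

  comps≡c : ∀ {m} (ends : Ends n m) (Y : Fin m → Bool) X → (∀ e → Y e ≡ lookup X e) → comps ends Y ≡ c (addE ends X [])
  comps≡c ends Y X eq = roots-cong {R = reach ends Y} {conn L}
    (λ x y h → reach-ind ends Y (λ y → conn L x y ≡ true)
       (λ e Ye → All.lookup (conn-joins L x) (∈-addE ends X [] e (trans (sym (eq e)) Ye))) h (conn-refl L x))
    (λ x y h → conn-ind {L} (λ y → reach ends Y x y ≡ true)
       (All-addE ends X (λ e Xe → reach-crosses ends Y x e (trans (eq e) Xe)) []) h (reach-refl ends Y x))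
    where L = addE ends X []

-- Deletion and contraction for the rank generating polynomial

sum-map-* : ∀ {A : Set} k (f : A → ℕ) xs → sum (map (λ x → k ℕ.* f x) xs) ≡ k ℕ.* sum (map f xs)
sum-map-* k f [] = sym (ℕ.*-zeroʳ k)
sum-map-* k f (x ∷ xs) = trans (cong (k ℕ.* f x ℕ.+_) (sum-map-* k f xs)) (sym (ℕ.*-distribˡ-+ k (f x) _))

∸-∸-swap : ∀ n a b → b ℕ.≤ n → (n ∸ a) ∸ (n ∸ b) ≡ b ∸ a
∸-∸-swap n a b b≤n = begin
  (n ∸ a) ∸ (n ∸ b)   ≡⟨ ℕ.∸-+-assoc n a (n ∸ b) ⟩
  n ∸ (a ℕ.+ (n ∸ b))   ≡⟨ cong (n ∸_) (ℕ.+-comm a (n ∸ b)) ⟩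
  n ∸ ((n ∸ b) ℕ.+ a)   ≡⟨ ℕ.∸-+-assoc n (n ∸ b) a ⟨
  (n ∸ (n ∸ b)) ∸ a   ≡⟨ cong (_∸ a) (ℕ.m∸[m∸n]≡n b≤n) ⟩
  b ∸ a ∎
  where open ≡-Reasoning

module _ {n : ℕ} (p q : ℕ) where

  -- After contraction of `con` the rank of X is `c con` minus the number of components of X
  -- together with `con`. The corank is therefore a difference of component numbers, and the second
  -- exponent is the nullity with its terms rearranged into a single subtraction.
  weight : ∀ {m} → Edges {n} → Ends n m → Vec Bool m → ℕ
  weight {m} con ends X = p ℕ.^ (c (addE ends X con) ∸ c (addE ends (full m) con))
                        ℕ.* q ℕ.^ ((countF (lookup X) ℕ.+ c (addE ends X con)) ∸ c con)

  -- The rank generating polynomial of the graph with the edges of con contracted.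
  relR : ∀ {m} → Edges {n} → Ends n m → ℕ
  relR {m} con ends = sum (map (weight con ends) (allVecBool m))

  whitneyR≡relR : ∀ {m} (ends : Ends n m) → whitneyR ends p q ≡ relR [] ends
  whitneyR≡relR {m} ends = cong sum (map-cong (λ X → cong₂ (λ a b → p ℕ.^ a ℕ.* q ℕ.^ b) {u = nul ends (lookup X)}
      (rank X) (nullity X)) (allVecBool m))
    where
    c≤n : ∀ X → c (addE ends X []) ℕ.≤ n
    c≤n X = countF≤ _
    cX : ∀ X → comps ends (lookup X) ≡ c (addE ends X [])
    cX X = comps≡c ends (lookup X) X (λ _ → refl)
    cE : comps ends (λ _ → true) ≡ c (addE ends (full m) [])
    cE = comps≡c ends (λ _ → true) (full m) (λ e → sym (lookup-replicate e true))
    rank : ∀ X → rk ends (λ _ → true) ∸ rk ends (lookup X) ≡ c (addE ends X []) ∸ c (addE ends (full m) [])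
    rank X = trans (cong₂ (λ a b → (n ∸ a) ∸ (n ∸ b)) {u = comps ends (lookup X)} cE (cX X))
        (∸-∸-swap n (c (addE ends (full m) [])) (c (addE ends X [])) (c≤n X))
    nullity : ∀ X → nul ends (lookup X) ≡ (countF (lookup X) ℕ.+ c (addE ends X [])) ∸ c {n} []
    nullity X = begin
      k ∸ (n ∸ comps ends (lookup X))   ≡⟨ cong (λ z → k ∸ (n ∸ z)) (cX X) ⟩
      k ∸ (n ∸ a)                       ≡⟨ ℕ.[m+n]∸[m+o]≡n∸o a k (n ∸ a) ⟨
      (a ℕ.+ k) ∸ (a ℕ.+ (n ∸ a))           ≡⟨ cong₂ _∸_ (ℕ.+-comm a k) (trans (ℕ.m+[n∸m]≡n (c≤n X)) (sym (c-[] {n}))) ⟩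
      (k ℕ.+ a) ∸ c {n} [] ∎
      where
      open ≡-Reasoning
      k = countF (lookup X)
      a = c (addE ends X [])

  module _ {m} (con : Edges {n}) (ends : Ends n (suc m)) where
    private
      e = ends zero
      ends′ = ends ∘ suc

    relR-split : relR con ends ≡ sum (map (λ X → weight con ends (true ∷ X)) (allVecBool m))
                               ℕ.+ sum (map (λ X → weight con ends (false ∷ X)) (allVecBool m))
    relR-split = begin
      sum (map w (map (true ∷_) A ++ map (false ∷_) A))                 ≡⟨ cong sum (map-++ w (map (true ∷_) A) _) ⟩
      sum (map w (map (true ∷_) A) ++ map w (map (false ∷_) A))         ≡⟨ sum-++ (map w (map (true ∷_) A)) _ ⟩
      sum (map w (map (true ∷_) A)) ℕ.+ sum (map w (map (false ∷_) A))    ≡⟨ cong₂ (λ a b → sum a ℕ.+ sum b) (map-∘ A) (map-∘ A) ⟨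
      sum (map (w ∘ (true ∷_)) A) ℕ.+ sum (map (w ∘ (false ∷_)) A) ∎
      where
      open ≡-Reasoning
      A = allVecBool m
      w = weight con ends

    c-addE-new : ∀ X → conn (addE ends′ X con) (proj₁ e) (proj₂ e) ≡ false →
      c (addE ends′ X con) ≡ suc (c (addE ends′ X (e ∷ con)))
    c-addE-new X h = trans (c-new (addE ends′ X con) (proj₁ e) (proj₂ e) h) (cong suc (sym (c-↭ (addE-∷ ends′ X e con))))

    c-addE-old : ∀ X → conn (addE ends′ X con) (proj₁ e) (proj₂ e) ≡ true →
      c (addE ends′ X (e ∷ con)) ≡ c (addE ends′ X con)
    c-addE-old X h = trans (c-↭ (addE-∷ ends′ X e con)) (c-old (addE ends′ X con) (proj₁ e) (proj₂ e) h)

    conn-addE : ∀ X → conn con (proj₁ e) (proj₂ e) ≡ true → conn (addE ends′ X con) (proj₁ e) (proj₂ e) ≡ true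
    conn-addE X = conn-mono (addE-⊆ ends′ X con) _ _

    weight-in : c con ≡ suc (c (e ∷ con)) → ∀ X → weight con ends (true ∷ X) ≡ weight (e ∷ con) ends′ X
    weight-in h X rewrite h = refl

    weight-out : c (addE ends′ (full m) (e ∷ con)) ≡ c (addE ends′ (full m) con) →
      ∀ X → weight con ends (false ∷ X) ≡ weight con ends′ X
    weight-out h X rewrite h = refl

    -- If X contains `e`, contracting the non-loop `e` lowers `c con` by one, which offsets the lost
    -- edge in the nullity. If X omits `e`, deleting the non-bridge `e` leaves the component number
    -- of the full edge set unchanged.
    relR-ordinary : conn con (proj₁ e) (proj₂ e) ≡ false → conn (addE ends′ (full m) con) (proj₁ e) (proj₂ e) ≡ true →
      relR con ends ≡ relR (e ∷ con) ends′ ℕ.+ relR con ends′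
    relR-ordinary h k = trans relR-split (cong₂ (λ a b → sum a ℕ.+ sum b)
      (map-cong (weight-in (c-new con (proj₁ e) (proj₂ e) h)) (allVecBool m))
          (map-cong (weight-out (c-addE-old (full m) k)) (allVecBool m)))

    -- A loop joins nothing, so choosing it only raises the nullity by one and contributes the
    -- factor `q`.
    relR-loop : conn con (proj₁ e) (proj₂ e) ≡ true → relR con ends ≡ suc q ℕ.* relR (e ∷ con) ends′
    relR-loop h = trans relR-split (trans (ℕ.+-comm (sum (map _ (allVecBool m))) _) (cong₂ ℕ._+_
      (cong sum (map-cong out (allVecBool m)))
      (trans (cong sum (map-cong inn (allVecBool m))) (sum-map-* q (weight (e ∷ con) ends′) (allVecBool m)))))
      where
      old : ∀ X → c (addE ends′ X (e ∷ con)) ≡ c (addE ends′ X con)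
      old X = c-addE-old X (conn-addE X h)
      out : ∀ X → weight con ends (false ∷ X) ≡ weight (e ∷ con) ends′ X
      out X rewrite old (full m) | old X | c-old con (proj₁ e) (proj₂ e) h = refl
      inn : ∀ X → weight con ends (true ∷ X) ≡ q ℕ.* weight (e ∷ con) ends′ X
      inn X = begin
        p ℕ.^ a ℕ.* q ℕ.^ (suc k ∸ c con)           ≡⟨ cong (λ z → p ℕ.^ a ℕ.* q ℕ.^ (suc k ∸ z)) (c-old con (proj₁ e) (proj₂ e) h) ⟨
        p ℕ.^ a ℕ.* q ℕ.^ (suc k ∸ c (e ∷ con))     ≡⟨ cong (λ z → p ℕ.^ a ℕ.* q ℕ.^ z) (ℕ.+-∸-assoc 1 (c-lower ends′ X (e ∷ con))) ⟩
        p ℕ.^ a ℕ.* (q ℕ.* q ℕ.^ (k ∸ c (e ∷ con)))   ≡⟨ ℕ.*-assoc (p ℕ.^ a) q _ ⟨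
        p ℕ.^ a ℕ.* q ℕ.* q ℕ.^ (k ∸ c (e ∷ con))     ≡⟨ cong (ℕ._* q ℕ.^ (k ∸ c (e ∷ con))) (ℕ.*-comm (p ℕ.^ a) q) ⟩
        q ℕ.* p ℕ.^ a ℕ.* q ℕ.^ (k ∸ c (e ∷ con))     ≡⟨ ℕ.*-assoc q (p ℕ.^ a) _ ⟩
        q ℕ.* (p ℕ.^ a ℕ.* q ℕ.^ (k ∸ c (e ∷ con))) ∎
        where
        open ≡-Reasoning
        a = c (addE ends′ X (e ∷ con)) ∸ c (addE ends′ (full m) (e ∷ con))
        k = countF (lookup X) ℕ.+ c (addE ends′ X (e ∷ con))

    -- An edge that joins different components of everything else does so for every X. Choosing it
    -- changes neither exponent; omitting it leaves the rank one short and contributes the factor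
    -- `p`.
    relR-bridge : conn (addE ends′ (full m) con) (proj₁ e) (proj₂ e) ≡ false → relR con ends ≡ suc p ℕ.* relR con ends′
    relR-bridge h = trans relR-split (cong₂ ℕ._+_
      (cong sum (map-cong inn (allVecBool m)))
      (trans (cong sum (map-cong out (allVecBool m))) (sum-map-* p (weight con ends′) (allVecBool m))))
      where
      new : ∀ X → c (addE ends′ X con) ≡ suc (c (addE ends′ X (e ∷ con)))
      new X = c-addE-new X (¬true⇒false λ t → true≢false (trans (sym (conn-mono (addE-full ends′ X con) _ _ t)) h))
      new-con : c con ≡ suc (c (e ∷ con))
      new-con = c-new con (proj₁ e) (proj₂ e) (¬true⇒false λ t → true≢false (trans (sym (conn-addE (full m) t)) h))
      inn : ∀ X → weight con ends (true ∷ X) ≡ weight con ends′ X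
      inn X = trans (weight-in new-con X) (cong₂ (λ a b → p ℕ.^ a ℕ.* q ℕ.^ b)
        (cong₂ _∸_ (sym (new X)) (sym (new (full m))))
        (cong₂ _∸_ (trans (sym (ℕ.+-suc (countF (lookup X)) _)) (cong (countF (lookup X) ℕ.+_) (sym (new X)))) (sym new-con)))
      out : ∀ X → weight con ends (false ∷ X) ≡ p ℕ.* weight con ends′ X
      out X = begin
        p ℕ.^ (a ∸ c (addE ends′ (full m) (e ∷ con))) ℕ.* b       ≡⟨ cong (λ z → p ℕ.^ (suc a ∸ z) ℕ.* b) (sym (new (full m))) ⟩
        p ℕ.^ (suc a ∸ c (addE ends′ (full m) con)) ℕ.* b         ≡⟨ cong (λ z → p ℕ.^ z ℕ.* b) (ℕ.+-∸-assoc 1 (c-mono (addE-full ends′ X con))) ⟩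
        p ℕ.* p ℕ.^ (a ∸ c (addE ends′ (full m) con)) ℕ.* b         ≡⟨ ℕ.*-assoc p _ b ⟩
        p ℕ.* (p ℕ.^ (a ∸ c (addE ends′ (full m) con)) ℕ.* b) ∎
        where
        open ≡-Reasoning
        a = c (addE ends′ X con)
        b = q ℕ.^ ((countF (lookup X) ℕ.+ a) ∸ c con)

-- Orthogonal lattices and states

sumℤ-cong : ∀ {k} {f g : Fin k → ℤ} → f ≗ g → sumℤ f ≡ sumℤ g
sumℤ-cong {zero} eq = refl
sumℤ-cong {suc k} eq = cong₂ _+_ (eq zero) (sumℤ-cong (eq ∘ suc))

sumℤ-zero : ∀ k → sumℤ {k} (λ _ → 0ℤ) ≡ 0ℤ
sumℤ-zero zero = refl
sumℤ-zero (suc k) = trans (ℤ.+-identityˡ _) (sumℤ-zero k)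

interchange : ∀ a b c d → (a + b) + (c + d) ≡ (a + c) + (b + d)
interchange = solve-∀

sumℤ-+ : ∀ {k} (f g : Fin k → ℤ) → sumℤ (λ e → f e + g e) ≡ sumℤ f + sumℤ g
sumℤ-+ {zero} f g = refl
sumℤ-+ {suc k} f g =
  trans (cong (λ z → f zero + g zero + z) (sumℤ-+ (f ∘ suc) (g ∘ suc))) (interchange (f zero) (g zero) _ _)

sumℤ-* : ∀ {k} c (f : Fin k → ℤ) → sumℤ (λ e → c * f e) ≡ c * sumℤ f
sumℤ-* {zero} c f = sym (ℤ.*-zeroʳ c)
sumℤ-* {suc k} c f =
  trans (cong (λ z → c * f zero + z) (sumℤ-* c (f ∘ suc))) (sym (ℤ.*-distribˡ-+ c (f zero) _))

0≤+⇒ : ∀ {a b} → 0ℤ ℤ.≤ a → 0ℤ ℤ.≤ b → 0ℤ ℤ.≤ a + b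
0≤+⇒ p q = ℤ.+-mono-≤ p q

0≤sumℤ : ∀ {k} {f : Fin k → ℤ} → (∀ e → 0ℤ ℤ.≤ f e) → 0ℤ ℤ.≤ sumℤ f
0≤sumℤ {zero} h = ℤ.≤-refl
0≤sumℤ {suc k} h = 0≤+⇒ (h zero) (0≤sumℤ (h ∘ suc))

0≤∧+≡0⇒≡0 : ∀ {a b} → 0ℤ ℤ.≤ a → 0ℤ ℤ.≤ b → a + b ≡ 0ℤ → a ≡ 0ℤ × b ≡ 0ℤ
0≤∧+≡0⇒≡0 {+ zero} {+ zero} _ _ _ = refl , refl

sumℤ-nonneg-zero : ∀ {k} {f : Fin k → ℤ} → (∀ e → 0ℤ ℤ.≤ f e) → sumℤ f ≡ 0ℤ →
                   ∀ e → f e ≡ 0ℤ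
sumℤ-nonneg-zero {suc k} h eq with 0≤∧+≡0⇒≡0 (h zero) (0≤sumℤ (h ∘ suc)) eq
... | p , q = λ { zero → p ; (suc i) → sumℤ-nonneg-zero (h ∘ suc) q i }

V : ℕ → Set
V m = Fin m → ℤ

infixr 5 _▸_
_▸_ : ∀ {a} {A : Set a} {m} → A → (Fin m → A) → Fin (suc m) → A
(c ▸ v) zero = c
(c ▸ v) (suc i) = v i

sgn : Bool → ℤ → ℤ
sgn true z = z
sgn false z = - z

ι : Bool → ℤ
ι true = 1ℤ
ι false = 0ℤ

-- The characteristic vector of `d`, directed by `s`. For a graph, membership in `T` makes `d` a
-- locally directed cut, and membership in `W` makes it a directed Eulerian subgraph.
directed : ∀ {m} → (Fin m → Bool) → (Fin m → Bool) → V m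
directed s d e = sgn (s e) (ι (d e))

record IsSubgroup {m} (P : V m → Set) : Set where
  field
    resp : ∀ {u v} → u ≗ v → P u → P v
    zer : P (λ _ → 0ℤ)
    add : ∀ {u v} → P u → P v → P (λ e → u e + v e)
    neg : ∀ {u} → P u → P (λ e → - u e)

  multℕ : ∀ {u} n → P u → P (λ e → + n * u e)
  multℕ {u} zero Pu = resp (λ e → sym (ℤ.*-zeroˡ (u e))) zer
  multℕ {u} (suc n) Pu =
    resp (λ e → sym (ℤ.suc-* (+ n) (u e))) (add Pu (multℕ n Pu))

  mult : ∀ {u} c → P u → P (λ e → c * u e)
  mult (+ n) Pu = multℕ n Pu
  mult {u} (-[1+ n ]) Pu =
    resp (λ e → ℤ.neg-distribˡ-* (+ suc n) (u e)) (neg (multℕ (suc n) Pu))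

-- The field paint is Minty's colouring lemma.
record Lattices (m : ℕ) : Set₁ where
  field
    T W : V m → Set
    T-sub : IsSubgroup T
    W-sub : IsSubgroup W
    orth : ∀ {φ γ} → T φ → W γ → sumℤ (λ e → φ e * γ e) ≡ 0ℤ
    paint : ∀ s e → (Σ[ d ∈ (Fin m → Bool) ] T (directed s d) × d e ≡ true)
                  ⊎ (Σ[ d ∈ (Fin m → Bool) ] W (directed s d) × d e ≡ true)

dualL : ∀ {m} → Lattices m → Lattices m
dualL M = record
  { T = W ; W = T ; T-sub = W-sub ; W-sub = T-sub
  ; orth = λ {φ} {γ} Wφ Tγ → trans (sumℤ-cong (λ e → ℤ.*-comm (φ e) (γ e))) (orth Tγ Wφ)
  ; paint = λ s e → swap (paint s e) }
  where open Lattices M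

signed : ∀ {m} → (Fin m → Bool) → (Fin m → ℕ) → V m
signed s f e = sgn (s e) (+ f e)

record State {m} (p q : ℕ) (T W : V m → Set) : Set where
  constructor mkState
  field
    s : Fin m → Bool
    f g : Fin m → ℕ
    f≤p : ∀ e → f e ℕ.≤ p
    g≤q : ∀ e → g e ℕ.≤ q
    TF : T (signed s f)
    WG : W (signed s g)

  F G : V m
  F = signed s f
  G = signed s g

open State

record Shift {m p q} {T W : V m → Set} (x y : State p q T W) (φ γ : V m) : Set where
  constructor mkShift
  field
    eq-s : ∀ e → ι (s x e) ≡ ι (s y e) + (φ e + γ e)
    eq-F : ∀ e → F x e ≡ F y e + + p * φ e
    eq-G : ∀ e → G x e ≡ G y e + + q * γ e

-- Because of ≈-disjoint below, x ≈ y means that y arises from x by reversing a directed cut and a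
-- directed cycle, replacing f by p ∸ f on the former and g by q ∸ g on the latter.
record _≈_ {m p q} {T W : V m → Set} (x y : State p q T W) : Set where
  constructor mk≈
  field
    {φ γ} : V m
    Tφ : T φ
    Wγ : W γ
    shift : Shift x y φ γ
  open Shift shift public

open _≈_

-- A transversal of the classes that contain a state with property `P`. It takes the place of the
-- cardinality of a quotient.
record Enumeration {m p q} {T W : V m → Set} (P : State p q T W → Set) (k : ℕ) : Set where
  field
    elt : Fin k → State p q T W
    sound : ∀ i → P (elt i)
    distinct : ∀ i j → elt i ≈ elt j → i ≡ j
    complete : ∀ x → P x → Σ[ i ∈ Fin k ] x ≈ elt i

Aligned : Bool → ℤ → Set
Aligned b z = Σ[ k ∈ ℕ ] z ≡ sgn b (+ k)

aligned-* : ∀ b {x y} → Aligned b x → Aligned b y → 0ℤ ℤ.≤ x * y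
aligned-* true (k , refl) (l , refl) rewrite sym (ℤ.pos-* k l) = +≤+ z≤n
aligned-* false (k , refl) (l , refl)
  rewrite sym (ℤ.neg-distribˡ-* (+ k) (- + l)) | sym (ℤ.neg-distribʳ-* (+ k) (+ l))
        | ℤ.neg-involutive (+ k * + l) | sym (ℤ.pos-* k l) = +≤+ z≤n

-- Two nonzero integers of the same sign have a sum of absolute value at least two, whereas `ι b`
-- and `ι b′` differ by at most one.
unit-sum-* : ∀ b b′ x y → ι b ≡ ι b′ + (x + y) → 0ℤ ℤ.≤ - (x * y)
unit-sum-* b b′ (+ zero) y _ = subst (λ z → 0ℤ ℤ.≤ - z) (sym (ℤ.*-zeroˡ y)) ℤ.≤-refl
unit-sum-* b b′ x@(+ suc _) (+ zero) _ = subst (λ z → 0ℤ ℤ.≤ - z) (sym (ℤ.*-zeroʳ x)) ℤ.≤-refl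
unit-sum-* b b′ x@(-[1+ _ ]) (+ zero) _ = subst (λ z → 0ℤ ℤ.≤ - z) (sym (ℤ.*-zeroʳ x)) ℤ.≤-refl
unit-sum-* b b′ (+ suc k) -[1+ l ] _ = +≤+ z≤n
unit-sum-* b b′ -[1+ k ] (+ suc l) _ = +≤+ z≤n
unit-sum-* true true (+ suc k) (+ suc l) eq with ℤ.+-injective eq
... | ()
unit-sum-* true false (+ suc k) (+ suc l) eq with trans (ℤ.+-injective eq) (cong suc (ℕ.+-suc k l))
... | ()
unit-sum-* false true (+ suc k) (+ suc l) ()
unit-sum-* false false (+ suc k) (+ suc l) ()
unit-sum-* true true -[1+ k ] -[1+ l ] ()
unit-sum-* true false -[1+ k ] -[1+ l ] ()
unit-sum-* false true -[1+ k ] -[1+ l ] ()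
unit-sum-* false false -[1+ k ] -[1+ l ] ()

Disjoint : ∀ {m} → V m → V m → Set
Disjoint φ γ = ∀ e → φ e ≡ 0ℤ ⊎ γ e ≡ 0ℤ

-- All products are nonpositive by `unit-sum-*` and they sum to zero, so each of them is zero.
unit-sum-disjoint : ∀ {m} {φ γ : V m} (s t : Fin m → Bool) →
  sumℤ (λ e → φ e * γ e) ≡ 0ℤ → (∀ e → ι (s e) ≡ ι (t e) + (φ e + γ e)) → Disjoint φ γ
unit-sum-disjoint {m} {φ} {γ} s t o eq e = ℤ.i*j≡0⇒i≡0∨j≡0 (φ e) (begin
  φ e * γ e         ≡⟨ ℤ.neg-involutive _ ⟨
  - - (φ e * γ e)   ≡⟨ cong -_ z ⟩
  0ℤ ∎)
  where
  open ≡-Reasoning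
  neg-sum : sumℤ (λ e → - (φ e * γ e)) ≡ 0ℤ
  neg-sum = begin
    sumℤ (λ e → - (φ e * γ e))          ≡⟨ sumℤ-cong {m} (λ e → ℤ.-1*i≡-i (φ e * γ e)) ⟨
    sumℤ (λ e → ℤ.-1ℤ * (φ e * γ e))    ≡⟨ sumℤ-* {m} ℤ.-1ℤ (λ e → φ e * γ e) ⟩
    ℤ.-1ℤ * sumℤ (λ e → φ e * γ e)      ≡⟨ cong (ℤ.-1ℤ *_) o ⟩
    0ℤ ∎
  z = sumℤ-nonneg-zero (λ e → unit-sum-* (s e) (t e) (φ e) (γ e) (eq e)) neg-sum e

aligned-disjoint : ∀ {m} {φ γ : V m} (s : Fin m → Bool) → sumℤ (λ e → φ e * γ e) ≡ 0ℤ →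
  (∀ e → Aligned (s e) (φ e)) → (∀ e → Aligned (s e) (γ e)) → Disjoint φ γ
aligned-disjoint {φ = φ} s o a b e = ℤ.i*j≡0⇒i≡0∨j≡0 (φ e)
  (sumℤ-nonneg-zero (λ e → aligned-* (s e) (a e) (b e)) o e)

ι-aligned : ∀ b d → Aligned b (sgn b (ι d))
ι-aligned b true = 1 , refl
ι-aligned b false = 0 , refl

unit-sum-aligned : ∀ b b′ x → ι b ≡ ι b′ + x → Aligned b x
unit-sum-aligned true true (+ zero) eq = 0 , refl
unit-sum-aligned true true (+ suc k) eq with ℤ.+-injective eq
... | ()
unit-sum-aligned true true -[1+ zero ] ()
unit-sum-aligned true true -[1+ suc k ] ()
unit-sum-aligned true false x eq = 1 , trans (sym (ℤ.+-identityˡ x)) (sym eq)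
unit-sum-aligned false true (+ k) eq with ℤ.+-injective eq
... | ()
unit-sum-aligned false true -[1+ zero ] eq = 1 , refl
unit-sum-aligned false true -[1+ suc k ] ()
unit-sum-aligned false false x eq = 0 , trans (sym (ℤ.+-identityˡ x)) (sym eq)

+-cancel : ∀ a b c → a ≡ b + c → b ≡ a + - c
+-cancel .(b + c) b c refl = solve′ b c
  where solve′ : ∀ b c → b ≡ b + c + - c
        solve′ = solve-∀

+-*0 : ∀ x n → x + + n * 0ℤ ≡ x
+-*0 x n = trans (cong (λ z → x + z) (ℤ.*-zeroʳ (+ n))) (ℤ.+-identityʳ x)

-- Signed values fill the interval from 0 to `p` or the one from `- p` to 0, according to the sign.
-- Reversing the edge translates one interval onto the other, which turns `f` into `p ∸ f`.
move-value : ∀ b b′ a → ι b ≡ ι b′ + a → ∀ {p f} → f ℕ.≤ p →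
  Σ[ f′ ∈ ℕ ] f′ ℕ.≤ p × sgn b (+ f) ≡ sgn b′ (+ f′) + + p * a
move-value b b′ a eq {p} {f} f≤p =
  subst (λ a → Σ[ f′ ∈ ℕ ] f′ ℕ.≤ p × sgn b (+ f) ≡ sgn b′ (+ f′) + + p * a) (sym a≡) (go b b′)
  where
  a≡ : a ≡ ι b + - ι b′
  a≡ = +-cancel (ι b) a (ι b′) (trans eq (ℤ.+-comm (ι b′) a))
  p≡ : + p ≡ + f + + (p ∸ f)
  p≡ = cong +_ (sym (ℕ.m+[n∸m]≡n f≤p))
  down : ∀ x y → x ≡ - y + (x + y) * 1ℤ
  down = solve-∀
  up : ∀ x y → - x ≡ y + (x + y) * ℤ.-1ℤ
  up = solve-∀
  go : ∀ b b′ → Σ[ f′ ∈ ℕ ] f′ ℕ.≤ p × sgn b (+ f) ≡ sgn b′ (+ f′) + + p * (ι b + - ι b′)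
  go true true = f , f≤p , sym (+-*0 (+ f) p)
  go false false = f , f≤p , sym (+-*0 (- + f) p)
  go true false = p ∸ f , ℕ.m∸n≤m p f ,
    subst (λ z → + f ≡ - + (p ∸ f) + z * 1ℤ) (sym p≡) (down (+ f) (+ (p ∸ f)))
  go false true = p ∸ f , ℕ.m∸n≤m p f ,
    subst (λ z → - + f ≡ + (p ∸ f) + z * ℤ.-1ℤ) (sym p≡) (up (+ f) (+ (p ∸ f)))

sgn-0 : ∀ b → sgn b 0ℤ ≡ 0ℤ
sgn-0 true = refl
sgn-0 false = refl

sgn-injective : ∀ b {x y} → sgn b x ≡ sgn b y → x ≡ y
sgn-injective true eq = eq
sgn-injective false eq = ℤ.neg-injective eq

sgn-zero : ∀ b {x} → sgn b x ≡ 0ℤ → x ≡ 0ℤ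
sgn-zero b eq = sgn-injective b (trans eq (sym (sgn-0 b)))

sgn-not : ∀ b x → sgn (not b) x ≡ - sgn b x
sgn-not true x = refl
sgn-not false x = sym (ℤ.neg-involutive x)

-- Where the reversal is due to the other lattice, the value is 0 and is not translated; 0 is
-- admissible for both signs.
move-value′ : ∀ b b′ {a c} → ι b ≡ ι b′ + (a + c) → a ≡ 0ℤ ⊎ c ≡ 0ℤ →
  ∀ {p f} → f ℕ.≤ p → sgn b (+ f) ≡ 0ℤ ⊎ c ≡ 0ℤ →
  Σ[ f′ ∈ ℕ ] f′ ℕ.≤ p × sgn b (+ f) ≡ sgn b′ (+ f′) + + p * a
move-value′ b b′ {a} eq _ f≤p (inj₂ refl) =
  move-value b b′ a (trans eq (cong (λ z → ι b′ + z) (ℤ.+-identityʳ a))) f≤p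
move-value′ b b′ eq (inj₂ refl) f≤p (inj₁ f0) = move-value′ b b′ eq (inj₂ refl) f≤p (inj₂ refl)
move-value′ b b′ eq (inj₁ refl) {p} f≤p (inj₁ f0) = 0 , z≤n ,
  trans f0 (sym (trans (+-*0 (sgn b′ 0ℤ) p) (sgn-0 b′)))

unit-sum-alignedʳ : ∀ b b′ {x y} → ι b ≡ ι b′ + (x + y) → x ≡ 0ℤ ⊎ y ≡ 0ℤ → Aligned b y
unit-sum-alignedʳ b b′ {y = y} eq (inj₁ refl) =
  unit-sum-aligned b b′ y (trans eq (cong (λ z → ι b′ + z) (ℤ.+-identityˡ y)))
unit-sum-alignedʳ true _ eq (inj₂ refl) = 0 , refl
unit-sum-alignedʳ false _ eq (inj₂ refl) = 0 , refl

unit-sum-alignedˡ : ∀ b b′ {x y} → ι b ≡ ι b′ + (x + y) → x ≡ 0ℤ ⊎ y ≡ 0ℤ → Aligned b x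
unit-sum-alignedˡ b b′ {x} {y} eq d =
  unit-sum-alignedʳ b b′ (trans eq (cong (λ z → ι b′ + z) (ℤ.+-comm x y))) (swap d)

reorient-ι : ∀ b d → ι b ≡ ι (b xor d) + sgn b (ι d)
reorient-ι true true = refl
reorient-ι true false = refl
reorient-ι false true = refl
reorient-ι false false = refl

ι-not : ∀ b → ι (not b) ≡ 1ℤ + - ι b
ι-not true = refl
ι-not false = refl

-- Translations of states and their classes

module _ {m} (M : Lattices m) {p q : ℕ} where
  open Lattices M
  private
    module TS = IsSubgroup T-sub
    module WS = IsSubgroup W-sub
    St = State p q T W

  pointwise-≈ : {x y : St} → s x ≗ s y → f x ≗ f y → g x ≗ g y → x ≈ y
  pointwise-≈ {x} {y} es ef eg = mk≈ TS.zer WS.zer (mkShift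
    (λ e → trans (cong ι (es e)) (sym (ℤ.+-identityʳ (ι (s y e)))))
    (λ e → trans (cong₂ (λ b k → sgn b (+ k)) (es e) (ef e)) (sym (+-*0 (F y e) p)))
    (λ e → trans (cong₂ (λ b k → sgn b (+ k)) (es e) (eg e)) (sym (+-*0 (G y e) q))))

  ≈-refl : (x : St) → x ≈ x
  ≈-refl x = pointwise-≈ (λ _ → refl) (λ _ → refl) (λ _ → refl)

  ≈-sym : {x y : St} → x ≈ y → y ≈ x
  ≈-sym {x} {y} r = mk≈ (TS.neg (Tφ r)) (WS.neg (Wγ r)) (mkShift
    (λ e → trans (+-cancel _ _ _ (eq-s r e)) (cong (λ z → ι (s x e) + z) (ℤ.neg-distrib-+ (φ r e) (γ r e))))
    (λ e → trans (+-cancel _ _ _ (eq-F r e)) (cong (λ z → F x e + z) (ℤ.neg-distribʳ-* (+ p) (φ r e))))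
    (λ e → trans (+-cancel _ _ _ (eq-G r e)) (cong (λ z → G x e + z) (ℤ.neg-distribʳ-* (+ q) (γ r e)))))

  ≈-trans : {x y z : St} → x ≈ y → y ≈ z → x ≈ z
  ≈-trans {x} {y} {z} r t = mk≈ (TS.add (Tφ r) (Tφ t)) (WS.add (Wγ r) (Wγ t)) (mkShift
    (λ e → trans (eq-s r e) (trans (cong (λ w → w + (φ r e + γ r e)) (eq-s t e))
       (lem₁ (ι (s z e)) (φ t e) (γ t e) (φ r e) (γ r e))))
    (λ e → trans (eq-F r e) (trans (cong (λ w → w + + p * φ r e) (eq-F t e)) (lem₂ (F z e) (+ p) (φ t e) (φ r e))))
    (λ e → trans (eq-G r e) (trans (cong (λ w → w + + q * γ r e) (eq-G t e)) (lem₂ (G z e) (+ q) (γ t e) (γ r e)))))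
    where
    lem₁ : ∀ z a b c d → z + (a + b) + (c + d) ≡ z + ((c + a) + (d + b))
    lem₁ = solve-∀
    lem₂ : ∀ z p a b → z + p * a + p * b ≡ z + p * (b + a)
    lem₂ = solve-∀

  ≈-disjoint : {x y : St} (r : x ≈ y) → Disjoint (φ r) (γ r)
  ≈-disjoint {x} {y} r = unit-sum-disjoint (s x) (s y) (orth (Tφ r) (Wγ r)) (eq-s r)

  -- The sum of `φ` and `γ` is zero at `e`, and one of the two already vanishes there. Hence a
  -- translation does nothing to an edge that keeps its direction.
  same-sign : {x y : St} (r : x ≈ y) → ∀ e → s x e ≡ s y e → φ r e ≡ 0ℤ × γ r e ≡ 0ℤ
  same-sign {x} {y} r e eq = both (≈-disjoint r e)
    where
    sum0 : φ r e + γ r e ≡ 0ℤ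
    sum0 = trans (+-cancel (ι (s x e)) (φ r e + γ r e) (ι (s y e)) (trans (eq-s r e) (ℤ.+-comm (ι (s y e)) (φ r e + γ r e))))
                 (trans (cong (λ b → ι (s x e) + - ι b) (sym eq)) (ℤ.+-inverseʳ (ι (s x e))))
    both : φ r e ≡ 0ℤ ⊎ γ r e ≡ 0ℤ → φ r e ≡ 0ℤ × γ r e ≡ 0ℤ
    both (inj₁ z) = z , trans (sym (trans (cong (λ z → z + γ r e) z) (ℤ.+-identityˡ (γ r e)))) sum0
    both (inj₂ z) = trans (sym (trans (cong (λ w → φ r e + w) z) (ℤ.+-identityʳ (φ r e)))) sum0 , z

  aligned-orth : ∀ (t : Fin m → Bool) {φ γ} → T φ → W γ →
    (∀ e → Aligned (t e) (φ e)) → (∀ e → Aligned (t e) (γ e)) → Disjoint φ γ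
  aligned-orth t Tφ Wγ = aligned-disjoint t (orth Tφ Wγ)

  -- A translation of the orientation alone determines the new state. Both `γ` and `F x` are aligned
  -- with `s x`, so by orthogonality `F x` vanishes on the support of `γ`; likewise `G x` vanishes
  -- on that of `φ`. This is what keeps the translated values within their bounds.
  move : (x : St) (t : Fin m → Bool) → ∀ {φ γ} → T φ → W γ →
         (∀ e → ι (s x e) ≡ ι (t e) + (φ e + γ e)) →
         Σ[ y ∈ St ] s y ≡ t × Shift x y φ γ
  move x t {φ} {γ} Tφ Wγ eq = y , refl , sh
    where
    dis : Disjoint φ γ
    dis = unit-sum-disjoint (s x) t (orth Tφ Wγ) eq
    Fγ : Disjoint (F x) γ
    Fγ = aligned-orth (s x) (TF x) Wγ (λ e → f x e , refl) (λ e → unit-sum-alignedʳ (s x e) (t e) (eq e) (dis e))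
    φG : Disjoint φ (G x)
    φG = aligned-orth (s x) Tφ (WG x) (λ e → unit-sum-alignedˡ (s x e) (t e) (eq e) (dis e)) (λ e → g x e , refl)
    newF : ∀ e → Σ[ f′ ∈ ℕ ] f′ ℕ.≤ p × F x e ≡ sgn (t e) (+ f′) + + p * φ e
    newF e = move-value′ (s x e) (t e) (eq e) (dis e) (f≤p x e) (Fγ e)
    newG : ∀ e → Σ[ g′ ∈ ℕ ] g′ ℕ.≤ q × G x e ≡ sgn (t e) (+ g′) + + q * γ e
    newG e = move-value′ (s x e) (t e) (trans (eq e) (cong (λ z → ι (t e) + z) (ℤ.+-comm (φ e) (γ e))))
               (swap (dis e)) (g≤q x e) (swap (φG e))
    sub : ∀ n a b c → a ≡ b + + n * c → a + - (+ n * c) ≡ b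
    sub n a b c e = sym (+-cancel a b _ e)
    y : St
    y = mkState t (proj₁ ∘ newF) (proj₁ ∘ newG) (proj₁ ∘ proj₂ ∘ newF) (proj₁ ∘ proj₂ ∘ newG)
      (TS.resp (λ e → sub p _ _ (φ e) (proj₂ (proj₂ (newF e)))) (TS.add (TF x) (TS.neg (TS.multℕ p Tφ))))
      (WS.resp (λ e → sub q _ _ (γ e) (proj₂ (proj₂ (newG e)))) (WS.add (WG x) (WS.neg (WS.multℕ q Wγ))))
    sh : Shift x y φ γ
    sh = mkShift eq (proj₂ ∘ proj₂ ∘ newF) (proj₂ ∘ proj₂ ∘ newG)

  flip-T : (x : St) (d : Fin m → Bool) → T (directed (s x) d) →
    Σ[ y ∈ St ] s y ≡ (λ e → s x e xor d e) × Shift x y (directed (s x) d) (λ _ → 0ℤ)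
  flip-T x d Td = move x _ Td WS.zer
    (λ e → trans (reorient-ι (s x e) (d e)) (cong (λ z → ι (s x e xor d e) + z) (sym (ℤ.+-identityʳ _))))

  flip-W : (x : St) (d : Fin m → Bool) → W (directed (s x) d) →
    Σ[ y ∈ St ] s y ≡ (λ e → s x e xor d e) × Shift x y (λ _ → 0ℤ) (directed (s x) d)
  flip-W x d Wd = move x _ TS.zer Wd
    (λ e → trans (reorient-ι (s x e) (d e)) (cong (λ z → ι (s x e xor d e) + z) (sym (ℤ.+-identityˡ _))))

  -- The exchange of tensions and flows is combined with the complement of `s`, so that the normal
  -- form of the dual has the opposite sign on the distinguished edge. This is what tells the
  -- deletion half from the contraction half.
  dual : St → State q p W T
  dual x = mkState (not ∘ s x) (g x) (f x) (g≤q x) (f≤p x)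
    (WS.resp (λ e → sym (sgn-not (s x e) _)) (WS.neg (WG x)))
    (TS.resp (λ e → sym (sgn-not (s x e) _)) (TS.neg (TF x)))

  dual-≈ : {x y : St} → x ≈ y → dual x ≈ dual y
  dual-≈ {x} {y} r = mk≈ (WS.neg (Wγ r)) (TS.neg (Tφ r)) (mkShift
    (λ e → trans (ι-not (s x e)) (trans (cong (λ z → 1ℤ + - z) (eq-s r e))
       (trans (lem₁ (ι (s y e)) (φ r e) (γ r e)) (cong (λ z → z + (- γ r e + - φ r e)) (sym (ι-not (s y e)))))))
    (λ e → trans (sgn-not (s x e) _) (trans (cong -_ (eq-G r e)) (trans (lem₂ (G y e) (+ q) (γ r e))
       (cong (λ z → z + + q * - γ r e) (sym (sgn-not (s y e) _))))))
    (λ e → trans (sgn-not (s x e) _) (trans (cong -_ (eq-F r e)) (trans (lem₂ (F y e) (+ p) (φ r e))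
       (cong (λ z → z + + p * - φ r e) (sym (sgn-not (s y e) _)))))))
    where
    lem₁ : ∀ b x y → 1ℤ + - (b + (x + y)) ≡ (1ℤ + - b) + (- y + - x)
    lem₁ = solve-∀
    lem₂ : ∀ a n x → - (a + n * x) ≡ - a + n * (- x)
    lem₂ = solve-∀

module _ {m} (M : Lattices m) {p q : ℕ} where
  private
    St = State p q (Lattices.T M) (Lattices.W M)

  dual-dual : (x : St) → x ≈ dual (dualL M) (dual M x)
  dual-dual x = pointwise-≈ M (λ e → sym (not-involutive (s x e))) (λ _ → refl) (λ _ → refl)

-- Contraction and deletion of an edge

-- A deletion is a contraction of the dual lattices.
record Contraction {m} (M : Lattices (suc m)) (M′ : Lattices m) : Set where
  private
    module M = Lattices M
    module M′ = Lattices M′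
  field
    T-ext : ∀ {φ} → M′.T φ → M.T (0ℤ ▸ φ)
    T-res : ∀ {φ} → M.T (0ℤ ▸ φ) → M′.T φ
    W-ext : ∀ {γ} → M′.W γ → Σ[ c ∈ ℤ ] M.W (c ▸ γ)
    W-res : ∀ {γ c} → M.W (c ▸ γ) → M′.W γ

InCut : ∀ {m p q} {T W : V (suc m) → Set} → State p q T W → Set
InCut {m} {T = T} x = Σ[ d ∈ (Fin (suc m) → Bool) ] T (directed (s x) d) × d zero ≡ true

-- The normal form of an extension of a state of the contraction.  For q = 0 the value of g carries
-- no information, and the directed cut selects the last state along the flips through the edge.
record Good {m p q} {T W : V (suc m) → Set} (x : State p q T W) : Set where
  constructor mkGood
  field
    s₀ : s x zero ≡ true
    f₀ : f x zero ≡ 0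
    slack : g x zero ℕ.< q ⊎ (q ≡ 0 × InCut x)

open Good

▸-cong : ∀ {m} {c c′ : ℤ} {v v′ : V m} → c ≡ c′ → v ≗ v′ → (c ▸ v) ≗ (c′ ▸ v′)
▸-cong eq _ zero = eq
▸-cong _ eq (suc i) = eq i

▸-η : ∀ {m} {c : ℤ} (v : V (suc m)) → v zero ≡ c → v ≗ (c ▸ v ∘ suc)
▸-η v eq zero = eq
▸-η v eq (suc i) = refl

unit≢0 : ∀ b {d} → d ≡ true → sgn b (ι d) ≡ 0ℤ → ⊥
unit≢0 true refl ()
unit≢0 false refl ()

jump-large : ∀ {b b′ i j n k} → b ≡ true → b′ ≡ true →
  sgn b (+ i) ≡ sgn b′ (+ j) + + n * + suc k → n ℕ.≤ i
jump-large {i = i} {j} {n} {k} refl refl eq = begin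
  n                   ≤⟨ ℕ.m≤m*n n (suc k) ⟩
  n ℕ.* suc k         ≤⟨ ℕ.m≤n+m _ j ⟩
  j ℕ.+ n ℕ.* suc k   ≡⟨ ℤ.+-injective (trans eq (cong (λ z → + j + z) (sym (ℤ.pos-* n (suc k))))) ⟨
  i ∎
  where open ℕ.≤-Reasoning

module _ {m} {M : Lattices (suc m)} {M′ : Lattices m} (con : Contraction M M′) {p q : ℕ} where
  open Contraction con
  private
    module M = Lattices M
    module M′ = Lattices M′
    module TS = IsSubgroup M.T-sub
    module WS = IsSubgroup M.W-sub
    St = State p q M.T M.W
    St′ = State p q M′.T M′.W

  restrict : (x : St) → f x zero ≡ 0 → St′
  restrict x eq = mkState (s x ∘ suc) (f x ∘ suc) (g x ∘ suc) (f≤p x ∘ suc) (g≤q x ∘ suc)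
    (T-res (TS.resp (▸-η (F x) (trans (cong (λ k → sgn (s x zero) (+ k)) eq) (sgn-0 (s x zero)))) (TF x)))
    (W-res (WS.resp (▸-η (G x) refl) (WG x)))

  extend : (y : St′) (k : ℕ) → k ℕ.≤ q → M.W (+ k ▸ G y) → St
  extend y k k≤q Wk = mkState (true ▸ s y) (0 ▸ f y) (k ▸ g y)
    (λ { zero → z≤n ; (suc i) → f≤p y i }) (λ { zero → k≤q ; (suc i) → g≤q y i })
    (TS.resp (λ { zero → refl ; (suc i) → refl }) (T-ext (TF y)))
    (WS.resp (λ { zero → refl ; (suc i) → refl }) Wk)

  restrict-≈ : {x y : St} (r : x ≈ y) (fx : f x zero ≡ 0) (fy : f y zero ≡ 0) →
    φ r zero ≡ 0ℤ → restrict x fx ≈ restrict y fy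
  restrict-≈ r _ _ φ0 = mk≈ (T-res (TS.resp (▸-η (φ r) φ0) (Tφ r))) (W-res (WS.resp (▸-η (γ r) refl) (Wγ r)))
    (mkShift (eq-s r ∘ suc) (eq-F r ∘ suc) (eq-G r ∘ suc))

  module _ {φ₀ : V (suc m)} (Tφ₀ : M.T φ₀) (φ₀≡1 : φ₀ zero ≡ 1ℤ) where

    -- Pairing with `φ₀` reads off the entry at the edge. It follows that an element of `M′.W`
    -- extends over the edge in only one way.
    coordinate : ∀ {v} → M.W v → (∀ i → v (suc i) ≡ 0ℤ) → v zero ≡ 0ℤ
    coordinate {v} Wv v0 = begin
      v zero                                                     ≡⟨ ℤ.*-identityˡ _ ⟨
      1ℤ * v zero                                                ≡⟨ cong (λ z → z * v zero) φ₀≡1 ⟨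
      φ₀ zero * v zero                                           ≡⟨ ℤ.+-identityʳ _ ⟨
      φ₀ zero * v zero + 0ℤ                                      ≡⟨ cong (λ z → φ₀ zero * v zero + z) rest ⟨
      φ₀ zero * v zero + sumℤ (λ i → φ₀ (suc i) * v (suc i))     ≡⟨ M.orth Tφ₀ Wv ⟩
      0ℤ ∎
      where
      open ≡-Reasoning
      rest : sumℤ (λ i → φ₀ (suc i) * v (suc i)) ≡ 0ℤ
      rest = trans (sumℤ-cong {m} (λ i → trans (cong (λ z → φ₀ (suc i) * z) (v0 i)) (ℤ.*-zeroʳ (φ₀ (suc i)))))
                   (sumℤ-zero m)

    G-zero : {x y : St} (fx : f x zero ≡ 0) (fy : f y zero ≡ 0) (r : restrict x fx ≈ restrict y fy) →
      ∀ c → M.W (c ▸ γ r) → G x zero ≡ G y zero + + q * c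
    G-zero {x} {y} fx fy r c Wc =
      trans (sym (ℤ.+-identityʳ _)) (trans (cong (λ z → G x zero + z) (sym (ℤ.+-inverseˡ Y)))
      (trans (sym (ℤ.+-assoc (G x zero) (- Y) Y)) (trans (cong (λ z → z + Y) δ0) (ℤ.+-identityˡ Y))))
      where
      Y = G y zero + + q * c
      δ0 : G x zero + - Y ≡ 0ℤ
      δ0 = coordinate (WS.add (WG x) (WS.neg (WS.add (WG y) (WS.multℕ q Wc))))
             (λ i → trans (cong (λ z → z + - (G y (suc i) + + q * γ r i)) (eq-G r i))
                          (ℤ.+-inverseʳ (G y (suc i) + + q * γ r i)))

    -- A positive extension of `γ` would force a value of at least `q` on the edge of `x`. If
    -- instead `x` is normalised by a directed cut, that cut and the extended `γ` would be aligned,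
    -- orthogonal and both nonzero on the edge.
    not-positive : {x y : St} (gx : Good x) (gy : Good y) (r : restrict x (f₀ gx) ≈ restrict y (f₀ gy)) →
      ∀ k → M.W (+ suc k ▸ γ r) → ⊥
    not-positive {x} {y} gx gy r k Wc with slack gx
    ... | inj₁ lt = ℕ.<⇒≱ lt (jump-large (s₀ gx) (s₀ gy) (G-zero {x} {y} (f₀ gx) (f₀ gy) r _ Wc))
    ... | inj₂ (_ , d , Td , d₀) =
      [ unit≢0 (s x zero) d₀ , (λ ()) ]′
        (aligned-orth M {p} {q} (s x) Td Wc (λ e → ι-aligned (s x e) (d e)) al zero)
      where
      al : ∀ e → Aligned (s x e) ((+ suc k ▸ γ r) e)
      al zero = suc k , sym (cong (λ b → sgn b (+ suc k)) (s₀ gx))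
      al (suc i) = unit-sum-alignedʳ (s x (suc i)) (s y (suc i)) (eq-s r i) (≈-disjoint M′ r i)

    -- The translation extends over the edge by some integer. It cannot be positive, nor negative
    -- after exchanging `x` and `y`, so the edge is left alone.
    extend-≈ : {x y : St} (gx : Good x) (gy : Good y) → restrict x (f₀ gx) ≈ restrict y (f₀ gy) → x ≈ y
    extend-≈ {x} {y} gx gy r with W-ext (Wγ r)
    ... | + suc k , Wc = ⊥-elim (not-positive gx gy r k Wc)
    ... | -[1+ k ] , Wc = ⊥-elim (not-positive gy gx (≈-sym M′ r) k
            (WS.resp (λ { zero → refl ; (suc i) → refl }) (WS.neg Wc)))
    ... | + zero , Wc = mk≈ (T-ext (Tφ r)) Wc (mkShift
      (λ { zero → trans (cong ι (trans (s₀ gx) (sym (s₀ gy)))) (sym (ℤ.+-identityʳ _)) ; (suc i) → eq-s r i })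
      (λ { zero → trans (cong₂ (λ b k → sgn b (+ k)) (trans (s₀ gx) (sym (s₀ gy))) (trans (f₀ gx) (sym (f₀ gy))))
                        (sym (trans (cong (λ z → F y zero + z) (ℤ.*-zeroʳ (+ p))) (ℤ.+-identityʳ _)))
         ; (suc i) → eq-F r i })
      (λ { zero → G-zero {x} {y} (f₀ gx) (f₀ gy) r _ Wc ; (suc i) → eq-G r i }))

    -- A flip of a directed cycle through the contracted edge shifts μ by one, so boundedness of μ
    -- makes the flips in raise and lower terminate.
    μ : St′ → ℤ
    μ y = sumℤ (λ i → φ₀ (suc i) * ι (s y i))

    bound : ℤ
    bound = sumℤ (λ i → + ℤ.∣ φ₀ (suc i) ∣)

    μ-lower : ∀ y → 0ℤ ℤ.≤ μ y + bound
    μ-lower y = subst (0ℤ ℤ.≤_) (sumℤ-+ {m} (λ i → φ₀ (suc i) * ι (s y i)) (λ i → + ℤ.∣ φ₀ (suc i) ∣))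
        (0≤sumℤ {m} (λ i → lem (φ₀ (suc i)) (s y i)))
      where
      lem : ∀ a b → 0ℤ ℤ.≤ a * ι b + + ℤ.∣ a ∣
      lem (+ k) true rewrite ℤ.*-identityʳ (+ k) = +≤+ z≤n
      lem -[1+ k ] true rewrite ℕ.*-identityʳ k = ℤ.≤-reflexive (sym (ℤ.+-inverseˡ (+ suc k)))
      lem a false rewrite ℤ.*-zeroʳ a = +≤+ z≤n

    μ-upper : ∀ y → 0ℤ ℤ.≤ bound + - μ y
    μ-upper y = subst (0ℤ ℤ.≤_) eq (0≤sumℤ {m} (λ i → lem (φ₀ (suc i)) (s y i)))
      where
      lem : ∀ a b → 0ℤ ℤ.≤ + ℤ.∣ a ∣ + ℤ.-1ℤ * (a * ι b)
      lem a false rewrite ℤ.*-zeroʳ a = +≤+ z≤n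
      lem (+ k) true rewrite ℤ.*-identityʳ (+ k) | ℤ.-1*i≡-i (+ k) = ℤ.≤-reflexive (sym (ℤ.+-inverseʳ (+ k)))
      lem -[1+ k ] true = +≤+ z≤n
      eq : sumℤ (λ i → + ℤ.∣ φ₀ (suc i) ∣ + ℤ.-1ℤ * (φ₀ (suc i) * ι (s y i))) ≡ bound + - μ y
      eq = trans (sumℤ-+ {m} (λ i → + ℤ.∣ φ₀ (suc i) ∣) (λ i → ℤ.-1ℤ * (φ₀ (suc i) * ι (s y i))))
        (cong (λ z → bound + z) (trans (sumℤ-* {m} ℤ.-1ℤ (λ i → φ₀ (suc i) * ι (s y i))) (ℤ.-1*i≡-i (μ y))))

    -- A directed cycle through the edge restricts to a translation of the contraction. Extending
    -- that translation over the edge moves the value there by `q`; orthogonality of the cycle to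
    -- `φ₀` shows that `μ` moves by one.
    flip-cycle : ∀ b (y : St′) c → M.W (c ▸ G y) → ∀ d → M.W (directed (b ▸ s y) d) → d zero ≡ true →
      Σ[ y′ ∈ St′ ] y ≈ y′ × M.W (c + - (+ q * sgn b 1ℤ) ▸ G y′) × μ y′ ≡ μ y + sgn b 1ℤ
    flip-cycle b y c Wc d Wd d₀ = y′ , mk≈ (IsSubgroup.zer M′.T-sub) Wd′ sh , Wc′ , μ≡
      where
      Wd▸ : M.W (sgn b 1ℤ ▸ directed (s y) (d ∘ suc))
      Wd▸ = WS.resp (λ { zero → cong (λ x → sgn b (ι x)) d₀ ; (suc i) → refl }) Wd
      Wd′ : M′.W (directed (s y) (d ∘ suc))
      Wd′ = W-res Wd▸
      flipped = flip-W M′ y (d ∘ suc) Wd′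
      y′ = proj₁ flipped
      sh = proj₂ (proj₂ flipped)
      Wc′ : M.W (c + - (+ q * sgn b 1ℤ) ▸ G y′)
      Wc′ = WS.resp (λ { zero → refl ; (suc i) → sym (+-cancel (G y i) (G y′ i) _ (Shift.eq-G sh i)) })
              (WS.add Wc (WS.neg (WS.multℕ q Wd▸)))
      D = sumℤ (λ i → φ₀ (suc i) * directed (s y) (d ∘ suc) i)
      D≡ : sgn b 1ℤ + D ≡ 0ℤ
      D≡ = trans (cong (λ z → z + D) (sym (trans (cong (λ z → z * sgn b 1ℤ) φ₀≡1) (ℤ.*-identityˡ _)))) (M.orth Tφ₀ Wd▸)
      μ-shift : μ y ≡ μ y′ + D
      μ-shift = trans (sumℤ-cong {m} (λ i →
          trans (cong (λ z → φ₀ (suc i) * z) (trans (Shift.eq-s sh i) (cong (λ z → ι (s y′ i) + z) (ℤ.+-identityˡ _))))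
                (ℤ.*-distribˡ-+ (φ₀ (suc i)) (ι (s y′ i)) (directed (s y) (d ∘ suc) i))))
        (sumℤ-+ {m} (λ i → φ₀ (suc i) * ι (s y′ i)) (λ i → φ₀ (suc i) * directed (s y) (d ∘ suc) i))
      μ≡ : μ y′ ≡ μ y + sgn b 1ℤ
      μ≡ = sym (trans (cong (λ z → z + sgn b 1ℤ) μ-shift) (trans (ℤ.+-assoc (μ y′) D (sgn b 1ℤ))
             (trans (cong (λ z → μ y′ + z) (trans (ℤ.+-comm D _) D≡)) (ℤ.+-identityʳ _))))

    c▸G-aligned : ∀ b (y : St′) c → Aligned b c → ∀ e → Aligned ((b ▸ s y) e) ((c ▸ G y) e)
    c▸G-aligned b y c al zero = al
    c▸G-aligned b y c al (suc i) = g y i , refl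

    -- The edge is given the sign of the negative value `c`. A directed cut through it would be
    -- aligned with the flow and nonzero where the flow is, against orthogonality; so there is a
    -- directed cycle, and its flip adds `q` to `c` and takes one from `μ`. The fuel `N` is the
    -- distance of `μ` to its lower bound.
    raise : ∀ N (y : St′) c → M.W (c ▸ G y) → μ y + bound ≡ + N →
      Σ[ y′ ∈ St′ ] y ≈ y′ × Σ[ k ∈ ℕ ] M.W (+ k ▸ G y′)
    raise N y (+ k) Wc eq = y , ≈-refl M′ y , k , Wc
    raise N y c@(-[1+ k ]) Wc eq with M.paint (false ▸ s y) zero
    ... | inj₁ (d , Td , d₀) with aligned-orth M {p} {q} (false ▸ s y) Td Wc
            (λ e → ι-aligned ((false ▸ s y) e) (d e)) (c▸G-aligned false y c (suc k , refl)) zero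
    ...   | inj₁ z = ⊥-elim (unit≢0 false d₀ z)
    raise N y c@(-[1+ k ]) Wc eq | inj₂ (d , Wd , d₀) with flip-cycle false y c Wc d Wd d₀
    ... | y′ , r , Wc′ , μ≡ = go N (trans (cong (λ z → z + bound) μ≡)
            (trans (lem (μ y) bound) (cong (λ z → z + ℤ.-1ℤ) eq)))
      where
      lem : ∀ a b → a + ℤ.-1ℤ + b ≡ a + b + ℤ.-1ℤ
      lem = solve-∀
      go : ∀ N → μ y′ + bound ≡ + N + ℤ.-1ℤ → Σ[ y′ ∈ St′ ] y ≈ y′ × Σ[ k ∈ ℕ ] M.W (+ k ▸ G y′)
      go zero eq′ with subst (0ℤ ℤ.≤_) eq′ (μ-lower y′)
      ... | ()
      go (suc N) eq′ with raise N y′ _ Wc′ eq′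
      ... | y″ , r′ , res = y″ , ≈-trans M′ r r′ , res

    -- Flips of directed cycles subtract `q` as long as the value is at least `q`. A directed cut
    -- through the edge forces the value 0, and with `k` not below `q` this happens only for
    -- `q = 0`. In that case the flips leave `k` fixed but still raise `μ`, so such a cut is reached
    -- eventually.
    lower : ∀ N (y : St′) k → M.W (+ k ▸ G y) → bound + - μ y ≡ + N →
      Σ[ y′ ∈ St′ ] y ≈ y′ × Σ[ k ∈ ℕ ] M.W (+ k ▸ G y′) ×
        (k ℕ.< q ⊎ (k ≡ 0 × q ≡ 0 × Σ[ d ∈ (Fin (suc m) → Bool) ] M.T (directed (true ▸ s y′) d) × d zero ≡ true))
    lower N y k Wk eq with k ℕ.<? q
    ... | yes k<q = y , ≈-refl M′ y , k , Wk , inj₁ k<q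
    ... | no k≮q with M.paint (true ▸ s y) zero
    lower N y k Wk eq | no k≮q | inj₁ (d , Td , d₀) with aligned-orth M {p} {q} (true ▸ s y) Td Wk
            (λ e → ι-aligned ((true ▸ s y) e) (d e)) (c▸G-aligned true y (+ k) (k , refl)) zero
    ... | inj₁ z = ⊥-elim (unit≢0 true d₀ z)
    ... | inj₂ refl = y , ≈-refl M′ y , 0 , Wk , inj₂ (refl , ℕ.n≤0⇒n≡0 (ℕ.≮⇒≥ k≮q) , d , Td , d₀)
    lower N y k Wk eq | no k≮q | inj₂ (d , Wd , d₀) with flip-cycle true y (+ k) Wk d Wd d₀
    ... | y′ , r , Wc′ , μ≡ = go N (trans (cong (λ z → bound + - z) μ≡)
            (trans (lem (μ y) bound) (cong (λ z → z + ℤ.-1ℤ) eq)))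
      where
      lem : ∀ a b → b + - (a + 1ℤ) ≡ b + - a + ℤ.-1ℤ
      lem = solve-∀
      c≡ : + k + - (+ q * 1ℤ) ≡ + (k ∸ q)
      c≡ = trans (cong (λ z → + k + - z) (ℤ.*-identityʳ (+ q))) (trans (ℤ.[+m]-[+n]≡m⊖n k q) (ℤ.⊖-≥ (ℕ.≮⇒≥ k≮q)))
      go : ∀ N → bound + - μ y′ ≡ + N + ℤ.-1ℤ → _
      go zero eq′ with subst (0ℤ ℤ.≤_) eq′ (μ-upper y′)
      ... | ()
      go (suc N) eq′ with lower N y′ (k ∸ q) (WS.resp (▸-cong c≡ (λ _ → refl)) Wc′) eq′
      ... | y″ , r′ , res = y″ , ≈-trans M′ r r′ , res

    lift : (y : St′) → Σ[ x ∈ St ] Σ[ gx ∈ Good x ] y ≈ restrict x (f₀ gx)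
    lift y with W-ext (WG y)
    ... | c , Wc with raise ℤ.∣ μ y + bound ∣ y c Wc (sym (ℤ.0≤i⇒+∣i∣≡i (μ-lower y)))
    ... | y₁ , r₁ , k , Wk with lower ℤ.∣ bound + - μ y₁ ∣ y₁ k Wk (sym (ℤ.0≤i⇒+∣i∣≡i (μ-upper y₁)))
    ... | y₂ , r₂ , k′ , Wk′ , c = x , good , ≈-trans M′ (≈-trans M′ r₁ r₂)
                (pointwise-≈ M′ (λ _ → refl) (λ _ → refl) (λ _ → refl))
      where
      small : ∀ {A : Set} → k′ ℕ.< q ⊎ (k′ ≡ 0 × A) → k′ ℕ.≤ q
      small (inj₁ lt) = ℕ.<⇒≤ lt
      small (inj₂ (refl , _)) = z≤n
      x = extend y₂ k′ (small c) Wk′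
      good : Good x
      good = mkGood refl refl ([ inj₁ , (λ { (_ , q0 , d , Td , d₀) →
        inj₂ (q0 , d , TS.resp (λ { zero → refl ; (suc i) → refl }) Td , d₀) }) ]′ c)

    -- On classes `lift` and `restrict` are inverse to each other. Good states agree in sign on the
    -- edge, so a translation between them has no tension there and restricts to the contraction.
    enumerate-Good : ∀ {k} → Enumeration {p = p} {q} {M′.T} {M′.W} (λ _ → ⊤) k →
                     Enumeration {p = p} {q} {M.T} {M.W} Good k
    enumerate-Good {k} E = record
      { elt = elt′ ; sound = good
      ; distinct = λ i j r → distinct i j (≈-trans M′ (proj₂ (proj₂ (lift (elt i)))) (≈-trans M′
          (restrict-≈ r (f₀ (good i)) (f₀ (good j)) (proj₁ (same-sign M r zero (trans (s₀ (good i)) (sym (s₀ (good j)))))))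
          (≈-sym M′ (proj₂ (proj₂ (lift (elt j)))))))
      ; complete = λ x gx → let (i , r) = complete (restrict x (f₀ gx)) tt in
          i , extend-≈ gx (good i) (≈-trans M′ r (proj₂ (proj₂ (lift (elt i))))) }
      where
      open Enumeration E
      elt′ = λ i → proj₁ (lift (elt i))
      good : ∀ i → Good (elt′ i)
      good i = proj₁ (proj₂ (lift (elt i)))

-- Splitting the classes at an ordinary edge

difference≡n : ∀ {b b′ d i j n} → b ≡ true → b′ ≡ false → d ≡ true →
  sgn b (+ i) ≡ sgn b′ (+ j) + + n * sgn b (ι d) → i ℕ.+ j ≡ n
difference≡n {i = i} {j} {n} refl refl refl eq = ℤ.+-injective (begin
  + i + + j                  ≡⟨ cong (λ z → + i + z) (ℤ.neg-involutive (+ j)) ⟨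
  + i + - - + j              ≡⟨ +-cancel (+ i) (+ n * 1ℤ) (- + j) (trans eq (ℤ.+-comm (- + j) _)) ⟨
  + n * 1ℤ                   ≡⟨ ℤ.*-identityʳ (+ n) ⟩
  + n ∎)
  where open ≡-Reasoning

rebound : ∀ {b b′ d i j} → b ≡ false → b′ ≡ true → d ≡ true →
  sgn b (+ i) ≡ sgn b′ (+ j) + + i * sgn b (ι d) → j ≡ 0
rebound {i = i} {j} refl refl refl eq = ℤ.+-injective (begin
  + j                              ≡⟨ lem (+ j) (+ i) ⟩
  (+ j + + i * ℤ.-1ℤ) + + i        ≡⟨ cong (λ z → z + + i) eq ⟨
  - + i + + i                      ≡⟨ ℤ.+-inverseˡ (+ i) ⟩
  0ℤ ∎)
  where
  open ≡-Reasoning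
  lem : ∀ a b → a ≡ (a + b * ℤ.-1ℤ) + b
  lem = solve-∀

signed-zero : ∀ b {k} → sgn b (+ k) ≡ 0ℤ → k ≡ 0
signed-zero b eq = ℤ.+-injective (sgn-zero b eq)

mkGood-cut : ∀ {m p q} {T W : V (suc m) → Set} {x : State p q T W} →
  s x zero ≡ true → f x zero ≡ 0 → g x zero ≡ 0 → InCut x → Good x
mkGood-cut {q = zero} s₀ f₀ g₀ cut = mkGood s₀ f₀ (inj₂ (refl , cut))
mkGood-cut {q = suc q} {x = x} s₀ f₀ g₀ cut = mkGood s₀ f₀ (inj₁ (subst (ℕ._< suc q) (sym g₀) (s≤s z≤n)))

module _ {m} (M : Lattices (suc m)) where
  open Lattices M
  private
    module TS = IsSubgroup T-sub
    module WS = IsSubgroup W-sub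

  directed-not : ∀ (s d : Fin (suc m) → Bool) e → - directed s d e ≡ directed (not ∘ s) d e
  directed-not s d e = sym (sgn-not (s e) _)

  -- The cut forces `G` to vanish on the edge, and its flip exchanges sign 1 with value `f` for sign
  -- 0 with value `p - f`. Sign 1 with value 0 is `Good`; sign 0 with a value below `p` is `Good` in
  -- the dual. Each pair exchanged by the flip contains one of these.
  cover-cut : ∀ {p q} (x : State p q T W) → InCut x →
    Σ[ y ∈ State p q T W ] (Good y ⊎ Good (dual M y)) × x ≈ y
  cover-cut {p} {q} x (d , Td , d₀) = go (s x zero) refl
    where
    g₀ : g x zero ≡ 0
    g₀ = signed-zero (s x zero) ([ (λ z → ⊥-elim (unit≢0 (s x zero) d₀ z)) , id ]′
           (aligned-orth M {p} {q} (s x) Td (WG x) (λ e → ι-aligned (s x e) (d e)) (λ e → g x e , refl) zero))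
    y = proj₁ (flip-T M x d Td)
    s≡ = proj₁ (proj₂ (flip-T M x d Td))
    sh = proj₂ (proj₂ (flip-T M x d Td))
    x≈y : x ≈ y
    x≈y = mk≈ Td WS.zer sh
    gy₀ : g y zero ≡ 0
    gy₀ = signed-zero (s y zero) (trans (sym (+-*0 (G y zero) q)) (trans (sym (Shift.eq-G sh zero))
            (trans (cong (λ k → sgn (s x zero) (+ k)) g₀) (sgn-0 (s x zero)))))
    sy₀ : s y zero ≡ not (s x zero)
    sy₀ = trans (cong (λ t → t zero) s≡) (trans (cong (λ b → s x zero xor b) d₀) (xor-true (s x zero)))
      where
      xor-true : ∀ b → b xor true ≡ not b
      xor-true true = refl
      xor-true false = refl
    cut-y : InCut y
    cut-y = d , TS.resp (λ e → trans (directed-not (s x) d e) (flipped e)) (TS.neg Td) , d₀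
      where
      flipped : ∀ e → directed (not ∘ s x) d e ≡ directed (s y) d e
      flipped e rewrite s≡ with s x e | d e
      ... | true | true = refl
      ... | true | false = refl
      ... | false | true = refl
      ... | false | false = refl
    go : ∀ b → s x zero ≡ b → Σ[ y ∈ State p q T W ] (Good y ⊎ Good (dual M y)) × x ≈ y
    go true sx with f x zero ℕ.≟ 0
    ... | yes f₀ = x , inj₁ (mkGood-cut sx f₀ g₀ (d , Td , d₀)) , ≈-refl M x
    ... | no f≢0 = y , inj₂ (mkGood (trans (cong not sy₀) (trans (cong (not ∘ not) sx) refl)) gy₀
        (inj₁ (subst (f y zero ℕ.<_) (difference≡n sx (trans sy₀ (cong not sx)) d₀ (Shift.eq-F sh zero))
          (ℕ.m<n+m (f y zero) (ℕ.n≢0⇒n>0 f≢0))))) , x≈y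
    go false sx with f x zero ℕ.<? p
    ... | yes lt = x , inj₂ (mkGood (cong not sx) g₀ (inj₁ lt)) , ≈-refl M x
    ... | no ≮p = y , inj₁ (mkGood-cut (trans sy₀ (cong not sx))
        (rebound sx (trans sy₀ (cong not sx)) d₀
          (subst (λ n → F x zero ≡ F y zero + + n * directed (s x) d zero)
                 (ℕ.≤-antisym (ℕ.≮⇒≥ ≮p) (f≤p x zero)) (Shift.eq-F sh zero)))
        gy₀ cut-y) , x≈y

  Good-dual-dual : ∀ {p q} {x : State p q T W} → Good x → Good (dual (dualL M) (dual M x))
  Good-dual-dual {x = x} gx = mkGood (trans (not-involutive _) (s₀ gx)) (f₀ gx)
    ([ inj₁ , (λ { (q0 , d , Td , d₀) → inj₂ (q0 , d ,
       TS.resp (λ e → cong (λ b → sgn b (ι (d e))) (sym (not-involutive (s x e)))) Td , d₀) }) ]′ (slack gx))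

module _ {m} (M : Lattices (suc m)) where
  open Lattices M
  private
    module WS = IsSubgroup W-sub

  -- By Minty's lemma the edge lies in a directed cut or in a directed cycle, and the latter is a
  -- directed cut of the dual.
  cover : ∀ {p q} (x : State p q T W) → Σ[ y ∈ State p q T W ] (Good y ⊎ Good (dual M y)) × x ≈ y
  cover x with paint (s x) zero
  ... | inj₁ cut = cover-cut M x cut
  ... | inj₂ (d , Wd , d₀) with cover-cut (dualL M) (dual M x)
                                 (d , WS.resp (directed-not M (s x) d) (WS.neg Wd) , d₀)
  ...   | y , gy , r = dual (dualL M) y , swap ([ inj₁ ∘ Good-dual-dual (dualL M) , inj₂ ]′ gy) ,
                       ≈-trans M (dual-dual M x) (dual-≈ (dualL M) r)

  -- A reversal of the edge by a cycle that ends with value 0 started from value `q`, which `slack`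
  -- forbids. In the other case of `slack`, a directed cut and the aligned flow `γ r` would both be
  -- nonzero on the edge.
  half-separated : ∀ {p q} {x y : State p q T W} → Good x → s y zero ≡ false → g y zero ≡ 0 →
    (r : x ≈ y) → γ r zero ≡ 1ℤ → ⊥
  half-separated {p} {q} {x} {y} gx sy gy r γ1 with slack gx
  ... | inj₁ lt = ℕ.<-irrefl gx≡q lt
    where
    gx≡q : g x zero ≡ q
    gx≡q = trans (sym (ℕ.+-identityʳ _)) (difference≡n (s₀ gx) (refl {x = false}) (refl {x = true})
      (trans (eq-G r zero) (cong₂ (λ a b → a + + q * b) (cong₂ (λ b k → sgn b (+ k)) sy gy)
        (trans γ1 (cong (λ b → sgn b 1ℤ) (sym (s₀ gx)))))))
  ... | inj₂ (_ , d , Td , d₀) = [ unit≢0 (s x zero) d₀ , (λ z → 1≢0 (trans (sym γ1) z)) ]′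
    (aligned-orth M {p} {q} (s x) Td (Wγ r) (λ e → ι-aligned (s x e) (d e))
      (λ e → unit-sum-alignedʳ (s x e) (s y e) (eq-s r e) (≈-disjoint M r e)) zero)
    where
    1≢0 : 1ℤ ≡ 0ℤ → ⊥
    1≢0 ()

module _ {m} (M : Lattices (suc m)) where
  open Lattices M

  -- The signs on the edge differ, so exactly one of `φ` and `γ` equals 1 there. The case of `φ` is
  -- that of `γ` in the dual, read from `y` to `x`.
  separated : ∀ {p q} {x y : State p q T W} → Good x → Good (dual M y) → x ≈ y → ⊥
  separated {x = x} {y} gx gy r with ≈-disjoint M r zero
  ... | inj₁ φ0 = half-separated M gx (not-true (s₀ gy)) (f₀ gy) r
      (trans (sym (ℤ.+-identityˡ _)) (trans (cong (λ z → z + γ r zero) (sym φ0)) sum1))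
    where
    sum1 : φ r zero + γ r zero ≡ 1ℤ
    sum1 = trans (sym (ℤ.+-identityˡ _)) (trans (sym (trans (eq-s r zero)
      (cong (λ b → ι b + (φ r zero + γ r zero)) (not-true (s₀ gy))))) (cong ι (s₀ gx)))
  ... | inj₂ γ0 = half-separated (dualL M) gy (cong not (s₀ gx)) (f₀ gx) (≈-sym (dualL M) (dual-≈ M r))
      (trans (ℤ.neg-involutive _) (trans (sym (ℤ.+-identityʳ _)) (trans (cong (λ z → φ r zero + z) (sym γ0)) sum1)))
    where
    sum1 : φ r zero + γ r zero ≡ 1ℤ
    sum1 = trans (sym (ℤ.+-identityˡ _)) (trans (sym (trans (eq-s r zero)
      (cong (λ b → ι b + (φ r zero + γ r zero)) (not-true (s₀ gy))))) (cong ι (s₀ gx)))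

  enumerate-ordinary : ∀ {p q k l} → Enumeration {p = p} {q} {T} {W} Good k → Enumeration {p = q} {p} {W} {T} Good l →
    Enumeration {p = p} {q} {T} {W} (λ _ → ⊤) (k ℕ.+ l)
  enumerate-ordinary {p} {q} {k} {l} E D = record
    { elt = at ∘ splitAt k ; sound = λ _ → tt
    ; distinct = λ i j r → trans (sym (F.join-splitAt k l i))
        (trans (cong (join k l) (inj (splitAt k i) (splitAt k j) r)) (F.join-splitAt k l j))
    ; complete = λ x _ → let (t , r) = com x in join k l t , subst (λ t → x ≈ at t) (sym (F.splitAt-join k l t)) r }
    where
    module E = Enumeration E
    module D = Enumeration D
    at : Fin k ⊎ Fin l → State p q T W
    at = [ E.elt , dual (dualL M) ∘ D.elt ]′
    sep : ∀ i j → E.elt i ≈ dual (dualL M) (D.elt j) → ⊥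
    sep i j = separated (E.sound i) (Good-dual-dual (dualL M) (D.sound j))
    inj : ∀ t u → at t ≈ at u → t ≡ u
    inj (inj₁ i) (inj₁ j) r = cong inj₁ (E.distinct i j r)
    inj (inj₁ i) (inj₂ j) r = ⊥-elim (sep i j r)
    inj (inj₂ i) (inj₁ j) r = ⊥-elim (sep j i (≈-sym M r))
    inj (inj₂ i) (inj₂ j) r = cong inj₂ (D.distinct i j (≈-trans (dualL M) (dual-dual (dualL M) (D.elt i))
      (≈-trans (dualL M) (dual-≈ M r) (≈-sym (dualL M) (dual-dual (dualL M) (D.elt j))))))
    com : ∀ x → Σ[ t ∈ Fin k ⊎ Fin l ] x ≈ at t
    com x with cover M x
    ... | y , inj₁ gy , r = let (i , r′) = E.complete y gy in inj₁ i , ≈-trans M r r′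
    ... | y , inj₂ gy , r = let (i , r′) = D.complete (dual M y) gy in
          inj₂ i , ≈-trans M r (≈-trans M (dual-dual M y) (dual-≈ (dualL M) r′))

-- Duality of enumerations, loops, and the edgeless case

module _ {m} (M : Lattices m) where
  open Lattices M

  enumerate-dual : ∀ {p q k} → Enumeration {p = p} {q} {T} {W} (λ _ → ⊤) k → Enumeration {p = q} {p} {W} {T} (λ _ → ⊤) k
  enumerate-dual E = record
    { elt = dual M ∘ elt ; sound = λ _ → tt
    ; distinct = λ i j r → distinct i j (≈-trans M (dual-dual M (elt i))
                   (≈-trans M (dual-≈ (dualL M) r) (≈-sym M (dual-dual M (elt j)))))
    ; complete = λ x _ → let (i , r) = complete (dual (dualL M) x) tt in
                   i , ≈-trans (dualL M) (dual-dual (dualL M) x) (dual-≈ M r) }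
    where open Enumeration E

module _ {m} {M : Lattices (suc m)} {M′ : Lattices m} (con : Contraction M M′) {p q : ℕ}
  (loop : ∀ {φ} → Lattices.T M φ → φ zero ≡ 0ℤ) (unit : Lattices.W M (1ℤ ▸ λ _ → 0ℤ)) where
  open Contraction con
  private
    module M = Lattices M
    module M′ = Lattices M′
    module TS = IsSubgroup M.T-sub
    module WS = IsSubgroup M.W-sub

  W-ext-any : ∀ {γ} → M′.W γ → ∀ c → M.W (c ▸ γ)
  W-ext-any {v} Wγ c with W-ext Wγ
  ... | c′ , Wc = WS.resp (λ { zero → lem c′ c ; (suc i) → trans (cong (λ z → v i + z) (ℤ.*-zeroʳ (c + - c′))) (ℤ.+-identityʳ _) })
                    (WS.add Wc (WS.mult (c + - c′) unit))
    where
    lem : ∀ a b → a + (b + - a) * 1ℤ ≡ b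
    lem = solve-∀

  -- The unit vector of the loop is a flow, so the sign of the loop can be made `true`. With this
  -- sign fixed no translation touches the loop, and its value, any of 0 to `q`, is an invariant of
  -- the class.
  enumerate-loop : ∀ {k} → Enumeration {p = p} {q} {M′.T} {M′.W} (λ _ → ⊤) k →
                   Enumeration {p = p} {q} {M.T} {M.W} (λ _ → ⊤) (suc q ℕ.* k)
  enumerate-loop {k} E = record
    { elt = at ∘ remQuot k ; sound = λ _ → tt
    ; distinct = λ i j r → trans (sym (F.combine-remQuot {suc q} k i))
        (trans (cong (λ (a , b) → combine a b) (inj (remQuot k i) (remQuot k j) r)) (F.combine-remQuot {suc q} k j))
    ; complete = λ x _ → let (j , i , r) = com x in
        combine j i , subst (λ t → x ≈ at t) (sym (F.remQuot-combine j i)) r }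
    where
    open Enumeration E
    at : Fin (suc q) × Fin k → State p q M.T M.W
    at (j , i) = extend con (elt i) (toℕ j) (ℕ.≤-pred (F.toℕ<n j)) (W-ext-any (WG (elt i)) (+ toℕ j))
    inj : ∀ t u → at t ≈ at u → t ≡ u
    inj (j , i) (j′ , i′) r with same-sign M r zero refl
    ... | φ0 , γ0 = cong₂ _,_
      (F.toℕ-injective (ℤ.+-injective (trans (eq-G r zero) (trans (cong (λ z → + toℕ j′ + + q * z) γ0) (+-*0 (+ toℕ j′) q)))))
      (distinct i i′ (≈-trans M′ (pointwise-≈ M′ (λ _ → refl) (λ _ → refl) (λ _ → refl))
         (≈-trans M′ (restrict-≈ con r refl refl φ0) (pointwise-≈ M′ (λ _ → refl) (λ _ → refl) (λ _ → refl)))))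
    positive : ∀ x → s x zero ≡ true → Σ[ j ∈ Fin (suc q) ] Σ[ i ∈ Fin k ] x ≈ at (j , i)
    positive x s₀ with complete (restrict con x fx₀) tt
      where
      fx₀ : f x zero ≡ 0
      fx₀ = signed-zero (s x zero) (loop (TF x))
    -- Every integer extends `γ` over the loop; 0 is the choice that leaves the value on the loop
    -- unchanged.
    ... | i , r = j , i , mk≈ (T-ext (Tφ r)) (W-ext-any (Wγ r) 0ℤ) (mkShift
        (λ { zero → trans (cong ι s₀) (sym (ℤ.+-identityʳ _)) ; (suc e) → eq-s r e })
        (λ { zero → trans (loop (TF x)) (sym (+-*0 0ℤ p)) ; (suc e) → eq-F r e })
        (λ { zero → trans (cong (λ b → sgn b (+ g x zero)) s₀) (trans (cong +_ (sym (F.toℕ-fromℕ< (s≤s (g≤q x zero)))))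
                          (sym (+-*0 (+ toℕ j) q)))
           ; (suc e) → eq-G r e }))
      where
      j = fromℕ< (s≤s (g≤q x zero))
    com : ∀ x → Σ[ j ∈ Fin (suc q) ] Σ[ i ∈ Fin k ] x ≈ at (j , i)
    com x with s x zero in s₀
    ... | true = positive x s₀
    ... | false = let (y , s≡ , sh) = flip-W M x (true ▸ λ _ → false) Wd
                      (j , i , r) = positive y (trans (cong (λ t → t zero) s≡) (cong (λ b → b xor true) s₀))
                  in j , i , ≈-trans M (mk≈ TS.zer Wd sh) r
      where
      Wd : M.W (directed (s x) (true ▸ λ _ → false))
      Wd = WS.resp (λ { zero → cong (λ b → sgn b 1ℤ) (sym s₀) ; (suc i) → sym (sgn-0 (s x (suc i))) }) (WS.neg unit)

enumerate-empty : (M : Lattices 0) → ∀ {p q} → Enumeration {p = p} {q} {Lattices.T M} {Lattices.W M} (λ _ → ⊤) 1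
enumerate-empty M = record
  { elt = λ _ → mkState (λ ()) (λ ()) (λ ()) (λ ()) (λ ()) (TS.resp (λ ()) TS.zer) (WS.resp (λ ()) WS.zer)
  ; sound = λ _ → tt
  ; distinct = λ { zero zero _ → refl }
  ; complete = λ x _ → zero , mk≈ TS.zer WS.zer (mkShift (λ ()) (λ ()) (λ ())) }
  where
  module TS = IsSubgroup (Lattices.T-sub M)
  module WS = IsSubgroup (Lattices.W-sub M)

-- Tensions and flows of a graph

pulse : ∀ {m} → Fin m → V m
pulse e i = ι (i == e)

sumℤ-pulse : ∀ {m} (f : V m) e → sumℤ (λ i → f i * pulse e i) ≡ f e
sumℤ-pulse {suc m} f zero = trans (cong₂ _+_ (ℤ.*-identityʳ (f zero))
  (trans (sumℤ-cong {m} (λ i → ℤ.*-zeroʳ (f (suc i)))) (sumℤ-zero m))) (ℤ.+-identityʳ (f zero))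
sumℤ-pulse {suc m} f (suc e) = trans (cong₂ _+_ (ℤ.*-zeroʳ (f zero)) (sumℤ-pulse (f ∘ suc) e)) (ℤ.+-identityˡ _)

module _ {n : ℕ} where

  Const : Edges {n} → (Fin n → ℤ) → Set
  Const con h = All (λ (a , b) → h a ≡ h b) con

  Const-zero : ∀ con → Const con (λ _ → 0ℤ)
  Const-zero con = All.tabulate λ _ → refl

  Const-add : ∀ {con h k} → Const con h → Const con k → Const con (λ v → h v + k v)
  Const-add ch ck = All.zipWith (λ (p , q) → cong₂ _+_ p q) (ch , ck)

  Const-scale : ∀ {con h} c → Const con h → Const con (λ v → c * h v)
  Const-scale c = All.map (cong (λ z → c * z))

  conn-const : ∀ {con h} → Const con h → ∀ {u v} → conn con u v ≡ true → h u ≡ h v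
  conn-const {con} {h} ch {u} r = conn-ind {L = con} (λ v → h u ≡ h v)
    (All.map (λ eq → (λ p → trans p eq) , (λ p → trans p (sym eq))) ch) r refl

  component : Edges {n} → Fin n → Fin n → ℤ
  component L u v = ι (conn L u v)

  component-const : ∀ L u → Const L (component L u)
  component-const L u = All.map (λ (p , q) → cong ι (⇔⇒≡ p q)) (conn-joins L u)

  Const-⊆ : ∀ {L L′ : Edges {n}} {h} → (∀ {p} → p ∈ L → p ∈ L′) → Const L′ h → Const L h
  Const-⊆ sub ch = All.tabulate λ i → All.lookup ch (sub i)

  coboundary : ∀ {m} → Ends n m → (Fin n → ℤ) → V m
  coboundary ends h e = h (proj₁ (ends e)) + - h (proj₂ (ends e))

  pairing : ∀ {m} → Ends n m → (Fin n → ℤ) → V m → ℤ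
  pairing ends h γ = sumℤ (λ e → coboundary ends h e * γ e)

  -- Tensions and flows, signed with respect to the reference orientation,
  -- of the graph in which the edges of con have been contracted.
  module _ {m} (con : Edges {n}) (ends : Ends n m) where

    Tension : V m → Set
    Tension φ = Σ[ h ∈ (Fin n → ℤ) ] Const con h × (∀ e → φ e ≡ coboundary ends h e)

    -- Orthogonality to the coboundaries of all potentials constant on `con` is Kirchhoff's law at
    -- every vertex of the contracted graph, stated without constructing those vertices.
    Flow : V m → Set
    Flow γ = ∀ h → Const con h → pairing ends h γ ≡ 0ℤ

  module _ {m} (ends : Ends n m) where

    pairing-cong : ∀ h {γ γ′} → γ ≗ γ′ → pairing ends h γ ≡ pairing ends h γ′
    pairing-cong h eq = sumℤ-cong {m} (λ e → cong (λ z → coboundary ends h e * z) (eq e))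

    pairing-zero : ∀ h → pairing ends h (λ _ → 0ℤ) ≡ 0ℤ
    pairing-zero h = trans (sumℤ-cong {m} (λ e → ℤ.*-zeroʳ (coboundary ends h e))) (sumℤ-zero m)

    pairing-+ : ∀ h γ γ′ → pairing ends h (λ e → γ e + γ′ e) ≡ pairing ends h γ + pairing ends h γ′
    pairing-+ h γ γ′ = trans (sumℤ-cong {m} (λ e → ℤ.*-distribˡ-+ (coboundary ends h e) (γ e) (γ′ e)))
      (sumℤ-+ {m} (λ e → coboundary ends h e * γ e) (λ e → coboundary ends h e * γ′ e))

    pairing-* : ∀ h c γ → pairing ends h (λ e → c * γ e) ≡ c * pairing ends h γ
    pairing-* h c γ = trans (sumℤ-cong {m} (λ e → lem (coboundary ends h e) c (γ e)))
      (sumℤ-* {m} c (λ e → coboundary ends h e * γ e))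
      where
      lem : ∀ a c b → a * (c * b) ≡ c * (a * b)
      lem = solve-∀

    pairing-neg : ∀ h γ → pairing ends h (λ e → - γ e) ≡ - pairing ends h γ
    pairing-neg h γ = trans (pairing-cong h (λ e → sym (ℤ.-1*i≡-i (γ e))))
      (trans (pairing-* h ℤ.-1ℤ γ) (ℤ.-1*i≡-i (pairing ends h γ)))

    pairing-pulse : ∀ h e → pairing ends h (pulse e) ≡ coboundary ends h e
    pairing-pulse h e = sumℤ-pulse (coboundary ends h) e

    pairing-+ˡ : ∀ h k c γ → pairing ends (λ v → h v + c * k v) γ ≡ pairing ends h γ + c * pairing ends k γ
    pairing-+ˡ h k c γ = trans (sumℤ-cong {m} (λ e → lem (h (proj₁ (ends e))) (h (proj₂ (ends e)))
        (k (proj₁ (ends e))) (k (proj₂ (ends e))) c (γ e)))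
      (trans (sumℤ-+ {m} (λ e → coboundary ends h e * γ e) (λ e → c * (coboundary ends k e * γ e)))
        (cong (λ z → pairing ends h γ + z) (sumℤ-* {m} c (λ e → coboundary ends k e * γ e))))
      where
      lem : ∀ a b x y c g → ((a + c * x) + - (b + c * y)) * g ≡ (a + - b) * g + c * ((x + - y) * g)
      lem = solve-∀

  module _ {m} (con : Edges {n}) (ends : Ends n m) where

    opaque
      Tension-subgroup : IsSubgroup (Tension con ends)
      Tension-subgroup = record
        { resp = λ { eq (h , ch , p) → h , ch , λ e → trans (sym (eq e)) (p e) }
        ; zer = (λ _ → 0ℤ) , Const-zero con , λ _ → refl
        ; add = λ { (h , ch , p) (k , ck , q) → (λ v → h v + k v) , Const-add ch ck ,
            λ e → trans (cong₂ _+_ (p e) (q e)) (lem₁ (h (proj₁ (ends e))) (h (proj₂ (ends e))) (k (proj₁ (ends e)))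
                (k (proj₂ (ends e)))) }
        ; neg = λ { (h , ch , p) → (λ v → - h v) , All.map (cong -_) ch ,
            λ e → trans (cong -_ (p e)) (lem₂ (h (proj₁ (ends e))) (h (proj₂ (ends e)))) } }
        where
        lem₁ : ∀ a b c d → (a + - b) + (c + - d) ≡ (a + c) + - (b + d)
        lem₁ = solve-∀
        lem₂ : ∀ a b → - (a + - b) ≡ - a + - (- b)
        lem₂ = solve-∀

      Flow-subgroup : IsSubgroup (Flow con ends)
      Flow-subgroup = record
        { resp = λ eq Wγ h ch → trans (sym (pairing-cong ends h eq)) (Wγ h ch)
        ; zer = λ h _ → pairing-zero ends h
        ; add = λ {u} {v} Wu Wv h ch → trans (pairing-+ ends h u v) (cong₂ _+_ (Wu h ch) (Wv h ch))
        ; neg = λ {u} Wu h ch → trans (pairing-neg ends h u) (cong -_ (Wu h ch)) }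

      orthogonal : ∀ {φ γ} → Tension con ends φ → Flow con ends γ → sumℤ (λ e → φ e * γ e) ≡ 0ℤ
      orthogonal {γ = γ} (h , ch , p) Wγ = trans (sumℤ-cong {m} (λ e → cong (λ z → z * γ e) (p e))) (Wγ h ch)

    -- Minty's colouring lemma for graphs

    module _ (s : Fin m → Bool) where
      src tgt : Fin m → Fin n
      src e = if s e then proj₁ (ends e) else proj₂ (ends e)
      tgt e = if s e then proj₂ (ends e) else proj₁ (ends e)

      drop-along : ∀ h e → coboundary ends h e * sgn (s e) 1ℤ ≡ h (src e) + - h (tgt e)
      drop-along h e with s e
      ... | true = ℤ.*-identityʳ _
      ... | false = lem (h (proj₁ (ends e))) (h (proj₂ (ends e)))
        where
        lem : ∀ a b → (a + - b) * ℤ.-1ℤ ≡ b + - a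
        lem = solve-∀

      -- The edges `d` of a directed walk from `b` to `w`, recorded only through their boundary. By
      -- `inside`, an edge that leaves `R` or ends in `b` is not yet in `d`, so it can be added
      -- without producing a coefficient 2.
      record Reached (b : Fin n) (R : Fin n → Bool) (w : Fin n) : Set where
        constructor mkReached
        field
          d : Fin m → Bool
          inside : ∀ e → d e ≡ true → R (tgt e) ≡ true × tgt e ≢ b
          unit-flow : ∀ h → Const con h → pairing ends h (directed s d) ≡ h b + - h w

      insert : (Fin m → Bool) → Fin m → Fin m → Bool
      insert d e i = d i ∨ (i == e)

      pairing-insert : ∀ d e h → d e ≡ false →
        pairing ends h (directed s (insert d e)) ≡ pairing ends h (directed s d) + (h (src e) + - h (tgt e))
      pairing-insert d e h de = begin
        pairing ends h (directed s (insert d e))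
          ≡⟨ sumℤ-cong {m} pointwise ⟩
        sumℤ (λ i → coboundary ends h i * directed s d i + (coboundary ends h i * sgn (s i) 1ℤ) * pulse e i)
          ≡⟨ sumℤ-+ {m} (λ i → coboundary ends h i * directed s d i) (λ i → (coboundary ends h i * sgn (s i) 1ℤ) * pulse e i) ⟩
        pairing ends h (directed s d) + sumℤ (λ i → (coboundary ends h i * sgn (s i) 1ℤ) * pulse e i)
          ≡⟨ cong (λ z → pairing ends h (directed s d) + z)
               (trans (sumℤ-pulse (λ i → coboundary ends h i * sgn (s i) 1ℤ) e) (drop-along h e)) ⟩
        pairing ends h (directed s d) + (h (src e) + - h (tgt e)) ∎
        where
        open ≡-Reasoning
        old : ∀ x c → x ≡ x + c * 0ℤ
        old x c = sym (trans (cong (λ z → x + z) (ℤ.*-zeroʳ c)) (ℤ.+-identityʳ x))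
        new : ∀ x c → x ≡ x * 0ℤ + c → x ≡ c
        new x c eq = trans eq (trans (cong (λ z → z + c) (ℤ.*-zeroʳ x)) (ℤ.+-identityˡ c))
        pointwise : ∀ i → coboundary ends h i * directed s (insert d e) i
                        ≡ coboundary ends h i * directed s d i + (coboundary ends h i * sgn (s i) 1ℤ) * pulse e i
        pointwise i with i F.≟ e
        ... | no _ rewrite ∨-identityʳ (d i) = old (coboundary ends h i * directed s d i) (coboundary ends h i * sgn (s i) 1ℤ)
        ... | yes refl rewrite de | sgn-0 (s e) = sym (trans
            (cong₂ _+_ (ℤ.*-zeroʳ (coboundary ends h e)) (ℤ.*-identityʳ (coboundary ends h e * sgn (s e) 1ℤ)))
          (ℤ.+-identityˡ (coboundary ends h e * sgn (s e) 1ℤ)))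

      add-vertex : (Fin n → Bool) → Fin n → Fin n → Bool
      add-vertex R w v = R v ∨ (v == w)

      record Region (b : Fin n) (R : Fin n → Bool) : Set where
        constructor mkRegion
        field
          source : R b ≡ true
          reached : ∀ w → R w ≡ true → Reached b R w
      open Region

      widen : ∀ {b R w v} → Reached b R v → Reached b (add-vertex R w) v
      widen (mkReached d i u) = mkReached d (λ e de → ∨-introˡ (proj₁ (i e de)) , proj₂ (i e de)) u

      grow : ∀ {b R w} → Region b R → Reached b (add-vertex R w) w → Region b (add-vertex R w)
      grow {b} {R} {w} reg r = mkRegion (∨-introˡ (source reg)) λ v h →
        [ (λ old → widen {w = w} (reached reg v old)) , (λ new → subst (Reached b _) (sym (==⇒≡ new)) r) ]′ (∨-true {R v} h)

      cross-edge : ∀ {b R} → Region b R → ∀ e → R (src e) ≡ true → R (tgt e) ≡ false → Reached b (add-vertex R (tgt e)) (tgt e)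
      cross-edge {b} {R} reg e inn out with reached reg (src e) inn
      ... | mkReached d i u = mkReached (insert d e) inside′ λ h ch →
          trans (pairing-insert d e h de) (trans (cong (λ z → z + (h (src e) + - h (tgt e))) (u h ch))
              (lem (h b) (h (src e)) (h (tgt e))))
        where
        lem : ∀ a b c → (a + - b) + (b + - c) ≡ a + - c
        lem = solve-∀
        de : d e ≡ false
        de = ¬true⇒false λ t → true≢false (trans (sym (proj₁ (i e t))) out)
        inside′ : ∀ i → insert d e i ≡ true → add-vertex R (tgt e) (tgt i) ≡ true × tgt i ≢ b
        inside′ i′ h with ∨-true {d i′} h
        ... | inj₁ p = ∨-introˡ (proj₁ (i i′ p)) , proj₂ (i i′ p)
        ... | inj₂ p with ==⇒≡ {u = i′} {e} p
        ...   | refl = ∨-introʳ {R (tgt e)} (==-refl (tgt e)) , λ eq → true≢false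
            (trans (sym (source reg)) (trans (cong R (sym eq)) out))

      cross-con : ∀ {b R} → Region b R → ∀ {v w} → R v ≡ true → (∀ h → Const con h → h v ≡ h w) → Reached b (add-vertex R w) w
      cross-con {b} {R} reg {v} {w} inn eq with reached reg v inn
      ... | mkReached d i u = mkReached d (λ e de → ∨-introˡ (proj₁ (i e de)) , proj₂ (i e de))
            λ h ch → trans (u h ch) (cong (λ z → h b + - z) (eq h ch))

      record Closed (R : Fin n → Bool) : Set where
        field
          forward : ∀ e → R (src e) ≡ true → R (tgt e) ≡ true
          con-closed : All (λ (a , b) → R a ≡ R b) con

      scan : ∀ {b} R → Region b R → Closed R ⊎ (Σ[ w ∈ Fin n ] R w ≡ false × Region b (add-vertex R w))
      scan {b} R reg with anyF (λ e → R (src e) ∧ not (R (tgt e))) in eq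
      ... | true with anyF-elim (λ e → R (src e) ∧ not (R (tgt e))) eq
      ...   | e , p with ∧-true {R (src e)} p
      ...     | inn , out = inj₂ (tgt e , not-true out , grow reg (cross-edge reg e inn (not-true out)))
      scan {b} R reg | false =
        [ (λ a → inj₁ (record { forward = forward′ ; con-closed = a })) , inj₂ ]′ (search con (λ h → id))
        where
        leaving : Fin m → Bool
        leaving e = R (src e) ∧ not (R (tgt e))
        forward′ : ∀ e → R (src e) ≡ true → R (tgt e) ≡ true
        forward′ e inn with R (tgt e) in out
        ... | true = refl
        ... | false = ⊥-elim (false⇒¬true eq (anyF-intro leaving e (cong₂ _∧_ inn (cong not out))))
        Result = Σ[ w ∈ Fin n ] R w ≡ false × Region b (add-vertex R w)
        search : ∀ L → (∀ h → Const con h → Const L h) → All (λ (a , b) → R a ≡ R b) L ⊎ Result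
        search [] _ = inj₁ []
        search ((v , w) ∷ L) cs with R v in ev | R w in ew
        ... | true | false = inj₂ (w , ew , grow reg (cross-con reg ev (λ h ch → All.head (cs h ch))))
        ... | false | true = inj₂ (v , ev , grow reg (cross-con reg ew (λ h ch → sym (All.head (cs h ch)))))
        ... | true | true = [ (λ a → inj₁ (trans ev (sym ew) ∷ a)) , inj₂ ]′ (search L (λ h → All.tail ∘ cs h))
        ... | false | false = [ (λ a → inj₁ (trans ev (sym ew) ∷ a)) , inj₂ ]′ (search L (λ h → All.tail ∘ cs h))

      saturate : ∀ {b} N R → Region b R → n ℕ.≤ N ℕ.+ countF R → Σ[ R′ ∈ (Fin n → Bool) ] Region b R′ × Closed R′
      saturate N R reg le with scan R reg
      ... | inj₁ cl = R , reg , cl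
      ... | inj₂ (w , out , reg′) = go N le
        where
        larger : countF R ℕ.< countF (add-vertex R w)
        larger = countF-mono-< R (add-vertex R w) (λ i → ∨-introˡ) w out (∨-introʳ {R w} (==-refl w))
        go : ∀ N → n ℕ.≤ N ℕ.+ countF R → _
        go zero le = ⊥-elim (ℕ.<⇒≱ (ℕ.≤-<-trans le larger) (countF≤ (add-vertex R w)))
        go (suc N) le = saturate N _ reg′ (ℕ.≤-trans le
          (ℕ.≤-trans (ℕ.≤-reflexive (sym (ℕ.+-suc N (countF R)))) (ℕ.+-monoʳ-≤ N larger)))

      start : ∀ b → Region b (λ v → v == b)
      start b = mkRegion (==-refl b) λ w h → mkReached (λ _ → false) (λ _ ()) λ k _ →
        trans (trans (pairing-cong ends k (λ e → sgn-0 (s e))) (pairing-zero ends k))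
              (sym (trans (cong (λ v → k b + - k v) (==⇒≡ h)) (ℤ.+-inverseʳ (k b))))

      opaque
        -- `R` consists of the vertices reached from the head of `e`. If the tail of `e` is among
        -- them, the walk to it closes up through `e`. Otherwise all edges between `R` and its
        -- complement lead into `R`, with `e` among them, and the indicator of the complement is a
        -- potential for this directed cut.
        paint-graph : ∀ e → (Σ[ d ∈ (Fin m → Bool) ] Tension con ends (directed s d) × d e ≡ true)
                          ⊎ (Σ[ d ∈ (Fin m → Bool) ] Flow con ends (directed s d) × d e ≡ true)
        paint-graph e with saturate n _ (start (tgt e)) (ℕ.m≤m+n n _)
        ... | R , reg , cl with R (src e) in eq
        ...   | true = inj₂ (insert d e , (λ h ch → trans (pairing-insert d e h de)
                  (trans (cong (λ z → z + (h (src e) + - h (tgt e))) (unit-flow h ch)) (lem (h (tgt e)) (h (src e))))) ,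
                  ∨-introʳ {d e} (==-refl e))
          where
          open Reached (reached reg (src e) eq)
          de : d e ≡ false
          de = ¬true⇒false λ t → proj₂ (inside e t) refl
          lem : ∀ a b → (a + - b) + (b + - a) ≡ 0ℤ
          lem = solve-∀
        ...   | false = inj₁ (d , (h , All.map (cong (ι ∘ not)) con-closed , potential) , cong₂ _∧_ (cong not eq) tgt∈R)
          where
          open Closed cl
          h : Fin n → ℤ
          h v = ι (not (R v))
          d : Fin m → Bool
          d i = not (R (src i)) ∧ R (tgt i)
          tgt∈R : R (tgt e) ≡ true
          tgt∈R = source reg
          potential : ∀ i → directed s d i ≡ coboundary ends h i
          potential i with s i | forward i
          ... | true | fw with R (proj₁ (ends i)) | R (proj₂ (ends i)) | fw
          ...   | true | true | _ = refl
          ...   | true | false | f = true≢false (sym (f refl))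
          ...   | false | true | _ = refl
          ...   | false | false | _ = refl
          potential i | false | fw with R (proj₁ (ends i)) | R (proj₂ (ends i)) | fw
          ...   | true | true | _ = refl
          ...   | true | false | _ = refl
          ...   | false | true | f = true≢false (sym (f refl))
          ...   | false | false | _ = refl

  graph : ∀ {m} → Edges {n} → Ends n m → Lattices m
  graph con ends = record
    { T = Tension con ends ; W = Flow con ends
    ; T-sub = Tension-subgroup con ends ; W-sub = Flow-subgroup con ends
    ; orth = orthogonal con ends ; paint = paint-graph con ends }

unit-orthogonal : ∀ {m} (M : Lattices (suc m)) → Lattices.T M (1ℤ ▸ λ _ → 0ℤ) → ∀ {γ} → Lattices.W M γ → γ zero ≡ 0ℤ
unit-orthogonal {m} M Tu {γ} Wγ = trans (sym (trans (cong₂ _+_ (ℤ.*-identityˡ (γ zero))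
  (trans (sumℤ-cong {m} (λ i → ℤ.*-zeroˡ (γ (suc i)))) (sumℤ-zero m))) (ℤ.+-identityʳ (γ zero)))) (Lattices.orth M Tu Wγ)

a-b≡0⇒a≡b : ∀ {a b} → 0ℤ ≡ a + - b → a ≡ b
a-b≡0⇒a≡b {a} {b} eq = ℤ.i-j≡0⇒i≡j a b (sym eq)

-- Contraction and deletion in a graph

module _ {n m : ℕ} (con : Edges {n}) (ends : Ends n (suc m)) where
  private
    e = ends zero
    u = proj₁ e
    v = proj₂ e
    ends′ = ends ∘ suc
    Γ = graph con ends

  contraction : (∀ {γ} → Flow (e ∷ con) ends′ γ → Σ[ c ∈ ℤ ] Flow con ends (c ▸ γ)) → Contraction Γ (graph (e ∷ con) ends′)
  contraction W-ext = record
    { T-ext = λ { (h , eq ∷ ch , p) → h , ch , λ { zero → sym (trans (cong (λ z → h u + - z) (sym eq)) (ℤ.+-inverseʳ (h u))) ; (suc i) → p i } }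
    ; T-res = λ { (h , ch , p) → h , a-b≡0⇒a≡b (p zero) ∷ ch , p ∘ suc }
    ; W-ext = W-ext
    ; W-res = λ { {γ} {c} Wγ h (eq ∷ ch) → trans (sym (trans (cong (λ z → z * c + pairing ends′ h γ)
        (trans (cong (λ z → h u + - z) (sym eq)) (ℤ.+-inverseʳ (h u))))
            (trans (cong (λ z → z + pairing ends′ h γ) (ℤ.*-zeroˡ c)) (ℤ.+-identityˡ _)))) (Wγ h ch) } }

  contraction-loop : conn con u v ≡ true → Contraction Γ (graph (e ∷ con) ends′)
  contraction-loop loop = contraction λ {γ} Wγ → 0ℤ , λ h ch → trans (cong₂ _+_ (ℤ.*-zeroʳ (coboundary ends h zero))
    (Wγ h (conn-const ch loop ∷ ch))) refl

  -- Orthogonality to the potential `k`, which drops by one along `e`, dictates the value on `e`.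
  -- This value works for every `h`, because subtracting from `h` the multiple of `k` with the same
  -- drop gives a potential that takes equal values at the ends of `e`, and `γ` is orthogonal to it.
  contraction-nonloop : ∀ {φ₀} → Tension con ends φ₀ → φ₀ zero ≡ 1ℤ → Contraction Γ (graph (e ∷ con) ends′)
  contraction-nonloop (k , ck , p) one = contraction λ {γ} Wγ → - pairing ends′ k γ , λ h ch →
    let x = h u + - h v
        h′ = λ w → h w + - x * k w
    in trans (cong (λ z → x * - pairing ends′ k γ + z) (step γ h x))
      (trans (cong (λ z → x * - pairing ends′ k γ + (z + x * pairing ends′ k γ))
          (Wγ h′ (a-b≡0⇒a≡b (sym (trans (lem (h u) (h v) (k u) (k v))
              (trans (cong (λ z → x + - x * z) (trans (sym (p zero)) one)) (lem₂ x))))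
                  ∷ Const-add ch (Const-scale (- x) ck))))
        (lem₃ x (pairing ends′ k γ)))
    where
    lem : ∀ a b c d → (a + - (a + - b) * c) + - (b + - (a + - b) * d) ≡ (a + - b) + - (a + - b) * (c + - d)
    lem = solve-∀
    lem₂ : ∀ x → x + - x * 1ℤ ≡ 0ℤ
    lem₂ = solve-∀
    lem₃ : ∀ x y → x * - y + (0ℤ + x * y) ≡ 0ℤ
    lem₃ = solve-∀
    lem₄ : ∀ a b x → a ≡ a + - x * b + x * b
    lem₄ = solve-∀
    step : ∀ γ h x → pairing ends′ h γ ≡ pairing ends′ (λ w → h w + - x * k w) γ + x * pairing ends′ k γ
    step γ h x = trans (lem₄ (pairing ends′ h γ) (pairing ends′ k γ) x)
      (cong (λ z → z + x * pairing ends′ k γ) (sym (pairing-+ˡ ends′ h k (- x) γ)))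

  -- Flows of the deleted graph are the flows that vanish on `e`, and a tension extends over `e` by
  -- its own potential.
  deletion : Contraction (dualL Γ) (dualL (graph con ends′))
  deletion = record
    { T-ext = λ Wγ h ch → trans (cong₂ _+_ (ℤ.*-zeroʳ (coboundary ends h zero)) (Wγ h ch)) refl
    ; T-res = λ {γ} Wγ h ch → trans (sym (trans (cong (λ z → z + pairing ends′ h γ) (ℤ.*-zeroʳ (coboundary ends h zero)))
                            (ℤ.+-identityˡ _))) (Wγ h ch)
    ; W-ext = λ { (h , ch , p) → coboundary ends h zero , h , ch , λ { zero → refl ; (suc i) → p i } }
    ; W-res = λ { (h , ch , p) → h , ch , p ∘ suc } }

  loop-unit : conn con u v ≡ true → Flow con ends (1ℤ ▸ λ _ → 0ℤ)
  loop-unit loop h ch = cong₂ _+_ (trans (ℤ.*-identityʳ _)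
    (trans (cong (λ z → h u + - z) (sym (conn-const ch loop))) (ℤ.+-inverseʳ (h u)))) (pairing-zero ends′ h)

  component-jump : ∀ L → conn L u v ≡ false → coboundary ends (component L u) zero ≡ 1ℤ
  component-jump L h = cong₂ (λ a b → ι a + - ι b) (conn-refl L u) h

  nonloop-tension : conn con u v ≡ false → Σ[ φ ∈ V (suc m) ] Tension con ends φ × φ zero ≡ 1ℤ
  nonloop-tension h = coboundary ends (component con u) ,
      (component con u , component-const con u , λ _ → refl) , component-jump con h

  private
    rest = addE ends′ (full m) con

  rest-edge : ∀ i → ends′ i ∈ rest
  rest-edge i = ∈-addE ends′ (full m) con i (lookup-replicate i true)

  bridge-unit : conn rest u v ≡ false → Tension con ends (1ℤ ▸ λ _ → 0ℤ)
  bridge-unit h = component rest u , Const-⊆ (addE-⊆ ends′ (full m) con) const ,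
    λ { zero → sym (component-jump rest h)
      ; (suc i) → sym (trans (cong (λ z → component rest u (proj₁ (ends′ i)) + - z) (sym (All.lookup const (rest-edge i))))
                   (ℤ.+-inverseʳ (component rest u (proj₁ (ends′ i))))) }
    where const = component-const rest u

  -- A walk that avoids `e` carries a unit from `u` to `w`: an edge contributes a signed pulse, and
  -- a contracted edge costs nothing.
  walk-flow : ∀ {w} → conn rest u w ≡ true → Σ[ γ ∈ V m ] (∀ h → Const con h → pairing ends′ h γ ≡ h u + - h w)
  walk-flow r = conn-ind {L = rest} P (All-addE ends′ (full m) (λ i _ → along i) (All.tabulate contracted)) r
      ((λ _ → 0ℤ) , λ h _ → trans (pairing-zero ends′ h) (sym (ℤ.+-inverseʳ (h u))))
    where
    P : Fin n → Set
    P w = Σ[ γ ∈ V m ] (∀ h → Const con h → pairing ends′ h γ ≡ h u + - h w)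
    lem₁ : ∀ a b c → (a + - b) + (b + - c) ≡ a + - c
    lem₁ = solve-∀
    lem₂ : ∀ a b c → (a + - b) + - (c + - b) ≡ a + - c
    lem₂ = solve-∀
    along : ∀ i → Joins P (ends′ i)
    along i = (λ { (γ , q) → (λ e → γ e + pulse i e) , λ h ch → trans (pairing-+ ends′ h γ (pulse i))
                  (trans (cong₂ _+_ (q h ch) (pairing-pulse ends′ h i))
                      (lem₁ (h u) (h (proj₁ (ends′ i))) (h (proj₂ (ends′ i))))) })
            , (λ { (γ , q) → (λ e → γ e + - pulse i e) , λ h ch → trans (pairing-+ ends′ h γ (λ e → - pulse i e))
                  (trans (cong₂ _+_ (q h ch) (trans (pairing-neg ends′ h (pulse i)) (cong -_ (pairing-pulse ends′ h i))))
                  (lem₂ (h u) (h (proj₂ (ends′ i))) (h (proj₁ (ends′ i))))) })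
    contracted : ∀ {p} → p ∈ con → Joins P p
    contracted i = (λ { (γ , q) → γ , λ h ch → trans (q h ch) (cong (λ z → h u + - z) (All.lookup ch i)) })
                 , (λ { (γ , q) → γ , λ h ch → trans (q h ch) (cong (λ z → h u + - z) (sym (All.lookup ch i))) })

  nonbridge-flow : conn rest u v ≡ true → Σ[ γ ∈ V (suc m) ] Flow con ends γ × γ zero ≡ 1ℤ
  nonbridge-flow r with walk-flow r
  ... | γ , q = (1ℤ ▸ λ i → - γ i) , (λ h ch → trans (cong (λ z → coboundary ends h zero * 1ℤ + z)
        (trans (pairing-neg ends′ h γ) (cong -_ (q h ch)))) (lem (h u + - h v))) , refl
    where
    lem : ∀ a → a * 1ℤ + - a ≡ 0ℤ
    lem = solve-∀

recount : ∀ {m p q} {T W : V m → Set} {P : State p q T W → Set} {k l} → k ≡ l → Enumeration P k → Enumeration P l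
recount refl E = E

Enumerated : ∀ {n} (p q : ℕ) {m} → Edges {n} → Ends n m → Set
Enumerated p q con ends = Enumeration {p = p} {q} {Tension con ends} {Flow con ends} (λ _ → ⊤) (relR p q con ends)

module _ {n m : ℕ} (p q : ℕ) (con : Edges {n}) (ends : Ends n (suc m)) where
  private
    e = ends zero
    ends′ = ends ∘ suc
    Γ = graph con ends

  private
    Rc = relR p q (e ∷ con) ends′
    Rd = relR p q con ends′
    Γ/e = graph (e ∷ con) ends′
    Γ∖e = graph con ends′

  enumerate-edge : Enumerated p q (e ∷ con) ends′ → Enumerated p q con ends′ →
    ∀ b b′ → conn con (proj₁ e) (proj₂ e) ≡ b → conn (addE ends′ (full m) con) (proj₁ e) (proj₂ e) ≡ b′ →
    Enumerated p q con ends
  enumerate-edge E _ true _ loop _ = recount {k = suc q ℕ.* Rc} (sym (relR-loop p q con ends loop))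
    (enumerate-loop {M = Γ} {Γ/e} (contraction-loop con ends loop)
      (λ {φ} → unit-orthogonal (dualL Γ) (loop-unit con ends loop) {φ}) (loop-unit con ends loop) {Rc} E)
  enumerate-edge _ D false false _ bridge = recount {k = suc p ℕ.* Rd} (sym (relR-bridge p q con ends bridge))
    (enumerate-dual (dualL Γ) {q} {p} {suc p ℕ.* Rd} (enumerate-loop {M = dualL Γ} {dualL Γ∖e} (deletion con ends)
      (λ {γ} → unit-orthogonal Γ (bridge-unit con ends bridge) {γ}) (bridge-unit con ends bridge) {Rd}
      (enumerate-dual Γ∖e {p} {q} {Rd} D)))
  enumerate-edge E D false true nonloop nonbridge =
    -- A tension with value 1 on `e` serves as `φ₀` for the contraction, and a flow with value 1 on
    -- `e` serves as `φ₀` for the deletion.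
    let (φ , Tφ , φ1) = nonloop-tension con ends nonloop
        (γ , Wγ , γ1) = nonbridge-flow con ends nonbridge
    in recount {k = Rc ℕ.+ Rd} (sym (relR-ordinary p q con ends nonloop nonbridge))
    (enumerate-ordinary Γ {p} {q} {Rc} {Rd}
      (enumerate-Good {M = Γ} {Γ/e} (contraction-nonloop con ends Tφ φ1) {φ₀ = φ} Tφ φ1 {Rc} E)
      (enumerate-Good {M = dualL Γ} {dualL Γ∖e} (deletion con ends) {φ₀ = γ} Wγ γ1 {Rd} (enumerate-dual Γ∖e {p} {q} {Rd} D)))

enumerate-graph : ∀ {n} p q m con (ends : Ends n m) → Enumerated p q con ends
enumerate-graph p q zero con ends = recount (sym one) (enumerate-empty (graph con ends))
  where
  one : relR p q con ends ≡ 1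
  one rewrite ℕ.n∸n≡0 (c con) = refl
enumerate-graph p q (suc m) con ends = enumerate-edge p q con ends
  (enumerate-graph p q m (ends zero ∷ con) (ends ∘ suc)) (enumerate-graph p q m con (ends ∘ suc)) _ _ refl refl

-- Cut-Eulerian equivalence and translations

sumℤ-swap : ∀ {k l} (f : Fin k → Fin l → ℤ) →
  sumℤ (λ i → sumℤ (λ j → f i j)) ≡ sumℤ (λ j → sumℤ (λ i → f i j))
sumℤ-swap {zero} {l} f = sym (sumℤ-zero l)
sumℤ-swap {suc k} {l} f = trans (cong (λ z → sumℤ (f zero) + z) (sumℤ-swap (λ i → f (suc i))))
  (sym (sumℤ-+ {l} (f zero) (λ j → sumℤ (λ i → f (suc i) j))))

if-ι : ∀ b g → (if b then g else 0ℤ) ≡ ι b * g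
if-ι true g = sym (ℤ.*-identityˡ g)
if-ι false g = sym (ℤ.*-zeroˡ g)

==-sym : ∀ {k} (u v : Fin k) → (u == v) ≡ (v == u)
==-sym u v = ⇔⇒≡ (λ h → trans (cong (v ==_) (==⇒≡ h)) (==-refl v)) (λ h → trans (cong (u ==_) (==⇒≡ h)) (==-refl u))

through : ∀ {n m} → (Fin m → Fin n) → V m → Fin n → ℤ
through x g v = sumℤ (λ e → if x e == v then g e else 0ℤ)

-- An exchange of summation. It passes from conservation at each vertex to orthogonality to
-- coboundaries.
sumℤ-through : ∀ {n m} (x : Fin m → Fin n) (g : V m) (h : V n) → sumℤ (λ v → h v * through x g v) ≡ sumℤ (λ e → h (x e) * g e)
sumℤ-through {n} {m} x g h = begin
  sumℤ (λ v → h v * through x g v)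
    ≡⟨ sumℤ-cong {n} (λ v → sym (sumℤ-* {m} (h v) (λ e → if x e == v then g e else 0ℤ))) ⟩
  sumℤ (λ v → sumℤ (λ e → h v * (if x e == v then g e else 0ℤ)))
    ≡⟨ sumℤ-swap {n} {m} (λ v e → h v * (if x e == v then g e else 0ℤ)) ⟩
  sumℤ (λ e → sumℤ (λ v → h v * (if x e == v then g e else 0ℤ)))
    ≡⟨ sumℤ-cong {m} (λ e → trans (sumℤ-cong {n} (pointwise e)) (sumℤ-pulse (λ v → h v * g e) (x e))) ⟩
  sumℤ (λ e → h (x e) * g e) ∎
  where
  open ≡-Reasoning
  lem : ∀ a b c → a * (b * c) ≡ (a * c) * b
  lem = solve-∀
  pointwise : ∀ e v → h v * (if x e == v then g e else 0ℤ) ≡ (h v * g e) * pulse (x e) v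
  pointwise e v = trans (cong (λ z → h v * z) (trans (if-ι (x e == v) (g e)) (cong (λ b → ι b * g e) (==-sym (x e) v))))
    (lem (h v) (ι (v == x e)) (g e))

-- Exhaustive search over vertex sets, by which the minimality of a directed cut is decided.
searchVec : ∀ k (P : Vec Bool k → Bool) → (Σ[ X ∈ Vec Bool k ] P X ≡ true) ⊎ (∀ X → P X ≡ false)
searchVec zero P with P [] in eq
... | true = inj₁ ([] , eq)
... | false = inj₂ λ { [] → eq }
searchVec (suc k) P with searchVec k (P ∘ (true ∷_)) | searchVec k (P ∘ (false ∷_))
... | inj₁ (X , h) | _ = inj₁ (true ∷ X , h)
... | inj₂ _ | inj₁ (X , h) = inj₁ (false ∷ X , h)
... | inj₂ p | inj₂ q = inj₂ λ { (true ∷ X) → p X ; (false ∷ X) → q X }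

module Oriented {n m : ℕ} (ends : Ends n m) (ρ : Orientation m) where

  sg : Fin m → Bool
  sg = lookup ρ

  tl hd : Fin m → Fin n
  tl = tail ends ρ
  hd = head ends ρ

  drop : (Fin n → ℤ) → V m
  drop h e = h (tl e) + - h (hd e)

  coboundary≡ : ∀ h e → coboundary ends h e ≡ sgn (sg e) (drop h e)
  coboundary≡ h e with lookup ρ e
  ... | true = refl
  ... | false = lem (h (proj₁ (ends e))) (h (proj₂ (ends e)))
    where
    lem : ∀ a b → a + - b ≡ - (b + - a)
    lem = solve-∀

  IsDrop : V m → Set
  IsDrop v = Σ[ h ∈ (Fin n → ℤ) ] (∀ e → v e ≡ drop h e)

  drop⇒tension : ∀ {v} → IsDrop v → Tension [] ends (λ e → sgn (sg e) (v e))
  drop⇒tension (h , p) = h , [] , λ e → trans (cong (sgn (sg e)) (p e)) (sym (coboundary≡ h e))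

  tension⇒drop : ∀ {v} → Tension [] ends (λ e → sgn (sg e) (v e)) → IsDrop v
  tension⇒drop (h , _ , p) = h , λ e → sgn-injective (sg e) (trans (p e) (coboundary≡ h e))

  pairing-signed : ∀ h (g : V m) → pairing ends h (λ e → sgn (sg e) (g e)) ≡ sumℤ (λ e → drop h e * g e)
  pairing-signed h g = sumℤ-cong {m} (λ e → trans (cong (λ z → z * sgn (sg e) (g e)) (coboundary≡ h e))
      (lem (sg e) (drop h e) (g e)))
    where
    lem : ∀ b x y → sgn b x * sgn b y ≡ x * y
    lem true x y = refl
    lem false x y = solve′ x y
      where solve′ : ∀ x y → (- x) * (- y) ≡ x * y
            solve′ = solve-∀

  sum-drop : ∀ h (g : V m) → sumℤ (λ e → drop h e * g e) ≡ sumℤ (λ e → h (tl e) * g e) + - sumℤ (λ e → h (hd e) * g e)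
  sum-drop h g = trans (sumℤ-cong {m} (λ e → lem (h (tl e)) (h (hd e)) (g e)))
    (trans (sumℤ-+ {m} (λ e → h (tl e) * g e) (λ e → ℤ.-1ℤ * (h (hd e) * g e)))
      (cong (λ z → sumℤ (λ e → h (tl e) * g e) + z) (trans (sumℤ-* {m} ℤ.-1ℤ (λ e → h (hd e) * g e)) (ℤ.-1*i≡-i _))))
    where
    lem : ∀ a b c → (a + - b) * c ≡ a * c + ℤ.-1ℤ * (b * c)
    lem = solve-∀

  isFlow⇒flow : (g : V m) → IsFlow ends ρ g → Flow [] ends (λ e → sgn (sg e) (g e))
  isFlow⇒flow g fl h _ = begin
    pairing ends h (λ e → sgn (sg e) (g e))   ≡⟨ pairing-signed h g ⟩
    sumℤ (λ e → drop h e * g e)              ≡⟨ sum-drop h g ⟩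
    outflow + - inflow                       ≡⟨ cong (λ z → z + - inflow) balance ⟩
    inflow + - inflow                        ≡⟨ ℤ.+-inverseʳ inflow ⟩
    0ℤ ∎
    where
    open ≡-Reasoning
    outflow inflow : ℤ
    outflow = sumℤ (λ e → h (tl e) * g e)
    inflow = sumℤ (λ e → h (hd e) * g e)
    weighted : (Fin m → Fin n) → ℤ
    weighted x = sumℤ (λ v → h v * through x g v)
    out-weighted : weighted tl ≡ outflow
    out-weighted = sumℤ-through {n} {m} tl g h
    in-weighted : weighted hd ≡ inflow
    in-weighted = sumℤ-through {n} {m} hd g h
    balance : outflow ≡ inflow
    balance = trans (sym out-weighted)
      (trans (sumℤ-cong {n} (λ v → cong (λ z → h v * z) (sym (fl v)))) in-weighted)

  flow⇒isFlow : (g : V m) → Flow [] ends (λ e → sgn (sg e) (g e)) → IsFlow ends ρ g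
  flow⇒isFlow g fl v = sym (ℤ.i-j≡0⇒i≡j (through tl g v) (through hd g v) (begin
    through tl g v + - through hd g v            ≡⟨ cong₂ (λ a b → a + - b) (at tl) (at hd) ⟩
    sumℤ (λ e → h (tl e) * g e) + - sumℤ (λ e → h (hd e) * g e)   ≡⟨ sum-drop h g ⟨
    sumℤ (λ e → drop h e * g e)                  ≡⟨ pairing-signed h g ⟨
    pairing ends h (λ e → sgn (sg e) (g e))       ≡⟨ fl h [] ⟩
    0ℤ ∎))
    where
    open ≡-Reasoning
    h : Fin n → ℤ
    h w = ι (w == v)
    at : ∀ x → through x g v ≡ sumℤ (λ e → h (x e) * g e)
    at x = sumℤ-cong {m} (λ e → if-ι (x e == v) (g e))

  countF-through : (D : Fin m → Bool) (x : Fin m → Fin n) → ∀ v → + countF (λ e → D e ∧ x e == v) ≡ through x (ι ∘ D) v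
  countF-through D x v = go D (λ e → x e == v)
    where
    go : ∀ {k} (D b : Fin k → Bool) → + countF (λ e → D e ∧ b e) ≡ sumℤ (λ e → if b e then ι (D e) else 0ℤ)
    go {zero} D b = refl
    go {suc k} D b = trans (ℤ.pos-+ (bit (D zero ∧ b zero)) (countF (λ e → D (suc e) ∧ b (suc e))))
      (cong₂ _+_ (one (D zero) (b zero)) (go (D ∘ suc) (b ∘ suc)))
      where
      one : ∀ d b → + bit (d ∧ b) ≡ (if b then ι d else 0ℤ)
      one true true = refl
      one true false = refl
      one false true = refl
      one false false = refl

  eulerian⇒flow : ∀ {D} → IsDirectedEulerian ends ρ D → Flow [] ends (directed sg D)
  eulerian⇒flow {D} eu = isFlow⇒flow (ι ∘ D) λ v → trans (sym (countF-through D hd v))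
      (trans (cong +_ (eu v)) (countF-through D tl v))

  flow⇒eulerian : ∀ {D} → Flow [] ends (directed sg D) → IsDirectedEulerian ends ρ D
  flow⇒eulerian {D} fl v = ℤ.+-injective (trans (countF-through D hd v)
      (trans (flow⇒isFlow (ι ∘ D) fl v) (sym (countF-through D tl v))))

  cutOf≡ : ∀ S e → cutOf ends S e ≡ S (tl e) xor S (hd e)
  cutOf≡ S e with lookup ρ e
  ... | true = refl
  ... | false = xor-comm (S (proj₁ (ends e))) (S (proj₂ (ends e)))

  Outward : VertexSet ends → Set
  Outward S = ∀ e → S (hd e) ≡ true → S (tl e) ≡ true

  outward-drop : ∀ S → Outward S → ∀ e → ι (cutOf ends S e) ≡ drop (ι ∘ S) e
  outward-drop S out e rewrite cutOf≡ S e with S (tl e) | S (hd e) | out e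
  ... | true | true | _ = refl
  ... | true | false | _ = refl
  ... | false | true | f = true≢false (sym (f refl))
  ... | false | false | _ = refl

  outward-tail : ∀ S → Outward S → ∀ e → cutOf ends S e ≡ true → S (tl e) ≡ true × S (hd e) ≡ false
  outward-tail S out e h with S (tl e) | S (hd e) | out e | trans (sym (cutOf≡ S e)) h
  ... | true | false | _ | _ = refl , refl
  ... | false | true | f | _ = true≢false (sym (f refl))

  same-side : ∀ {S T : VertexSet ends} → _⊆E_ ends (cutOf ends T) (cutOf ends S) → ∀ e → S (tl e) ≡ S (hd e) → T (tl e) ≡ T (hd e)
  same-side {S} {T} sub e eq = xor-false (trans (sym (cutOf≡ T e)) (¬true⇒false λ h →
    false⇒¬true (trans (cutOf≡ S e) (trans (cong (_xor S (hd e)) eq) (xor-same (S (hd e))))) (sub e h)))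
    where
    xor-false : ∀ {a b} → a xor b ≡ false → a ≡ b
    xor-false {true} {true} _ = refl
    xor-false {false} {false} _ = refl

  cut-ends : ∀ {S} → ∀ e → cutOf ends S e ≡ false → S (tl e) ≡ S (hd e)
  cut-ends {S} e h with S (tl e) | S (hd e) | trans (sym (cutOf≡ S e)) h
  ... | true | true | _ = refl
  ... | false | false | _ = refl

  module Search (S : VertexSet ends) where

    enters proper outside : VertexSet ends → Fin m → Bool
    enters T e = T (hd e) ∧ not (T (tl e))
    outside T e = cutOf ends T e ∧ not (cutOf ends S e)
    proper T e = cutOf ends S e ∧ not (cutOf ends T e)

    -- Only cuts directed out of their vertex set compete, since a smaller cut has to remain
    -- directed for the descent to continue. `Minimal` shows that minimality among these already
    -- gives a bond.
    smallerCut : VertexSet ends → Bool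
    smallerCut T = not (anyF (enters T)) ∧ (anyF (cutOf ends T) ∧ (not (anyF (outside T)) ∧ anyF (proper T)))

    smallerCut-elim : ∀ T → smallerCut T ≡ true → Outward T × NonEmpty ends (cutOf ends T)
      × _⊆E_ ends (cutOf ends T) (cutOf ends S) × Σ[ e ∈ Fin m ] cutOf ends S e ≡ true × cutOf ends T e ≡ false
    smallerCut-elim T h with ∧-true {not (anyF (enters T))} h
    ... | h₁ , h′ with ∧-true {anyF (cutOf ends T)} h′
    ... | h₂ , h″ with ∧-true {not (anyF (outside T))} h″
    ... | h₃ , h₄ with anyF-elim (proper T) h₄
    ... | e , he = excluded (T ∘ hd) (T ∘ tl) h₁ , anyF-elim (cutOf ends T) h₂ , excluded (cutOf ends T) (cutOf ends S) h₃
                 , e , proj₁ (∧-true {cutOf ends S e} he) , not-true (proj₂ (∧-true {cutOf ends S e} he))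
      where
      excluded : (a b : Fin m → Bool) → not (anyF (λ e → a e ∧ not (b e))) ≡ true → ∀ i → a i ≡ true → b i ≡ true
      excluded a b h i ai with b i in eq
      ... | true = refl
      ... | false = ⊥-elim (false⇒¬true (not-true h) (anyF-intro (λ e → a e ∧ not (b e)) i (cong₂ _∧_ ai (cong not eq))))

    smallerCut-intro : ∀ T → Outward T → NonEmpty ends (cutOf ends T) →
      _⊆E_ ends (cutOf ends T) (cutOf ends S) → ∀ e → cutOf ends S e ≡ true → cutOf ends T e ≡ false → smallerCut T ≡ true
    smallerCut-intro T out (e₀ , h₀) sub e hS hT = cong₂ _∧_ (none (enters T) λ i h →
        let (p , q) = ∧-true {T (hd i)} h in false⇒¬true (not-true q) (out i p))
      (cong₂ _∧_ (anyF-intro (cutOf ends T) e₀ h₀)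
      (cong₂ _∧_ (none (outside T) λ i h → let (p , q) = ∧-true {cutOf ends T i} h in false⇒¬true (not-true q) (sub i p))
                 (anyF-intro (proper T) e (cong₂ _∧_ hS (cong not hT)))))
      where
      none : (f : Fin m → Bool) → (∀ i → f i ≡ true → ⊥) → not (anyF f) ≡ true
      none f h = cong not (¬true⇒false λ p → let (i , q) = anyF-elim f p in h i q)

  -- Any cut inside ∂S splits the tails and the heads of ∂S: all-or-none, applied to S ∩ T and S ∪ T,
  -- shows that both splittings are trivial, hence ∂T is empty or ∂S.
  module Minimal (S : VertexSet ends) (out : Outward S) (ne : NonEmpty ends (cutOf ends S))
    (minimal : ∀ X → Search.smallerCut S (lookup X) ≡ false) where
    private B = cutOf ends S

    all-or-none : ∀ T → Outward T → _⊆E_ ends (cutOf ends T) B → (∀ e → cutOf ends T e ≡ false) ⊎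
        (∀ e → B e ≡ true → cutOf ends T e ≡ true)
    all-or-none T outT sub with anyF (cutOf ends T) in eq
    ... | false = inj₁ λ e → ¬true⇒false λ h → false⇒¬true eq (anyF-intro (cutOf ends T) e h)
    ... | true with anyF-elim (cutOf ends T) eq
    ...   | e₀ , h₀ = inj₂ λ e Be → ¬false⇒true λ hT → false⇒¬true (minimal X)
            (Search.smallerCut-intro S T′ (λ i h → trans (T′≡ (tl i)) (outT i (trans (sym (T′≡ (hd i))) h)))
              (e₀ , trans (cut≡ e₀) h₀) (λ i h → sub i (trans (sym (cut≡ i)) h)) e Be (trans (cut≡ e) hT))
      where
      -- Minimality is known for vertex sets given by vectors, so `T` is replaced by a pointwise
      -- equal set of that form.
      X = tabulate T
      T′ = lookup X
      T′≡ : ∀ v → T′ v ≡ T v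
      T′≡ = lookup∘tabulate T
      cut≡ : ∀ e → cutOf ends T′ e ≡ cutOf ends T e
      cut≡ e = cong₂ _xor_ (T′≡ (proj₁ (ends e))) (T′≡ (proj₂ (ends e)))

    module _ (T : VertexSet ends) (sub : _⊆E_ ends (cutOf ends T) B) where
      cap cup : VertexSet ends
      cap v = S v ∧ T v
      cup v = S v ∨ T v

      same : ∀ e → S (tl e) ≡ S (hd e) → T (tl e) ≡ T (hd e)
      same = same-side {S} {T} sub

      same⇒⊆ : ∀ U → (∀ e → S (tl e) ≡ S (hd e) → U (tl e) ≡ U (hd e)) → _⊆E_ ends (cutOf ends U) B
      same⇒⊆ U h e cu with B e in eq
      ... | true = refl
      ... | false = ⊥-elim (false⇒¬true (trans (cutOf≡ U e)
          (trans (cong (_xor U (hd e)) (h e (cut-ends {S} e eq))) (xor-same (U (hd e))))) cu)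

      cap-outward : Outward cap
      cap-outward e h with ∧-true {S (hd e)} h
      ... | hS , hT = cong₂ _∧_ (out e hS) (trans (same e (trans (out e hS) (sym hS))) hT)

      cup-outward : Outward cup
      cup-outward e h with S (tl e) in eq
      ... | true = refl
      ... | false with S (hd e) in eq′
      ...   | true = ⊥-elim (false⇒¬true eq (out e eq′))
      ...   | false = trans (same e (trans eq (sym eq′))) h

      cap-cut : ∀ e → B e ≡ true → cutOf ends cap e ≡ T (tl e)
      cap-cut e Be = let (inS , outS) = outward-tail S out e Be in
        trans (cutOf≡ cap e) (trans (cong₂ (λ a b → (a ∧ T (tl e)) xor (b ∧ T (hd e))) inS outS) (xor-identityʳ (T (tl e))))

      cup-cut : ∀ e → B e ≡ true → cutOf ends cup e ≡ not (T (hd e))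
      cup-cut e Be = let (inS , outS) = outward-tail S out e Be in
        trans (cutOf≡ cup e) (cong₂ (λ a b → (a ∨ T (tl e)) xor (b ∨ T (hd e))) inS outS)

      tails : (∀ e → B e ≡ true → T (tl e) ≡ false) ⊎ (∀ e → B e ≡ true → T (tl e) ≡ true)
      tails with all-or-none cap cap-outward (same⇒⊆ cap (λ e eq → cong₂ _∧_ eq (same e eq)))
      ... | inj₁ none = inj₁ λ e Be → trans (sym (cap-cut e Be)) (none e)
      ... | inj₂ all = inj₂ λ e Be → trans (sym (cap-cut e Be)) (all e Be)

      heads : (∀ e → B e ≡ true → T (hd e) ≡ true) ⊎ (∀ e → B e ≡ true → T (hd e) ≡ false)
      heads with all-or-none cup cup-outward (same⇒⊆ cup (λ e eq → cong₂ _∨_ eq (same e eq)))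
      ... | inj₁ none = inj₁ λ e Be → not-injective (trans (sym (cup-cut e Be)) (none e))
      ... | inj₂ all = inj₂ λ e Be → not-injective (trans (sym (cup-cut e Be)) (all e Be))

      cut-full : NonEmpty ends (cutOf ends T) → ∀ e → B e ≡ true → cutOf ends T e ≡ true
      cut-full (e₀ , h₀) e Be = trans (cutOf≡ T e) (trans (cong₂ _xor_ (proj₁ const) (proj₂ const))
          (trans (sym (cutOf≡ T e₀)) h₀))
        where
        Be₀ : B e₀ ≡ true
        Be₀ = sub e₀ h₀
        const : T (tl e) ≡ T (tl e₀) × T (hd e) ≡ T (hd e₀)
        const = [ (λ f → trans (f e Be) (sym (f e₀ Be₀))) , (λ f → trans (f e Be) (sym (f e₀ Be₀))) ]′ tails
              , [ (λ f → trans (f e Be) (sym (f e₀ Be₀))) , (λ f → trans (f e Be) (sym (f e₀ Be₀))) ]′ heads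

    bond : IsBond ends B
    bond = (S , λ _ → refl) , ne , λ B′ (T , B′≡) (e₀ , h₀) sub e →
      ⇔⇒≡ (sub e) (λ Be → trans (B′≡ e) (cut-full T (λ i h → sub i (trans (B′≡ i) h)) (e₀ , trans (sym (B′≡ e₀)) h₀) e Be))

  find-bond : ∀ N S → countF (cutOf ends S) ℕ.≤ N → Outward S → NonEmpty ends (cutOf ends S) →
    Σ[ T ∈ VertexSet ends ] Outward T × IsBond ends (cutOf ends T) × _⊆E_ ends (cutOf ends T) (cutOf ends S)
  find-bond N S le out ne with searchVec n (λ X → Search.smallerCut S (lookup X))
  ... | inj₂ minimal = S , out , Minimal.bond S out ne minimal , λ _ → id
  ... | inj₁ (X , h) with Search.smallerCut-elim S (lookup X) h
  ...   | outX , neX , sub , e , eS , eX = go N le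
    where
    lt : countF (cutOf ends (lookup X)) ℕ.< countF (cutOf ends S)
    lt = countF-mono-< (cutOf ends (lookup X)) (cutOf ends S) sub e eX eS
    go : ∀ N → countF (cutOf ends S) ℕ.≤ N → _
    go zero le = ⊥-elim (ℕ.n≮0 (ℕ.<-≤-trans lt le))
    go (suc N) le with find-bond N (lookup X) (ℕ.≤-pred (ℕ.<-≤-trans lt le)) outX neX
    ... | T , outT , b , sub′ = T , outT , b , λ i → sub i ∘ sub′ i

  -- A superlevel set of the potential h at the tail of e₀.
  above : ∀ h e₀ → (C : Fin m → Bool) → (∀ e → ι (C e) ≡ drop h e) → C e₀ ≡ true →
    Σ[ S ∈ VertexSet ends ] Outward S × NonEmpty ends (cutOf ends S) × _⊆E_ ends (cutOf ends S) C
  above h e₀ C p Ce₀ = S , outS , (e₀ , trans (cutOf≡ S e₀) (cong₂ _xor_ (S-true ℤ.≤-refl) hd₀)) , sub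
    where
    level = h (tl e₀)
    S : VertexSet ends
    S v = does (level ℤ.≤? h v)
    S-true : ∀ {v} → level ℤ.≤ h v → S v ≡ true
    S-true {v} le = dec-true (level ℤ.≤? h v) le
    S-elim : ∀ {v} → S v ≡ true → level ℤ.≤ h v
    S-elim {v} eq with level ℤ.≤? h v
    ... | yes le = le
    tl≡ : ∀ e → h (tl e) ≡ h (hd e) + ι (C e)
    tl≡ e = trans (lem (h (tl e)) (h (hd e))) (cong (λ z → h (hd e) + z) (sym (p e)))
      where
      lem : ∀ a b → a ≡ b + (a + - b)
      lem = solve-∀
    outS : Outward S
    outS e eq = S-true (ℤ.≤-trans (S-elim eq) (subst (h (hd e) ℤ.≤_) (sym (tl≡ e)) (up (C e))))
      where
      up : ∀ b {x} → x ℤ.≤ x + ι b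
      up true {x} = ℤ.i≤i+j x 1ℤ
      up false {x} = ℤ.i≤i+j x 0ℤ
    hd₀ : S (hd e₀) ≡ false
    hd₀ = dec-false (level ℤ.≤? h (hd e₀)) λ le →
      ℤ.<⇒≱ (subst (h (hd e₀) ℤ.<_) (sym (trans (tl≡ e₀) (trans (cong (λ b → h (hd e₀) + ι b) Ce₀) (ℤ.+-comm (h (hd e₀)) 1ℤ))))
        (ℤ.suc[i]≤j⇒i<j ℤ.≤-refl)) le
    sub : _⊆E_ ends (cutOf ends S) C
    sub e ce with C e in eq
    ... | true = refl
    ... | false = ⊥-elim (false⇒¬true (trans (cutOf≡ S e)
        (trans (cong (λ z → does (level ℤ.≤? z) xor S (hd e)) hh) (xor-same (S (hd e))))) ce)
      where
      hh : h (tl e) ≡ h (hd e)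
      hh = trans (tl≡ e) (trans (cong (λ b → h (hd e) + ι b) eq) (ℤ.+-identityʳ _))

  -- Bonds are peeled off one at a time. A superlevel set of the potential gives a directed cut
  -- inside `C`, which contains a directed bond; subtracting the indicator potential of that bond
  -- leaves a tension with values in {0,1} on fewer edges.
  drop⇒cut : ∀ N C → countF C ℕ.≤ N → IsDrop (ι ∘ C) → IsLocallyDirectedCut ends ρ C
  drop⇒cut N C le (h , p) with anyF C in eq
  ... | false = ((λ _ → false) , λ e → empty e) , [] , [] , [] , (λ e Ce → ⊥-elim (false⇒¬true (empty e) Ce)) , λ e ()
    where
    empty : ∀ e → C e ≡ false
    empty e = ¬true⇒false λ t → false⇒¬true eq (anyF-intro C e t)
  ... | true with anyF-elim C eq
  ...   | e₀ , Ce₀ with above h e₀ C p Ce₀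
  ...   | S₀ , out₀ , ne₀ , sub₀ with find-bond _ S₀ ℕ.≤-refl out₀ ne₀
  ...   | S , out , bond , sub₁ = go N le
    where
    B = cutOf ends S
    sub : _⊆E_ ends B C
    sub e = sub₀ e ∘ sub₁ e
    C′ : EdgeSet ends
    C′ e = C e ∧ not (B e)
    ne : NonEmpty ends B
    ne = proj₁ (proj₂ bond)
    lt : countF C′ ℕ.< countF C
    lt = countF-mono-< C′ C (λ e → proj₁ ∘ ∧-true {C e}) (proj₁ ne)
      (trans (cong (λ b → C (proj₁ ne) ∧ not b) (proj₂ ne)) (∧-zeroʳ (C (proj₁ ne)))) (sub (proj₁ ne) (proj₂ ne))
    drop′ : IsDrop (ι ∘ C′)
    drop′ = (λ v → h v + - ι (S v)) , λ e → trans (ι-diff (C e) (B e) (sub e))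
      (trans (cong₂ (λ a b → a + - b) (p e) (outward-drop S out e))
        (lem (h (tl e)) (h (hd e)) (ι (S (tl e))) (ι (S (hd e)))))
      where
      ι-diff : ∀ c b → (b ≡ true → c ≡ true) → ι (c ∧ not b) ≡ ι c + - ι b
      ι-diff true true _ = refl
      ι-diff true false _ = refl
      ι-diff false true f = true≢false (sym (f refl))
      ι-diff false false _ = refl
      lem : ∀ a b c d → (a + - b) + - (c + - d) ≡ (a + - c) + - (b + - d)
      lem = solve-∀
    go : ∀ N → countF C ℕ.≤ N → IsLocallyDirectedCut ends ρ C
    go zero le = ⊥-elim (ℕ.n≮0 (ℕ.<-≤-trans lt le))
    go (suc N) le with drop⇒cut N C′ (ℕ.≤-pred (ℕ.<-≤-trans lt le)) drop′
    ... | (S′ , C′≡) , Bs , dir , dis , cov , inn =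
      -- As a disjoint union, `C` is the symmetric difference of the cuts `B` and `C′`, and a
      -- symmetric difference of cuts is the cut of the symmetric difference of their vertex sets.
      ((λ v → S v xor S′ v) , λ e → trans (C≡ (C e) (B e) (sub e)) (trans (cong (B e xor_) (C′≡ e))
        (xor-interchange (S (proj₁ (ends e))) (S (proj₂ (ends e))) (S′ (proj₁ (ends e))) (S′ (proj₂ (ends e)))))) ,
      B ∷ Bs , (bond , S , (λ _ → refl) , inj₁ (λ e Be → proj₁ (outward-tail S out e Be))) ∷ dir ,
      All.tabulate (λ {B₂} i e Be B₂e → false⇒¬true (B⇒¬C′ (B e) Be) (inn e (lose i B₂e))) ∷ dis ,
      (λ e Ce → covered e (B e) refl Ce) ,
      λ { e (here Be) → sub e Be ; e (there a) → proj₁ (∧-true {C e} (inn e a)) }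
      where
      C≡ : ∀ c b → (b ≡ true → c ≡ true) → c ≡ b xor (c ∧ not b)
      C≡ true true _ = refl
      C≡ true false _ = refl
      C≡ false true f = true≢false (sym (f refl))
      C≡ false false _ = refl
      xor-interchange : ∀ a b c d → (a xor b) xor (c xor d) ≡ (a xor c) xor (b xor d)
      xor-interchange true true true true = refl
      xor-interchange true true true false = refl
      xor-interchange true true false true = refl
      xor-interchange true true false false = refl
      xor-interchange true false true true = refl
      xor-interchange true false true false = refl
      xor-interchange true false false true = refl
      xor-interchange true false false false = refl
      xor-interchange false true true true = refl
      xor-interchange false true true false = refl
      xor-interchange false true false true = refl
      xor-interchange false true false false = refl
      xor-interchange false false c d = refl
      B⇒¬C′ : ∀ b {c} → b ≡ true → c ∧ not b ≡ false
      B⇒¬C′ true {true} _ = refl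
      B⇒¬C′ true {false} _ = refl
      covered : ∀ e b → B e ≡ b → C e ≡ true → Any (λ B → B e ≡ true) (B ∷ Bs)
      covered e true Be Ce = here Be
      covered e false Be Ce = there (cov e (cong₂ _∧_ Ce (cong not Be)))

  union : List (EdgeSet ends) → EdgeSet ends
  union [] e = false
  union (B ∷ Bs) e = B e ∨ union Bs e

  union⇒Any : ∀ Bs {e} → union Bs e ≡ true → Any (λ B → B e ≡ true) Bs
  union⇒Any (B ∷ Bs) {e} h = [ here , there ∘ union⇒Any Bs ]′ (∨-true {B e} h)

  Any⇒union : ∀ {Bs e} → Any (λ B → B e ≡ true) Bs → union Bs e ≡ true
  Any⇒union (here h) = ∨-introˡ h
  Any⇒union {B ∷ Bs} {e} (there a) = ∨-introʳ {B e} (Any⇒union a)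

  bond-drop : ∀ {B} → IsDirectedBond ends ρ B → IsDrop (ι ∘ B)
  bond-drop {B} (_ , S , B≡ , inj₁ out) = ι ∘ S , λ e → value e (B e) refl
    where
    value : ∀ e b → B e ≡ b → ι b ≡ drop (ι ∘ S) e
    value e true Be with S (tl e) | S (hd e) | out e Be | trans (sym (cutOf≡ S e)) (trans (sym (B≡ e)) Be)
    ... | true | false | _ | _ = refl
    value e false Be = sym (trans (cong (λ b → ι b + - ι (S (hd e))) (cut-ends {S} e (trans (sym (B≡ e)) Be)))
        (ℤ.+-inverseʳ (ι (S (hd e)))))
  bond-drop {B} (_ , S , B≡ , inj₂ inw) = (λ v → - ι (S v)) , λ e → value e (B e) refl
    where
    value : ∀ e b → B e ≡ b → ι b ≡ drop (λ v → - ι (S v)) e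
    value e true Be with S (tl e) | S (hd e) | inw e Be | trans (sym (cutOf≡ S e)) (trans (sym (B≡ e)) Be)
    ... | false | true | _ | _ = refl
    value e false Be = sym (trans (cong (λ b → - ι b + - - ι (S (hd e))) (cut-ends {S} e (trans (sym (B≡ e)) Be)))
        (ℤ.+-inverseʳ (- ι (S (hd e)))))

  union-drop : ∀ {Bs} → All (IsDirectedBond ends ρ) Bs → AllPairs (DisjointE ends) Bs → IsDrop (ι ∘ union Bs)
  union-drop [] [] = (λ _ → 0ℤ) , λ _ → refl
  union-drop {B ∷ Bs} (d ∷ ds) (a ∷ as) with bond-drop d | union-drop ds as
  ... | h , p | k , q = (λ v → h v + k v) , λ e → trans (ι-∨ (B e) (union Bs e) (λ Be Ue → disjoint e Be (union⇒Any Bs Ue)))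
      (trans (cong₂ _+_ (p e) (q e)) (lem (h (tl e)) (h (hd e)) (k (tl e)) (k (hd e))))
    where
    lem : ∀ a b c d → (a + - b) + (c + - d) ≡ (a + c) + - (b + d)
    lem = solve-∀
    ι-∨ : ∀ b c → (b ≡ true → c ≡ true → ⊥) → ι (b ∨ c) ≡ ι b + ι c
    ι-∨ true true f = ⊥-elim (f refl refl)
    ι-∨ true false _ = refl
    ι-∨ false true _ = refl
    ι-∨ false false _ = refl
    disjoint : ∀ e → B e ≡ true → Any (λ B → B e ≡ true) Bs → ⊥
    disjoint e Be any = All.lookupWith (λ dj B₂e → dj e Be B₂e) a any

  cut⇒drop : ∀ {C} → IsLocallyDirectedCut ends ρ C → IsDrop (ι ∘ C)
  cut⇒drop {C} (_ , Bs , dir , dis , cov , inn) with union-drop dir dis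
  ... | h , p = h , λ e → trans (cong ι (⇔⇒≡ (Any⇒union ∘ cov e) (inn e ∘ union⇒Any Bs))) (p e)

  ce⇒shift : ∀ {σ} → _∼ce_ ends ρ σ → Σ[ φ ∈ V m ] Σ[ γ ∈ V m ] Tension [] ends φ × Flow [] ends γ ×
    (∀ e → ι (lookup ρ e) ≡ ι (lookup σ e) + (φ e + γ e))
  ce⇒shift {σ} (C , D , cut , eul , dis , fwd , bwd) = directed sg C , directed sg D ,
    drop⇒tension (cut⇒drop cut) , eulerian⇒flow eul ,
    λ e → value (sg e) (lookup σ e) (C e) (D e) (dis e) (fwd e) (bwd e)
    where
    value : ∀ r t c d → (c ≡ true → d ≡ true → ⊥) → (r xor t ≡ true → c ≡ true ⊎ d ≡ true) →
      (c ≡ true ⊎ d ≡ true → r xor t ≡ true) → ι r ≡ ι t + (sgn r (ι c) + sgn r (ι d))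
    value r t true true dj _ _ = ⊥-elim (dj refl refl)
    value true true true false _ _ b = true≢false (sym (b (inj₁ refl)))
    value true false true false _ _ _ = refl
    value false true true false _ _ _ = refl
    value false false true false _ _ b = true≢false (sym (b (inj₁ refl)))
    value true true false true _ _ b = true≢false (sym (b (inj₂ refl)))
    value true false false true _ _ _ = refl
    value false true false true _ _ _ = refl
    value false false false true _ _ b = true≢false (sym (b (inj₂ refl)))
    value true true false false _ _ _ = refl
    value true false false false _ f _ = [ (λ ()) , (λ ()) ]′ (f refl)
    value false true false false _ f _ = [ (λ ()) , (λ ()) ]′ (f refl)
    value false false false false _ _ _ = refl

  -- Disjointness leaves at each edge a single summand, which must be the difference of the two
  -- signs. So `φ` and `γ` are the characteristic vectors of their supports directed by `ρ`, and
  -- these supports partition the reversed edges.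
  shift⇒ce : ∀ {σ φ γ} → Tension [] ends φ → Flow [] ends γ →
    (∀ e → ι (lookup ρ e) ≡ ι (lookup σ e) + (φ e + γ e)) → _∼ce_ ends ρ σ
  shift⇒ce {σ} {φ} {γ} Tφ Wγ eq = C , D , drop⇒cut _ C ℕ.≤-refl
      (tension⇒drop (IsSubgroup.resp (Tension-subgroup [] ends) (proj₁ ∘ val) Tφ)) ,
      flow⇒eulerian (IsSubgroup.resp (Flow-subgroup [] ends) (proj₁ ∘ proj₂ ∘ val) Wγ) ,
      (λ e → proj₁ (proj₂ (proj₂ (val e)))) , (λ e → proj₁ (proj₂ (proj₂ (proj₂ (val e))))) ,
          (λ e → proj₂ (proj₂ (proj₂ (proj₂ (val e)))))
    where
    nonzero : ℤ → Bool
    nonzero (+ zero) = false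
    nonzero _ = true
    C D : EdgeSet ends
    C e = nonzero (φ e)
    D e = nonzero (γ e)
    Value : Bool → Bool → ℤ → ℤ → Set
    Value r t x y = (x ≡ sgn r (ι (nonzero x))) × (y ≡ sgn r (ι (nonzero y))) ×
      (nonzero x ≡ true → nonzero y ≡ true → ⊥) ×
      (r xor t ≡ true → nonzero x ≡ true ⊎ nonzero y ≡ true) × (nonzero x ≡ true ⊎ nonzero y ≡ true → r xor t ≡ true)
    both-false : {A : Set} → false ≡ true ⊎ false ≡ true → A
    both-false (inj₁ ())
    both-false (inj₂ ())
    valˡ : ∀ r t y → y ≡ ι r + - ι t → Value r t 0ℤ y
    valˡ true true _ refl = refl , refl , (λ ()) , (λ ()) , both-false
    valˡ true false _ refl = refl , refl , (λ ()) , (λ _ → inj₂ refl) , λ _ → refl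
    valˡ false true _ refl = refl , refl , (λ ()) , (λ _ → inj₂ refl) , λ _ → refl
    valˡ false false _ refl = refl , refl , (λ ()) , (λ ()) , both-false
    valʳ : ∀ r t x → x ≡ ι r + - ι t → Value r t x 0ℤ
    valʳ true true _ refl = refl , refl , (λ ()) , (λ ()) , both-false
    valʳ true false _ refl = refl , refl , (λ _ ()) , (λ _ → inj₁ refl) , λ _ → refl
    valʳ false true _ refl = refl , refl , (λ _ ()) , (λ _ → inj₁ refl) , λ _ → refl
    valʳ false false _ refl = refl , refl , (λ ()) , (λ ()) , both-false
    solve-for : ∀ {a b z} → a ≡ b + z → z ≡ a + - b
    solve-for {a} {b} {z} e = +-cancel a z b (trans e (ℤ.+-comm b z))
    val : ∀ e → Value (lookup ρ e) (lookup σ e) (φ e) (γ e)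
    val e with φ e | γ e | unit-sum-disjoint {φ = φ} {γ} sg (lookup σ) (orthogonal [] ends {φ} {γ} Tφ Wγ) eq e | eq e
    ... | _ | y | inj₁ refl | eqe = valˡ (lookup ρ e) (lookup σ e) y
        (solve-for (trans eqe (cong (λ z → ι (lookup σ e) + z) (ℤ.+-identityˡ y))))
    ... | x | _ | inj₂ refl | eqe = valʳ (lookup ρ e) (lookup σ e) x
        (solve-for (trans eqe (cong (λ z → ι (lookup σ e) + z) (ℤ.+-identityʳ x))))

-- Representatives

AllPairs-lookup : ∀ {A : Set} {R : A → A → Set} {xs} → AllPairs R xs → ∀ {x y} → x ∈ xs → y ∈ xs →
  x ≡ y ⊎ (R x y ⊎ R y x)
AllPairs-lookup (r ∷ rs) (here refl) (here refl) = inj₁ refl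
AllPairs-lookup (r ∷ rs) (here refl) (there j) = inj₂ (inj₁ (All.lookup r j))
AllPairs-lookup (r ∷ rs) (there i) (here refl) = inj₂ (inj₂ (All.lookup r i))
AllPairs-lookup (r ∷ rs) (there i) (there j) = AllPairs-lookup rs i j

lookup-injective : ∀ {A : Set} {k} {v w : Vec A k} → lookup v ≗ lookup w → v ≡ w
lookup-injective {v = v} {w} eq = trans (sym (tabulate∘lookup v)) (trans (tabulate-cong eq) (tabulate∘lookup w))

module _ {n m : ℕ} (ends : Ends n m) (reps : List (Orientation m)) (sdr : IsSDR ends reps) (p q : ℕ) where
  private
    M = graph [] ends
    St = State p q (Tension [] ends) (Flow [] ends)

  fromTriple : ∀ t → IsCounted ends reps p q t → St
  fromTriple (ρ , f , g) (_ , (h , tension) , flow , f≤p , g≤q) =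
    mkState (lookup ρ) (lookup f) (lookup g) f≤p g≤q (drop⇒tension (h , tension)) (isFlow⇒flow (λ e → + lookup g e) flow)
    where open Oriented ends ρ

  toTriple : Orientation m → St → Triple ends
  toTriple ρ y = ρ , Vec.tabulate (f y) , Vec.tabulate (g y)

  toTriple-counted : ∀ {ρ y} → ρ ∈ reps → s y ≗ lookup ρ → IsCounted ends reps p q (toTriple ρ y)
  toTriple-counted {ρ} {y} i eq = i
    , tension⇒drop (IsSubgroup.resp (Tension-subgroup [] ends)
        (λ e → cong₂ (λ b k → sgn b (+ k)) (eq e) (sym (lookup∘tabulate (f y) e))) (TF y))
    , flow⇒isFlow (λ e → + lookup (Vec.tabulate (g y)) e)
        (IsSubgroup.resp (Flow-subgroup [] ends) (λ e → cong₂ (λ b k → sgn b (+ k)) (eq e) (sym (lookup∘tabulate (g y) e))) (WG y))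
    , (λ e → subst (ℕ._≤ p) (sym (lookup∘tabulate (f y) e)) (f≤p y e))
    , (λ e → subst (ℕ._≤ q) (sym (lookup∘tabulate (g y) e)) (g≤q y e))
    where open Oriented ends ρ

  opaque
    -- The equivalence supplied by `sdr` leads from `ρ` to the orientation of `x`, whereas the state
    -- has to move from `x` to `ρ`; hence the negated translation.
    represent : (x : St) → Σ[ ρ ∈ Orientation m ] ρ ∈ reps × Σ[ y ∈ St ] s y ≗ lookup ρ × x ≈ y
    represent x with find (proj₁ sdr (Vec.tabulate (s x)))
    ... | ρ , i , r with Oriented.ce⇒shift ends ρ {Vec.tabulate (s x)} r
    ... | φ , γ , Tφ , Wγ , eq with move M x (lookup ρ) (IsSubgroup.neg (Tension-subgroup [] ends) Tφ)
        (IsSubgroup.neg (Flow-subgroup [] ends) Wγ) eq′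
      where
      eq′ : ∀ e → ι (s x e) ≡ ι (lookup ρ e) + (- φ e + - γ e)
      eq′ e = trans (+-cancel (ι (lookup ρ e)) (ι (s x e)) (φ e + γ e)
          (trans (eq e) (cong (λ b → ι b + (φ e + γ e)) (lookup∘tabulate (s x) e))))
        (cong (λ z → ι (lookup ρ e) + z) (ℤ.neg-distrib-+ (φ e) (γ e)))
    ... | y , s≡ , sh = ρ , i , y , (λ e → cong (λ t → t e) s≡) , mk≈ (IsSubgroup.neg (Tension-subgroup [] ends) Tφ)
        (IsSubgroup.neg (Flow-subgroup [] ends) Wγ) sh

  ≈⇒ce : ∀ {ρ σ} {x y : St} → s x ≗ lookup ρ → s y ≗ lookup σ → x ≈ y → _∼ce_ ends ρ σ
  ≈⇒ce {ρ} {σ} ex ey r = Oriented.shift⇒ce ends ρ {σ} (Tφ r) (Wγ r)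
    (λ e → trans (cong ι (sym (ex e))) (trans (eq-s r e) (cong (λ b → ι b + (φ r e + γ r e)) (ey e))))

  same-orientation : ∀ {x y : St} → s x ≗ s y → x ≈ y → f x ≗ f y × g x ≗ g y
  same-orientation {x} {y} es r = (λ e → value p (es e) (eq-F r e) (proj₁ (same-sign M r e (es e)))) ,
      (λ e → value q (es e) (eq-G r e) (proj₂ (same-sign M r e (es e))))
    where
    value : ∀ n {b b′ k l c} → b ≡ b′ → sgn b (+ k) ≡ sgn b′ (+ l) + + n * c → c ≡ 0ℤ → k ≡ l
    value n {b} {k = k} {l} refl eq refl = ℤ.+-injective (sgn-injective b (trans eq (+-*0 (sgn b (+ l)) n)))

  -- `AllPairs` excludes equivalence only in the order of the list, so both directions are supplied;
  -- they come from the symmetry of `≈`.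
  reps-distinct : ∀ {ρ σ} → ρ ∈ reps → σ ∈ reps → _∼ce_ ends ρ σ → _∼ce_ ends σ ρ → ρ ≡ σ
  reps-distinct i j r r′ with AllPairs-lookup (proj₂ sdr) i j
  ... | inj₁ eq = eq
  ... | inj₂ (inj₁ ¬r) = ⊥-elim (¬r r)
  ... | inj₂ (inj₂ ¬r) = ⊥-elim (¬r r′)

  -- Each class of states contains exactly one counted triple. Its orientation is the unique
  -- representative equivalent to the given one, and by `same-orientation` the orientation fixes the
  -- values within the class.
  triples : ∀ {k} → Enumeration {p = p} {q} {Tension [] ends} {Flow [] ends} (λ _ → ⊤) k →
    Σ[ L ∈ List (Triple ends) ] (Unique L × (∀ t → t ∈ L → IsCounted ends reps p q t)
      × (∀ t → IsCounted ends reps p q t → t ∈ L) × length L ≡ k)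
  triples {k} E = List.tabulate triple , tabulate⁺ (λ {i} {j} → injective i j)
      , (λ t i → let (j , eq) = ∈-tabulate⁻ i in subst (IsCounted ends reps p q) (sym eq) (toTriple-counted {ρ j} {y j} (ρ∈ j) (s≗ j)))
      , complete′ , length-tabulate triple
    where
    open Enumeration E
    ρ : Fin k → Orientation m
    ρ i = proj₁ (represent (elt i))
    ρ∈ : ∀ i → ρ i ∈ reps
    ρ∈ i = proj₁ (proj₂ (represent (elt i)))
    y : Fin k → St
    y i = proj₁ (proj₂ (proj₂ (represent (elt i))))
    s≗ : ∀ i → s (y i) ≗ lookup (ρ i)
    s≗ i = proj₁ (proj₂ (proj₂ (proj₂ (represent (elt i)))))
    elt≈ : ∀ i → elt i ≈ y i
    elt≈ i = proj₂ (proj₂ (proj₂ (proj₂ (represent (elt i)))))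
    triple : Fin k → Triple ends
    triple i = toTriple (ρ i) (y i)
    untabulate : ∀ (a b : Fin m → ℕ) → Vec.tabulate a ≡ Vec.tabulate b → a ≗ b
    untabulate a b eq e = trans (sym (lookup∘tabulate a e)) (trans (cong (λ v → lookup v e) eq) (lookup∘tabulate b e))
    injective : ∀ i j → triple i ≡ triple j → i ≡ j
    injective i j eq = distinct i j (≈-trans M {x = elt i} {y i} {elt j} (elt≈ i)
        (≈-trans M {x = y i} {y j} {elt j} y≈y (≈-sym M {x = elt j} {y j} (elt≈ j))))
      where
      ρ≡ : ρ i ≡ ρ j
      ρ≡ = cong proj₁ eq
      f≡ : Vec.tabulate (f (y i)) ≡ Vec.tabulate (f (y j))
      f≡ = cong (proj₁ ∘ proj₂) eq
      g≡ : Vec.tabulate (g (y i)) ≡ Vec.tabulate (g (y j))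
      g≡ = cong (proj₂ ∘ proj₂) eq
      y≈y : y i ≈ y j
      y≈y = pointwise-≈ M {x = y i} {y j} (λ e → trans (s≗ i e) (trans (cong (λ τ → lookup τ e) ρ≡) (sym (s≗ j e))))
        (untabulate (f (y i)) (f (y j)) f≡) (untabulate (g (y i)) (g (y j)) g≡)
    complete′ : ∀ t → IsCounted ends reps p q t → t ∈ List.tabulate triple
    complete′ (σ , fv , gv) ct = subst (_∈ List.tabulate triple) (sym t≡) (∈-tabulate⁺ {f = triple} i)
      where
      x : St
      x = fromTriple (σ , fv , gv) ct
      i : Fin k
      i = proj₁ (complete x tt)
      x≈y : x ≈ y i
      x≈y = ≈-trans M {x = x} {elt i} {y i} (proj₂ (complete x tt)) (elt≈ i)
      σ≡ρ : σ ≡ ρ i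
      σ≡ρ = reps-distinct {σ} {ρ i} (proj₁ ct) (ρ∈ i) (≈⇒ce {σ} {ρ i} {x} {y i} (λ _ → refl) (s≗ i) x≈y)
        (≈⇒ce {ρ i} {σ} {y i} {x} (s≗ i) (λ _ → refl) (≈-sym M {x = x} {y i} x≈y))
      s≗y : s x ≗ s (y i)
      s≗y e = trans (cong (λ τ → lookup τ e) σ≡ρ) (sym (s≗ i e))
      same : lookup fv ≗ f (y i) × lookup gv ≗ g (y i)
      same = same-orientation {x} {y i} s≗y x≈y
      f≡ : fv ≡ Vec.tabulate (f (y i))
      f≡ = lookup-injective (λ e → trans (proj₁ same e) (sym (lookup∘tabulate (f (y i)) e)))
      g≡ : gv ≡ Vec.tabulate (g (y i))
      g≡ = lookup-injective (λ e → trans (proj₂ same e) (sym (lookup∘tabulate (g (y i)) e)))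
      t≡ : (σ , fv , gv) ≡ triple i
      t≡ = cong₂ _,_ σ≡ρ (cong₂ _,_ f≡ g≡)

theorem1p3 : (n m : ℕ) (ends : Ends n m) (reps : List (Orientation m)) →
    IsSDR ends reps → (p q : ℕ) →
    Σ[ L ∈ List (Triple ends) ]
    (Unique L
    × (∀ t → t ∈ L → IsCounted ends reps p q t)
    × (∀ t → IsCounted ends reps p q t → t ∈ L)
    × length L ≡ whitneyR ends p q)
theorem1p3 n m ends reps sdr p q =
  triples ends reps sdr p q (recount (sym (whitneyR≡relR p q ends)) (enumerate-graph p q m [] ends))
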